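{- Let $K$ be one of the fields $\mathbb{Q}_2(\sqrt{2}),\ \mathbb{Q}_2(\sqrt{10}),\ \mathbb{Q}_2(\sqrt{ -2}),\ \mathbb{Q}_2(\sqrt{ -10})$. Then $\Gamma^*(4,K)=11$. That is: every additive form $a_1x_1^4+\cdots+a_sx_s^4$ with $a_i\in K$ and $s\ge 11$ has a nontrivial zero in $K^s$, and there exist $a_1,\dots,a_{10}\in K$ such that $a_1x_1^4+\cdots+a_{10}x_{10}^4$ has no nontrivial zero in $K^{10}$.
   Context: For a field $K$ and integer $d\ge1$, $\Gamma^*(d,K)$ denotes the least integer $s$ such that every additive form $a_1x_1^d+\cdots+a_sx_s^d$ with coefficients $a_i\in K$ has a nontrivial zero (a zero in $K^s$ other than $(0,\dots,0)$). -}

module Defs where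

open import Algebra.Bundles using (CommutativeRing)
open import Data.Fin.Base using (Fin)
open import Data.Integer.Base as ℤ using (ℤ; +_)
import Data.Integer.Properties as ℤ
open import Data.Integer.Divisibility.Signed as ℤ using (divides)
open import Data.Integer.Tactic.RingSolver using (solve-∀)
open import Data.Nat.Base as ℕ using (ℕ; zero; suc; _≤_)
import Data.Nat.Properties as ℕ
open import Data.Product.Base using (_×_; _,_; ∃-syntax)
open import Data.Vec.Functional using (Vector)
open import Level using (Level; 0ℓ; _⊔_)
open import Relation.Binary.PropositionalEquality as ≡ using (_≡_)
open import Relation.Nullary.Negation using (¬_)

private variable
  c ℓ : Level

module AdditiveForms (K : CommutativeRing c ℓ) where
  open CommutativeRing K
  open import Algebra.Properties.Semiring.Exp semiring using (_^_)
  open import Algebra.Properties.Semiring.Sum semiring using (sum)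

  additiveForm : ℕ → ∀ {s} → Vector Carrier s → Vector Carrier s → Carrier
  additiveForm d a x = sum (λ i → a i * x i ^ d)

  HasNontrivialZero : ℕ → ∀ {s} → Vector Carrier s → Set (c ⊔ ℓ)
  HasNontrivialZero d {s} a =
    ∃[ x ] (¬ (∀ (i : Fin s) → x i ≈ 0#)) × additiveForm d a x ≈ 0#

  EveryFormIsotropic : ℕ → ℕ → Set (c ⊔ ℓ)
  EveryFormIsotropic d s = ∀ (a : Vector Carrier s) → HasNontrivialZero d a

  Γ*[_]≡_ : ℕ → ℕ → Set (c ⊔ ℓ)
  Γ*[ d ]≡ s =
    EveryFormIsotropic d s × (∀ t → EveryFormIsotropic d t → s ≤ t)

-- ℤ₂ as the inverse limit of the rings ℤ/2ⁿ.  The residue in ℤ/2ⁿ is given by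
-- an arbitrary integer representative, so equality is congruence at every level.

record ℤ₂ : Set where
  constructor mkℤ₂
  field
    residue  : ℕ → ℤ
    coherent : ∀ n → (+ 2) ℤ.^ n ℤ.∣ residue (suc n) ℤ.- residue n

open ℤ₂ public

infix 4 _≈ℤ₂_
record _≈ℤ₂_ (x y : ℤ₂) : Set where
  constructor mk≈
  field
    congruent : ∀ n → (+ 2) ℤ.^ n ℤ.∣ residue x n ℤ.- residue y n

open _≈ℤ₂_ public

private
  ∣-+ : ∀ {m} a b x y → m ℤ.∣ a ℤ.- b → m ℤ.∣ x ℤ.- y →
        m ℤ.∣ (a ℤ.+ x) ℤ.- (b ℤ.+ y)
  ∣-+ a b x y p q = ≡.subst (_ ℤ.∣_) (eq a b x y) (ℤ.∣m∣n⇒∣m+n p q)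
    where
    eq : ∀ a b x y → (a ℤ.- b) ℤ.+ (x ℤ.- y) ≡ (a ℤ.+ x) ℤ.- (b ℤ.+ y)
    eq = solve-∀

  ∣-neg : ∀ {m} a b → m ℤ.∣ a ℤ.- b → m ℤ.∣ (ℤ.- a) ℤ.- (ℤ.- b)
  ∣-neg a b p = ≡.subst (_ ℤ.∣_) (eq a b) (ℤ.∣m⇒∣-m p)
    where
    eq : ∀ a b → ℤ.- (a ℤ.- b) ≡ (ℤ.- a) ℤ.- (ℤ.- b)
    eq = solve-∀

  ∣-* : ∀ {m} a b x y → m ℤ.∣ a ℤ.- b → m ℤ.∣ x ℤ.- y →
        m ℤ.∣ (a ℤ.* x) ℤ.- (b ℤ.* y)
  ∣-* a b x y p q =
    ≡.subst (_ ℤ.∣_) (eq a b x y) (ℤ.∣m∣n⇒∣m+n (ℤ.∣n⇒∣m*n a q) (ℤ.∣m⇒∣m*n y p))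
    where
    eq : ∀ a b x y →
         a ℤ.* (x ℤ.- y) ℤ.+ (a ℤ.- b) ℤ.* y ≡ (a ℤ.* x) ℤ.- (b ℤ.* y)
    eq = solve-∀

  ∣-sym : ∀ {m} a b → m ℤ.∣ a ℤ.- b → m ℤ.∣ b ℤ.- a
  ∣-sym a b p = ≡.subst (_ ℤ.∣_) (eq a b) (ℤ.∣m⇒∣-m p)
    where
    eq : ∀ a b → ℤ.- (a ℤ.- b) ≡ b ℤ.- a
    eq = solve-∀

  ∣-trans : ∀ {m} a b d → m ℤ.∣ a ℤ.- b → m ℤ.∣ b ℤ.- d → m ℤ.∣ a ℤ.- d
  ∣-trans a b d p q = ≡.subst (_ ℤ.∣_) (eq a b d) (ℤ.∣m∣n⇒∣m+n p q)
    where
    eq : ∀ a b d → (a ℤ.- b) ℤ.+ (b ℤ.- d) ≡ a ℤ.- d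
    eq = solve-∀

  ∣-reflexive : ∀ {m a b} → a ≡ b → m ℤ.∣ a ℤ.- b
  ∣-reflexive {m} {a} ≡.refl = divides (+ 0) (ℤ.+-inverseʳ a)

ℤ⇒ℤ₂ : ℤ → ℤ₂
ℤ⇒ℤ₂ a = mkℤ₂ (λ _ → a) (λ _ → ∣-reflexive {a = a} ≡.refl)

infixl 6 _+ℤ₂_
_+ℤ₂_ : ℤ₂ → ℤ₂ → ℤ₂
x +ℤ₂ y = mkℤ₂ (λ n → residue x n ℤ.+ residue y n)
  λ n → ∣-+ (residue x (suc n)) (residue x n) (residue y (suc n)) (residue y n)
          (coherent x n) (coherent y n)

infixl 7 _*ℤ₂_
_*ℤ₂_ : ℤ₂ → ℤ₂ → ℤ₂
x *ℤ₂ y = mkℤ₂ (λ n → residue x n ℤ.* residue y n)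
  λ n → ∣-* (residue x (suc n)) (residue x n) (residue y (suc n)) (residue y n)
          (coherent x n) (coherent y n)

infix 8 -ℤ₂_
-ℤ₂_ : ℤ₂ → ℤ₂
-ℤ₂ x = mkℤ₂ (λ n → ℤ.- residue x n)
  λ n → ∣-neg (residue x (suc n)) (residue x n) (coherent x n)

ℤ₂-commutativeRing : CommutativeRing 0ℓ 0ℓ
ℤ₂-commutativeRing = record
  { Carrier = ℤ₂
  ; _≈_ = _≈ℤ₂_
  ; _+_ = _+ℤ₂_
  ; _*_ = _*ℤ₂_
  ; -_ = -ℤ₂_
  ; 0# = ℤ⇒ℤ₂ (+ 0)
  ; 1# = ℤ⇒ℤ₂ (+ 1)
  ; isCommutativeRing = record
    { isRing = record
      { +-isAbelianGroup = record
        { isGroup = record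
          { isMonoid = record
            { isSemigroup = record
              { isMagma = record
                { isEquivalence = record
                  { refl  = pointwise λ _ → ≡.refl
                  ; sym   = λ {x} {y} p → mk≈ λ n →
                      ∣-sym (residue x n) (residue y n) (congruent p n)
                  ; trans = λ {x} {y} {z} p q → mk≈ λ n →
                      ∣-trans (residue x n) (residue y n) (residue z n)
                        (congruent p n) (congruent q n)
                  }
                ; ∙-cong = λ {x} {y} {u} {v} p q → mk≈ λ n →
                    ∣-+ (residue x n) (residue y n) (residue u n) (residue v n)
                      (congruent p n) (congruent q n)
                }
              ; assoc = λ x y z → pointwise λ n → ℤ.+-assoc (residue x n) _ _
              }
            ; identity = (λ x → pointwise λ n → ℤ.+-identityˡ _)
                       , (λ x → pointwise λ n → ℤ.+-identityʳ _)
            }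
          ; inverse = (λ x → pointwise λ n → ℤ.+-inverseˡ (residue x n))
                    , (λ x → pointwise λ n → ℤ.+-inverseʳ (residue x n))
          ; ⁻¹-cong = λ {x} {y} p → mk≈ λ n →
              ∣-neg (residue x n) (residue y n) (congruent p n)
          }
        ; comm = λ x y → pointwise λ n → ℤ.+-comm (residue x n) _
        }
      ; *-cong = λ {x} {y} {u} {v} p q → mk≈ λ n →
          ∣-* (residue x n) (residue y n) (residue u n) (residue v n)
            (congruent p n) (congruent q n)
      ; *-assoc = λ x y z → pointwise λ n → ℤ.*-assoc (residue x n) _ _
      ; *-identity = (λ x → pointwise λ n → ℤ.*-identityˡ _)
                   , (λ x → pointwise λ n → ℤ.*-identityʳ _)
      ; distrib = (λ x y z → pointwise λ n → ℤ.*-distribˡ-+ (residue x n) _ _)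
                , (λ x y z → pointwise λ n → ℤ.*-distribʳ-+ (residue x n) (residue y n) _)
      }
    ; *-comm = λ x y → pointwise λ n → ℤ.*-comm (residue x n) _
    }
  }
  where
  pointwise : ∀ {x y} → (∀ n → residue x n ≡ residue y n) → x ≈ℤ₂ y
  pointwise p = mk≈ λ n → ∣-reflexive (p n)

2-cancelˡ : ∀ x y → ℤ⇒ℤ₂ (+ 2) *ℤ₂ x ≈ℤ₂ ℤ⇒ℤ₂ (+ 2) *ℤ₂ y → x ≈ℤ₂ y
2-cancelˡ x y p = mk≈ λ n →
  let x′ = residue x (suc n)
      y′ = residue y (suc n)
      2∣ = ≡.subst (_ ℤ.∣_) (factor x′ y′) (congruent p (suc n))
  in ∣-trans (residue x n) x′ (residue y n)
       (∣-sym x′ (residue x n) (coherent x n))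
       (∣-trans x′ y′ (residue y n)
         (ℤ.*-cancelˡ-∣ (+ 2) 2∣)
         (coherent y n))
  where
  factor : ∀ a b → + 2 ℤ.* a ℤ.- + 2 ℤ.* b ≡ + 2 ℤ.* (a ℤ.- b)
  factor = solve-∀

-- R[1/t] for t a non-zero-divisor; num / exp stands for num / t ^ exp.

module Localization
  (R : CommutativeRing c ℓ) (t : CommutativeRing.Carrier R)
  (t-cancelˡ : ∀ x y → CommutativeRing._≈_ R (CommutativeRing._*_ R t x)
                                            (CommutativeRing._*_ R t y) →
               CommutativeRing._≈_ R x y)
  where
  open CommutativeRing R
  open import Algebra.Properties.Semiring.Exp semiring using (_^_; ^-homo-*)
  open import Algebra.Properties.Ring ring using (-‿distribˡ-*)
  open import Algebra.Solver.Ring.NaturalCoefficients.Default commutativeSemiring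
  open import Relation.Binary.Reasoning.Setoid setoid

  record Fraction : Set c where
    constructor _/t^_
    field
      num : Carrier
      exp : ℕ

  open Fraction public

  infix 4 _≈ᶠ_
  record _≈ᶠ_ (x y : Fraction) : Set ℓ where
    constructor mk≈ᶠ
    field
      cross : num x * t ^ exp y ≈ num y * t ^ exp x

  open _≈ᶠ_ public

  _+ᶠ_ _*ᶠ_ : Fraction → Fraction → Fraction
  (a /t^ k) +ᶠ (b /t^ l) = (a * t ^ l + b * t ^ k) /t^ (k ℕ.+ l)
  (a /t^ k) *ᶠ (b /t^ l) = (a * b) /t^ (k ℕ.+ l)

  -ᶠ_ : Fraction → Fraction
  -ᶠ (a /t^ k) = (- a) /t^ k

  embed : Carrier → Fraction
  embed a = a /t^ 0

  private
    t^-cancelʳ : ∀ k x y → x * t ^ k ≈ y * t ^ k → x ≈ y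
    t^-cancelʳ zero    x y p = trans (sym (*-identityʳ x)) (trans p (*-identityʳ y))
    t^-cancelʳ (suc k) x y p = t^-cancelʳ k x y (t-cancelˡ _ _ (begin
      t * (x * t ^ k)  ≈⟨ swap t x (t ^ k) ⟩
      x * (t * t ^ k)  ≈⟨ p ⟩
      y * (t * t ^ k)  ≈⟨ swap t y (t ^ k) ⟨
      t * (y * t ^ k)  ∎))
      where
      swap : ∀ a b e → a * (b * e) ≈ b * (a * e)
      swap = solve 3 (λ a b e → a :* (b :* e) := b :* (a :* e)) refl

    ≈ᶠ-trans : ∀ {x y z} → x ≈ᶠ y → y ≈ᶠ z → x ≈ᶠ z
    ≈ᶠ-trans {a /t^ k} {b /t^ l} {d /t^ m} (mk≈ᶠ p) (mk≈ᶠ q) =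
      mk≈ᶠ (t^-cancelʳ l _ _ (begin
        a * t ^ m * t ^ l  ≈⟨ swap a (t ^ m) (t ^ l) ⟩
        a * t ^ l * t ^ m  ≈⟨ *-congʳ p ⟩
        b * t ^ k * t ^ m  ≈⟨ swap b (t ^ k) (t ^ m) ⟩
        b * t ^ m * t ^ k  ≈⟨ *-congʳ q ⟩
        d * t ^ l * t ^ k  ≈⟨ swap d (t ^ l) (t ^ k) ⟩
        d * t ^ k * t ^ l  ∎))
      where
      swap : ∀ a b e → a * b * e ≈ a * e * b
      swap = solve 3 (λ a b e → a :* b :* e := a :* e :* b) refl

    +ᶠ-cong : ∀ {x y u v} → x ≈ᶠ y → u ≈ᶠ v → (x +ᶠ u) ≈ᶠ (y +ᶠ v)
    +ᶠ-cong {a /t^ k} {b /t^ l} {d /t^ m} {e /t^ n} (mk≈ᶠ p) (mk≈ᶠ q) = mk≈ᶠ (begin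
      (a * M + d * K) * t ^ (l ℕ.+ n)            ≈⟨ *-congˡ (^-homo-* t l n) ⟩
      (a * M + d * K) * (L * N)                  ≈⟨ expand a d K L M N ⟩
      (a * L) * (M * N) + (d * N) * (K * L)      ≈⟨ +-cong (*-congʳ p) (*-congʳ q) ⟩
      (b * K) * (M * N) + (e * M) * (K * L)      ≈⟨ collect b e K L M N ⟩
      (b * N + e * L) * (K * M)                  ≈⟨ *-congˡ (^-homo-* t k m) ⟨
      (b * N + e * L) * t ^ (k ℕ.+ m)            ∎)
      where
      K = t ^ k
      L = t ^ l
      M = t ^ m
      N = t ^ n
      expand : ∀ a d K L M N →
        (a * M + d * K) * (L * N) ≈ (a * L) * (M * N) + (d * N) * (K * L)
      expand = solve 6 (λ a d K L M N →
        (a :* M :+ d :* K) :* (L :* N) := (a :* L) :* (M :* N) :+ (d :* N) :* (K :* L)) refl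
      collect : ∀ b e K L M N →
        (b * K) * (M * N) + (e * M) * (K * L) ≈ (b * N + e * L) * (K * M)
      collect = solve 6 (λ b e K L M N →
        (b :* K) :* (M :* N) :+ (e :* M) :* (K :* L) := (b :* N :+ e :* L) :* (K :* M)) refl

    *ᶠ-cong : ∀ {x y u v} → x ≈ᶠ y → u ≈ᶠ v → (x *ᶠ u) ≈ᶠ (y *ᶠ v)
    *ᶠ-cong {a /t^ k} {b /t^ l} {d /t^ m} {e /t^ n} (mk≈ᶠ p) (mk≈ᶠ q) = mk≈ᶠ (begin
      (a * d) * t ^ (l ℕ.+ n)      ≈⟨ *-congˡ (^-homo-* t l n) ⟩
      (a * d) * (t ^ l * t ^ n)    ≈⟨ swap a d (t ^ l) (t ^ n) ⟩
      (a * t ^ l) * (d * t ^ n)    ≈⟨ *-cong p q ⟩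
      (b * t ^ k) * (e * t ^ m)    ≈⟨ swap b e (t ^ k) (t ^ m) ⟨
      (b * e) * (t ^ k * t ^ m)    ≈⟨ *-congˡ (^-homo-* t k m) ⟨
      (b * e) * t ^ (k ℕ.+ m)      ∎)
      where
      swap : ∀ a b x y → (a * b) * (x * y) ≈ (a * x) * (b * y)
      swap = solve 4 (λ a b x y → (a :* b) :* (x :* y) := (a :* x) :* (b :* y)) refl

    -ᶠ-cong : ∀ {x y} → x ≈ᶠ y → (-ᶠ x) ≈ᶠ (-ᶠ y)
    -ᶠ-cong {a /t^ k} {b /t^ l} (mk≈ᶠ p) = mk≈ᶠ (begin
      (- a) * t ^ l  ≈⟨ -‿distribˡ-* a (t ^ l) ⟨
      - (a * t ^ l)  ≈⟨ -‿cong p ⟩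
      - (b * t ^ k)  ≈⟨ -‿distribˡ-* b (t ^ k) ⟩
      (- b) * t ^ k  ∎)

    same-exp : ∀ {a b k l} → a ≈ b → k ≡ l → (a /t^ k) ≈ᶠ (b /t^ l)
    same-exp p ≡.refl = mk≈ᶠ (*-congʳ p)

    +ᶠ-assoc : ∀ x y z → ((x +ᶠ y) +ᶠ z) ≈ᶠ (x +ᶠ (y +ᶠ z))
    +ᶠ-assoc (a /t^ k) (b /t^ l) (d /t^ m) = same-exp (begin
      (a * L + b * K) * M + d * t ^ (k ℕ.+ l)  ≈⟨ +-congˡ (*-congˡ (^-homo-* t k l)) ⟩
      (a * L + b * K) * M + d * (K * L)        ≈⟨ rearrange a b d K L M ⟩
      a * (L * M) + (b * M + d * L) * K        ≈⟨ +-congʳ (*-congˡ (^-homo-* t l m)) ⟨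
      a * t ^ (l ℕ.+ m) + (b * M + d * L) * K  ∎) (ℕ.+-assoc k l m)
      where
      K = t ^ k
      L = t ^ l
      M = t ^ m
      rearrange : ∀ a b d K L M →
        (a * L + b * K) * M + d * (K * L) ≈ a * (L * M) + (b * M + d * L) * K
      rearrange = solve 6 (λ a b d K L M →
        (a :* L :+ b :* K) :* M :+ d :* (K :* L) :=
        a :* (L :* M) :+ (b :* M :+ d :* L) :* K) refl

    +ᶠ-comm : ∀ x y → (x +ᶠ y) ≈ᶠ (y +ᶠ x)
    +ᶠ-comm (a /t^ k) (b /t^ l) = same-exp (+-comm _ _) (ℕ.+-comm k l)

    +ᶠ-identityˡ : ∀ x → (embed 0# +ᶠ x) ≈ᶠ x
    +ᶠ-identityˡ (a /t^ k) = same-exp (begin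
      0# * t ^ k + a * 1#  ≈⟨ +-cong (zeroˡ _) (*-identityʳ a) ⟩
      0# + a               ≈⟨ +-identityˡ a ⟩
      a                    ∎) ≡.refl

    +ᶠ-inverseˡ : ∀ x → ((-ᶠ x) +ᶠ x) ≈ᶠ embed 0#
    +ᶠ-inverseˡ (a /t^ k) = mk≈ᶠ (begin
      ((- a) * t ^ k + a * t ^ k) * 1#  ≈⟨ *-identityʳ _ ⟩
      (- a) * t ^ k + a * t ^ k         ≈⟨ distribʳ (t ^ k) (- a) a ⟨
      (- a + a) * t ^ k                 ≈⟨ *-congʳ (-‿inverseˡ a) ⟩
      0# * t ^ k                        ≈⟨ zeroˡ _ ⟩
      0#                                ≈⟨ zeroˡ _ ⟨
      0# * t ^ (k ℕ.+ k)                ∎)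

    *ᶠ-assoc : ∀ x y z → ((x *ᶠ y) *ᶠ z) ≈ᶠ (x *ᶠ (y *ᶠ z))
    *ᶠ-assoc (a /t^ k) (b /t^ l) (d /t^ m) = same-exp (*-assoc a b d) (ℕ.+-assoc k l m)

    *ᶠ-comm : ∀ x y → (x *ᶠ y) ≈ᶠ (y *ᶠ x)
    *ᶠ-comm (a /t^ k) (b /t^ l) = same-exp (*-comm a b) (ℕ.+-comm k l)

    *ᶠ-identityˡ : ∀ x → (embed 1# *ᶠ x) ≈ᶠ x
    *ᶠ-identityˡ (a /t^ k) = same-exp (*-identityˡ a) ≡.refl

    *ᶠ-distribˡ : ∀ x y z → (x *ᶠ (y +ᶠ z)) ≈ᶠ ((x *ᶠ y) +ᶠ (x *ᶠ z))
    *ᶠ-distribˡ (a /t^ k) (b /t^ l) (d /t^ m) = mk≈ᶠ (begin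
      a * (b * M + d * L) * t ^ ((k ℕ.+ l) ℕ.+ (k ℕ.+ m))
        ≈⟨ *-congˡ (trans (^-homo-* t (k ℕ.+ l) (k ℕ.+ m))
                          (*-cong (^-homo-* t k l) (^-homo-* t k m))) ⟩
      a * (b * M + d * L) * ((K * L) * (K * M))
        ≈⟨ rearrange a b d K L M ⟩
      ((a * b) * (K * M) + (a * d) * (K * L)) * (K * (L * M))
        ≈⟨ *-cong (+-cong (*-congˡ (^-homo-* t k m)) (*-congˡ (^-homo-* t k l)))
                  (trans (^-homo-* t k (l ℕ.+ m)) (*-congˡ (^-homo-* t l m))) ⟨
      ((a * b) * t ^ (k ℕ.+ m) + (a * d) * t ^ (k ℕ.+ l)) * t ^ (k ℕ.+ (l ℕ.+ m)) ∎)
      where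
      K = t ^ k
      L = t ^ l
      M = t ^ m
      rearrange : ∀ a b d K L M →
        a * (b * M + d * L) * ((K * L) * (K * M)) ≈
        ((a * b) * (K * M) + (a * d) * (K * L)) * (K * (L * M))
      rearrange = solve 6 (λ a b d K L M →
        a :* (b :* M :+ d :* L) :* ((K :* L) :* (K :* M)) :=
        ((a :* b) :* (K :* M) :+ (a :* d) :* (K :* L)) :* (K :* (L :* M))) refl

  commutativeRing : CommutativeRing c ℓ
  commutativeRing = record
    { Carrier = Fraction
    ; _≈_ = _≈ᶠ_
    ; _+_ = _+ᶠ_
    ; _*_ = _*ᶠ_
    ; -_ = -ᶠ_
    ; 0# = embed 0#
    ; 1# = embed 1#
    ; isCommutativeRing = record
      { isRing = record
        { +-isAbelianGroup = record
          { isGroup = record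
            { isMonoid = record
              { isSemigroup = record
                { isMagma = record
                  { isEquivalence = record
                    { refl  = mk≈ᶠ refl
                    ; sym   = λ p → mk≈ᶠ (sym (cross p))
                    ; trans = ≈ᶠ-trans
                    }
                  ; ∙-cong = +ᶠ-cong
                  }
                ; assoc = +ᶠ-assoc
                }
              ; identity = +ᶠ-identityˡ
                         , λ x → ≈ᶠ-trans (+ᶠ-comm x _) (+ᶠ-identityˡ x)
              }
            ; inverse = +ᶠ-inverseˡ
                      , λ x → ≈ᶠ-trans (+ᶠ-comm x _) (+ᶠ-inverseˡ x)
            ; ⁻¹-cong = -ᶠ-cong
            }
          ; comm = +ᶠ-comm
          }
        ; *-cong = *ᶠ-cong
        ; *-assoc = *ᶠ-assoc
        ; *-identity = *ᶠ-identityˡ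
                     , λ x → ≈ᶠ-trans (*ᶠ-comm x _) (*ᶠ-identityˡ x)
        ; distrib = *ᶠ-distribˡ
                  , λ x y z → ≈ᶠ-trans (*ᶠ-comm (y +ᶠ z) x)
                      (≈ᶠ-trans (*ᶠ-distribˡ x y z)
                        (+ᶠ-cong (*ᶠ-comm x y) (*ᶠ-comm x z)))
        }
      ; *-comm = *ᶠ-comm
      }
    }

-- R[X]/(X² − D), the pair re + im √ standing for re + im·X.

module AdjoinSqrt (R : CommutativeRing c ℓ) (D : CommutativeRing.Carrier R) where
  open CommutativeRing R
  open import Algebra.Solver.Ring.NaturalCoefficients.Default commutativeSemiring

  infix 5 _+_√
  record Element : Set c where
    constructor _+_√
    field
      re im : Carrier

  open Element public

  infix 4 _≈√_
  record _≈√_ (x y : Element) : Set ℓ where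
    constructor _,_
    field
      re-≈ : re x ≈ re y
      im-≈ : im x ≈ im y

  open _≈√_ public

  _+√_ _*√_ : Element → Element → Element
  x +√ y = (re x + re y) + (im x + im y) √
  x *√ y = (re x * re y + D * (im x * im y)) + (re x * im y + im x * re y) √

  -√_ : Element → Element
  -√ x = (- re x) + (- im x) √

  private
    *√-assoc : ∀ x y z → ((x *√ y) *√ z) ≈√ (x *√ (y *√ z))
    *√-assoc (a + b √) (e + f √) (g + h √) =
      solve 7 (λ D a b e f g h →
        (a :* e :+ D :* (b :* f)) :* g :+ D :* ((a :* f :+ b :* e) :* h) :=
        a :* (e :* g :+ D :* (f :* h)) :+ D :* (b :* (e :* h :+ f :* g)))
        refl D a b e f g h
      ,
      solve 7 (λ D a b e f g h →
        (a :* e :+ D :* (b :* f)) :* h :+ (a :* f :+ b :* e) :* g :=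
        a :* (e :* h :+ f :* g) :+ b :* (e :* g :+ D :* (f :* h)))
        refl D a b e f g h

    *√-comm : ∀ x y → (x *√ y) ≈√ (y *√ x)
    *√-comm (a + b √) (e + f √) =
      solve 5 (λ D a b e f →
        a :* e :+ D :* (b :* f) := e :* a :+ D :* (f :* b)) refl D a b e f
      ,
      solve 4 (λ a b e f → a :* f :+ b :* e := e :* b :+ f :* a) refl a b e f

    *√-identityˡ : ∀ x → ((1# + 0# √) *√ x) ≈√ x
    *√-identityˡ (a + b √) =
      solve 3 (λ D a b → con 1 :* a :+ D :* (con 0 :* b) := a) refl D a b
      ,
      solve 2 (λ a b → con 1 :* b :+ con 0 :* a := b) refl a b

    *√-distribˡ : ∀ x y z → (x *√ (y +√ z)) ≈√ ((x *√ y) +√ (x *√ z))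
    *√-distribˡ (a + b √) (e + f √) (g + h √) =
      solve 7 (λ D a b e f g h →
        a :* (e :+ g) :+ D :* (b :* (f :+ h)) :=
        (a :* e :+ D :* (b :* f)) :+ (a :* g :+ D :* (b :* h)))
        refl D a b e f g h
      ,
      solve 6 (λ a b e f g h →
        a :* (f :+ h) :+ b :* (e :+ g) :=
        (a :* f :+ b :* e) :+ (a :* h :+ b :* g))
        refl a b e f g h

    ≈√-trans : ∀ {x y z} → x ≈√ y → y ≈√ z → x ≈√ z
    ≈√-trans (p , q) (r , s) = trans p r , trans q s

    +√-cong : ∀ {x y u v} → x ≈√ y → u ≈√ v → (x +√ u) ≈√ (y +√ v)
    +√-cong (p , q) (r , s) = +-cong p r , +-cong q s

  commutativeRing : CommutativeRing c ℓ
  commutativeRing = record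
    { Carrier = Element
    ; _≈_ = _≈√_
    ; _+_ = _+√_
    ; _*_ = _*√_
    ; -_ = -√_
    ; 0# = 0# + 0# √
    ; 1# = 1# + 0# √
    ; isCommutativeRing = record
      { isRing = record
        { +-isAbelianGroup = record
          { isGroup = record
            { isMonoid = record
              { isSemigroup = record
                { isMagma = record
                  { isEquivalence = record
                    { refl  = refl , refl
                    ; sym   = λ p → sym (re-≈ p) , sym (im-≈ p)
                    ; trans = ≈√-trans
                    }
                  ; ∙-cong = +√-cong
                  }
                ; assoc = λ x y z → +-assoc _ _ _ , +-assoc _ _ _
                }
              ; identity = Pair._,_ (λ x → +-identityˡ _ , +-identityˡ _)
                                    (λ x → +-identityʳ _ , +-identityʳ _)
              }
            ; inverse = Pair._,_ (λ x → -‿inverseˡ _ , -‿inverseˡ _)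
                                 (λ x → -‿inverseʳ _ , -‿inverseʳ _)
            ; ⁻¹-cong = λ p → -‿cong (re-≈ p) , -‿cong (im-≈ p)
            }
          ; comm = λ x y → +-comm _ _ , +-comm _ _
          }
        ; *-cong = λ p q →
            +-cong (*-cong (re-≈ p) (re-≈ q)) (*-congˡ (*-cong (im-≈ p) (im-≈ q)))
          , +-cong (*-cong (re-≈ p) (im-≈ q)) (*-cong (im-≈ p) (re-≈ q))
        ; *-assoc = *√-assoc
        ; *-identity = Pair._,_ *√-identityˡ
            (λ x → ≈√-trans (*√-comm x _) (*√-identityˡ x))
        ; distrib = Pair._,_ *√-distribˡ
            (λ x y z → ≈√-trans (*√-comm (y +√ z) x)
              (≈√-trans (*√-distribˡ x y z) (+√-cong (*√-comm x y) (*√-comm x z))))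
        }
      ; *-comm = *√-comm
      }
    }
    where import Data.Product.Base as Pair

module ℚ₂ = Localization ℤ₂-commutativeRing (ℤ⇒ℤ₂ (+ 2)) 2-cancelˡ

-- Every nonzero element of ℤ₂ is a power of 2 times a unit, so ℤ₂[1/2] is its
-- field of fractions.

ℚ₂-commutativeRing : CommutativeRing 0ℓ 0ℓ
ℚ₂-commutativeRing = ℚ₂.commutativeRing

-- This is the field ℚ₂(√m) only when m is not a square in ℚ₂, e.g. when m is
-- twice an odd integer.

ℚ₂[√_] : ℤ → CommutativeRing 0ℓ 0ℓ
ℚ₂[√ m ] = AdjoinSqrt.commutativeRing ℚ₂-commutativeRing (ℚ₂.embed (ℤ⇒ℤ₂ m))

{-# OPTIONS --safe #-}
module Submission where

-- Write m = 2u with u odd and π = √m, a uniformiser of ℤ₂[π].  By Hensel's lemma, a value of the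
-- form divisible by 8π in which some term has an odd coefficient and an odd argument can be
-- corrected to a nontrivial zero.
--
-- Upper bound.  Up to fourth powers the coefficients have valuations 0, 1, 2, 3, and multiplying
-- the form by π rotates these four levels.  Try the arguments 0, 1, π and 1 + π, choosing a set T
-- of odd arguments, at least one of them at level 0, with Σ_T aᵢ ≡ 0 modulo 4.  Modulo 8π, changing
-- 0 to π adds 4aᵢ, and changing 1 to 1 + π adds 4(π + 2δ)aᵢ with δ = 0 or 1 according to m modulo 8,
-- so the effect of a change depends on aᵢ modulo 4 only.  If the changes reach every multiple of 4
-- modulo 8π, there is a zero.  A finite search shows that this happens as soon as the numbers of
-- coefficients on the levels dominate one of five configurations, and any eleven coefficients do so
-- after a rotation.
--
-- Lower bound.  Σ xᵢ⁴ + β Σ yⱼ⁴ with six xᵢ and four yⱼ, where β = 2π or 4 + 2π according to m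
-- modulo 8, has no zero modulo 16 with an odd argument, so infinite descent applies.

open import Defs
open import Algebra.Bundles using (CommutativeRing)
import Algebra.Properties.Semiring.Mult as Mult
open import Axiom.ExcludedMiddle using (ExcludedMiddle)
open import Data.Bool.Base using (Bool; true; false; _∨_; _∧_; not; T)
open import Data.Bool.ListAction using (any; all)
import Data.Bool.Properties as Bool
open import Data.Bool.Properties using (T-∧; T-≡)
open import Data.Fin.Base using (zero; suc)
open import Data.Integer.Base as ℤ using (ℤ; +_; -[1+_])
open import Data.Integer.Divisibility.Signed as ℤ using (divides)
import Data.Integer.DivMod as ℤ
import Data.Integer.Properties as ℤ
open import Data.Integer.Tactic.RingSolver using (solve-∀)
open import Data.List.Base as List
  using (List; []; _∷_; _++_; map; length; replicate; upTo; cartesianProduct; cartesianProductWith;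
      deduplicate)
open import Data.List.Membership.Propositional using (_∈_)
open import Data.List.Membership.Propositional.Properties
  using (∈-cartesianProductWith⁺; ∈-cartesianProduct⁺; ∈-deduplicate⁺; ∈-upTo⁺; ∈-map⁺)
open import Data.List.Properties
  using (++-assoc; ++-identityʳ; map-++; map-∘; map-id; length-map; ∷-injectiveˡ; ∷-injectiveʳ;
         take++drop≡id; length-take; length-tabulate; map-tabulate; tabulate-lookup)
open import Data.List.Relation.Binary.Permutation.Propositional as Perm using (_↭_; ↭-sym)
import Data.List.Relation.Binary.Permutation.Propositional.Properties as Perm
open import Data.List.Relation.Binary.Pointwise using (Pointwise; []; _∷_)
open import Data.List.Relation.Unary.All as All using (All; []; _∷_)
import Data.List.Relation.Unary.All.Properties as All
open import Data.List.Relation.Unary.Any as Any using (Any; here; there)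
import Data.List.Relation.Unary.Any.Properties as Any
open import Data.Nat.Base as ℕ using (ℕ; zero; suc; _≥_)
import Data.Nat.Divisibility as ℕ
import Data.Nat.DivMod as ℕ
import Data.Nat.Properties as ℕ
open import Data.Product.Base using (_×_; _,_; ∃-syntax; Σ-syntax; proj₁; proj₂)
open import Data.Product.Properties using (≡-dec)
open import Data.Sum.Base using (_⊎_; inj₁; inj₂; [_,_]′)
open import Data.Unit.Base using (tt)
open import Data.Unit.Polymorphic.Base using (⊤)
open import Data.Vec.Functional using (Vector)
open import Function.Base using (_∘_)
open import Function.Bundles using (Equivalence)
open import Level as Level using (Level; 0ℓ; _⊔_)
open import Relation.Binary.Definitions using (_Respects_)
open import Relation.Binary.PropositionalEquality as ≡ using (_≡_)
open import Relation.Nullary.Decidable using (yes; no; from-yes)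
open import Relation.Nullary.Negation using (¬_; contradiction)
open import Relation.Unary using (Pred)
open import Data.List.Membership.DecPropositional (≡-dec ℕ._≟_ ℕ._≟_) using (_∈?_)

-- The modulus 8π is forced. Let an odd argument of an odd coefficient change by s. The linear term
-- of the effect has valuation 4 + v(s) and the quadratic one at least 2 + 2v(s), so the linear term
-- is sure to dominate only from v(s) = 3 on. Steps 2πz have this valuation, and their linear terms
-- run through all multiples of 8π.
--
-- The obstacle to a direct search is the number of cases: there are 64 classes of odd coefficients
-- modulo 8π. Requiring the changes to reach every multiple of 4 removes the dependence on the exact
-- value of Σ_T aᵢ. Its class modulo 4 then suffices, and hence so do the classes of the
-- coefficients modulo 4, of which there are only 8, 4, 2 and 1 on the four levels.

-- Quartic forms over a commutative ring

module Quartic {c ℓ} (R : CommutativeRing c ℓ) where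
  open CommutativeRing R
  open import Algebra.Properties.Semiring.Exp semiring using (_^_; ^-congˡ)
  open import Algebra.Properties.CommutativeSemigroup +-commutativeSemigroup using (x∙yz≈y∙xz)
  open import Algebra.Solver.Ring.NaturalCoefficients.Default commutativeSemiring
  open import Relation.Binary.Reasoning.Setoid setoid

  form : List (Carrier × Carrier) → Carrier
  form []             = 0#
  form ((b , x) ∷ ps) = b * x ^ 4 + form ps

  form-↭ : ∀ {ps qs} → ps ↭ qs → form ps ≈ form qs
  form-↭ Perm.refl           = refl
  form-↭ (Perm.prep _ p)     = +-congˡ (form-↭ p)
  form-↭ (Perm.swap _ _ p)   = trans (x∙yz≈y∙xz _ _ _) (+-congˡ (+-congˡ (form-↭ p)))
  form-↭ (Perm.trans p q)    = trans (form-↭ p) (form-↭ q)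

  zeros : List Carrier → List (Carrier × Carrier)
  zeros = map (λ b → b , 0#)

  map-proj₁-zeros : ∀ bs → map proj₁ (zeros bs) ≡ bs
  map-proj₁-zeros bs = ≡.trans (≡.sym (map-∘ bs)) (map-id bs)

  form-zeros : ∀ bs → form (zeros bs) ≈ 0#
  form-zeros []       = refl
  form-zeros (b ∷ bs) = begin
    b * 0# ^ 4 + form (zeros bs)  ≈⟨ +-cong (*-congˡ (zeroˡ _)) (form-zeros bs) ⟩
    b * 0# + 0#                  ≈⟨ +-identityʳ _ ⟩
    b * 0#                       ≈⟨ zeroʳ b ⟩
    0#                                  ∎

  form-++ : ∀ ps qs → form (ps ++ qs) ≈ form ps + form qs
  form-++ []       qs = sym (+-identityˡ _)
  form-++ (p ∷ ps) qs = trans (+-congˡ (form-++ ps qs)) (sym (+-assoc _ _ _))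

  -- One notion for two situations: `Q` constrains the value of the form and `P` certifies that the
  -- arguments are not trivial. It is used for exact zeros with a nonzero argument and for values
  -- modulo 8π with an odd argument at an odd coefficient. Keeping each argument next to its
  -- coefficient lets permutations act on both at once.
  Represents : ∀ {p q} → Pred Carrier q → Pred (Carrier × Carrier) p → Pred (List Carrier) (c ⊔ p ⊔ q)
  Represents Q P bs = ∃[ ps ] map proj₁ ps ≡ bs × Q (form ps) × Any P ps

  module _ {p q} {Q : Pred Carrier q} {P : Pred (Carrier × Carrier) p} (resp : Q Respects _≈_) where

    Represents-resp-↭ : Represents Q P Respects _↭_
    Represents-resp-↭ bs↭cs (ps , ≡.refl , z , a) =
      let qs , eq , ps↭qs = Perm.↭-map-inv proj₁ bs↭cs
      in qs , ≡.sym eq , resp (form-↭ ps↭qs) z , Perm.Any-resp-↭ ps↭qs a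

    Represents-++ʳ : ∀ cs {bs} → Represents Q P bs → Represents Q P (bs ++ cs)
    Represents-++ʳ cs (ps , ≡.refl , z , a) =
      ps ++ zeros cs , ≡.trans (map-++ proj₁ ps (zeros cs))
          (≡.cong (map proj₁ ps ++_) (map-proj₁-zeros cs)) ,
      resp (sym (trans (form-++ ps (zeros cs)) (trans (+-congˡ (form-zeros cs)) (+-identityʳ _)))) z ,
      Any.++⁺ˡ a

    Represents-++ˡ : ∀ cs {bs} → Represents Q P bs → Represents Q P (cs ++ bs)
    Represents-++ˡ cs {bs} r = Represents-resp-↭ (Perm.++-comm bs cs) (Represents-++ʳ cs r)

  Nonzero : Pred (Carrier × Carrier) ℓ
  Nonzero (_ , x) = ¬ x ≈ 0#

  HasZero : Pred (List Carrier) (c ⊔ ℓ)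
  HasZero = Represents (_≈ 0#) Nonzero

  ≈0-resp : (_≈ 0#) Respects _≈_
  ≈0-resp x≈y x≈0 = trans (sym x≈y) x≈0

  scaleAll : Carrier → List (Carrier × Carrier) → List (Carrier × Carrier)
  scaleAll t = map (λ (b , x) → b , t * x)

  form-scaleAll : ∀ t ps → form (scaleAll t ps) ≈ t ^ 4 * form ps
  form-scaleAll t []             = sym (zeroʳ _)
  form-scaleAll t ((b , x) ∷ ps) = trans (+-congˡ (form-scaleAll t ps))
    (solve 4 (λ b t x f → b :* (t :* x) :^ 4 :+ t :^ 4 :* f := t :^ 4 :* (b :* x :^ 4 :+ f))
      refl b t x (form ps))

  map-proj₁-scaleAll : ∀ t ps → map proj₁ (scaleAll t ps) ≡ map proj₁ ps
  map-proj₁-scaleAll t ps = ≡.sym (map-∘ ps)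

  module _ {t} (t-cancel : ∀ {x} → t * x ≈ 0# → x ≈ 0#) where

    Any-scaleAll : ∀ {ps} → Any Nonzero ps → Any Nonzero (scaleAll t ps)
    Any-scaleAll (here nz)  = here (nz ∘ t-cancel)
    Any-scaleAll (there nz) = there (Any-scaleAll nz)

    -- The ring need not contain the inverse of `t`. Instead of dividing the first argument by `t`,
    -- all other arguments are multiplied by it, which scales the whole form by the fourth power of
    -- `t`.
    HasZero-*⁴ : ∀ {b c bs} → c ≈ b * t ^ 4 → HasZero (b ∷ bs) → HasZero (c ∷ bs)
    HasZero-*⁴ {b} {c} c≈ ((_ , x) ∷ ps , ≡.refl , z , a) =
      (c , x) ∷ scaleAll t ps , ≡.cong (c ∷_) (map-proj₁-scaleAll t ps) , eq , scaled a
      where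
      scaled : Any Nonzero ((b , x) ∷ ps) → Any Nonzero ((c , x) ∷ scaleAll t ps)
      scaled (here nz)  = here nz
      scaled (there nz) = there (Any-scaleAll nz)
      eq : form ((c , x) ∷ scaleAll t ps) ≈ 0#
      eq = begin
        c * x ^ 4 + form (scaleAll t ps)           ≈⟨ +-cong (*-congʳ c≈) (form-scaleAll t ps) ⟩
        b * t ^ 4 * x ^ 4 + t ^ 4 * form ps        ≈⟨ solve 4
            (λ b t x f → b :* t :^ 4 :* x :^ 4 :+ t :^ 4 :* f
                                                         := t :^ 4 :* (b :* x :^ 4 :+ f)) refl b t x
                                                             (form ps) ⟩
        t ^ 4 * (b * x ^ 4 + form ps)              ≈⟨ *-congˡ z ⟩
        t ^ 4 * 0#                                 ≈⟨ zeroʳ _ ⟩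
        0#                                         ∎

    HasZero-/⁴ : ∀ {b c bs} → c ≈ b * t ^ 4 → HasZero (c ∷ bs) → HasZero (b ∷ bs)
    HasZero-/⁴ {b} {c} c≈ ((_ , x) ∷ ps , ≡.refl , z , a) =
      (b , t * x) ∷ ps , ≡.refl , trans (+-congʳ eq) z , scaled a
      where
      scaled : Any Nonzero ((c , x) ∷ ps) → Any Nonzero ((b , t * x) ∷ ps)
      scaled (here nz)  = here (nz ∘ t-cancel)
      scaled (there nz) = there nz
      eq : b * (t * x) ^ 4 ≈ c * x ^ 4
      eq = trans (solve 3 (λ b t x → b :* (t :* x) :^ 4 := b :* t :^ 4 :* x :^ 4) refl b t x)
                 (*-congʳ (sym c≈))

  HasZero-map-* : ∀ t {bs} → HasZero bs → HasZero (map (t *_) bs)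
  HasZero-map-* t (ps , ≡.refl , z , a) =
    map scale ps , ≡.trans (≡.sym (map-∘ ps)) (map-∘ ps) ,
    trans (form-scale ps) (trans (*-congˡ z) (zeroʳ t)) , Any.map⁺ a
    where
    scale : Carrier × Carrier → Carrier × Carrier
    scale (b , x) = t * b , x
    form-scale : ∀ ps → form (map scale ps) ≈ t * form ps
    form-scale []             = sym (zeroʳ t)
    form-scale ((b , x) ∷ ps) = trans (+-cong (*-assoc t b _) (form-scale ps)) (sym (distribˡ t _ _))

  HasZero-∷-0 : ∀ {b bs} → ¬ 1# ≈ 0# → b ≈ 0# → HasZero (b ∷ bs)
  HasZero-∷-0 {b} 1≉0 b≈0 = Represents-++ʳ ≈0-resp _ {_ ∷ []}
    ((b , 1#) ∷ [] , ≡.refl , trans (+-identityʳ _) (trans (*-congʳ b≈0) (zeroˡ _)) , here 1≉0)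

  infix 4 _≼_
  -- Quantifying over the remaining coefficients allows a list to be replaced entry by entry. In the
  -- applications the two coefficients are equal or differ by a power of π⁴.
  _≼_ : Carrier → Carrier → Set (c ⊔ ℓ)
  b ≼ c = ∀ {bs} → HasZero (c ∷ bs) → HasZero (b ∷ bs)

  HasZero-≼ : ∀ {bs cs} ds → Pointwise _≼_ bs cs → HasZero (cs ++ ds) → HasZero (bs ++ ds)
  HasZero-≼ ds []                 h = h
  HasZero-≼ ds (_∷_ {b} {c} {bs} {cs} b≼c bs≼cs) h =
    Represents-resp-↭ ≈0-resp (Perm.shift b bs ds)
      (HasZero-≼ (b ∷ ds) bs≼cs (Represents-resp-↭ ≈0-resp (↭-sym (Perm.shift b cs ds)) (b≼c h)))

  -- Stated positively, as the vanishing of every argument, so that no equality in the ring has to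
  -- be decided.
  Anisotropic : Pred (List Carrier) (c ⊔ ℓ)
  Anisotropic bs = ∀ ps → map proj₁ ps ≡ bs → form ps ≈ 0# → All (λ (_ , x) → x ≈ 0#) ps

  Anisotropic-++⁻ˡ : ∀ bs {cs} → Anisotropic (bs ++ cs) → Anisotropic bs
  Anisotropic-++⁻ˡ bs {cs} aniso ps ≡.refl z = All.++⁻ˡ ps (aniso (ps ++ zeros cs)
    (≡.trans (map-++ proj₁ ps (zeros cs)) (≡.cong (map proj₁ ps ++_) (map-proj₁-zeros cs)))
    (trans (form-++ ps (zeros cs)) (trans (+-congˡ (form-zeros cs)) (trans (+-identityʳ _) z))))

-- Arithmetic of the 2-adic integers

∣-difference : ∀ {d} a b → d ℤ.∣ a ℤ.- b → d ℤ.∣ b → d ℤ.∣ a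
∣-difference a b p q = ≡.subst (_ ℤ.∣_) (eq a b) (ℤ.∣m∣n⇒∣m+n p q)
  where
  eq : ∀ a b → a ℤ.- b ℤ.+ b ≡ a
  eq = solve-∀

∣-difference′ : ∀ {d} a b → d ℤ.∣ a ℤ.- b → d ℤ.∣ a → d ℤ.∣ b
∣-difference′ a b p q = ≡.subst (_ ℤ.∣_) (eq a b) (ℤ.∣m∣n⇒∣m-n q p)
  where
  eq : ∀ a b → a ℤ.- (a ℤ.- b) ≡ b
  eq = solve-∀

1∣ : ∀ a → + 1 ℤ.∣ a
1∣ a = divides a (≡.sym (ℤ.*-identityʳ a))

∣-*-∣ : ∀ {a c} b d → a ℤ.∣ b → c ℤ.∣ d → a ℤ.* c ℤ.∣ b ℤ.* d
∣-*-∣ {a} {c} b d (divides p ≡.refl) (divides q ≡.refl) = divides (p ℤ.* q) (eq a c p q)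
  where
  eq : ∀ a c p q → p ℤ.* a ℤ.* (q ℤ.* c) ≡ p ℤ.* q ℤ.* (a ℤ.* c)
  eq = solve-∀

2∣2^1+n : ∀ n → + 2 ℤ.∣ (+ 2) ℤ.^ suc n
2∣2^1+n n = divides ((+ 2) ℤ.^ n) (ℤ.*-comm (+ 2) ((+ 2) ℤ.^ n))

2^n∣2^1+n : ∀ n → (+ 2) ℤ.^ n ℤ.∣ (+ 2) ℤ.^ suc n
2^n∣2^1+n n = divides (+ 2) ≡.refl

∣residue-suc : ∀ x n → (+ 2) ℤ.^ n ℤ.∣ residue x n → (+ 2) ℤ.^ n ℤ.∣ residue x (suc n)
∣residue-suc x n = ∣-difference _ _ (coherent x n)

even-residue-1 : ∀ x n → + 2 ℤ.∣ residue x (suc n) → + 2 ℤ.∣ residue x 1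
even-residue-1 x zero    p = p
even-residue-1 x (suc n) p = even-residue-1 x n
  (∣-difference′ _ _ (ℤ.∣-trans (2∣2^1+n n) (coherent x (suc n))) p)

even-residues : ∀ x → + 2 ℤ.∣ residue x 1 → ∀ n → + 2 ℤ.∣ residue x (suc n)
even-residues x p zero    = p
even-residues x p (suc n) =
  ∣-difference _ _ (ℤ.∣-trans (2∣2^1+n n) (coherent x (suc n))) (even-residues x p n)

-- The index shifts by one because a residue modulo 2ⁿ⁺¹ determines its half only modulo 2ⁿ.
halve : ∀ x → + 2 ℤ.∣ residue x 1 → ∃[ y ] (∀ n → residue x (suc n) ≡ + 2 ℤ.* residue y n)
halve x even = mkℤ₂ q coh , double
  where
  q : ℕ → ℤ
  q n = ℤ.quotient (even-residues x even n)
  double : ∀ n → residue x (suc n) ≡ + 2 ℤ.* q n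
  double n = ≡.trans (ℤ._∣_.equality (even-residues x even n)) (ℤ.*-comm (q n) (+ 2))
  eq : ∀ a b → + 2 ℤ.* a ℤ.- + 2 ℤ.* b ≡ + 2 ℤ.* (a ℤ.- b)
  eq = solve-∀
  coh : ∀ n → (+ 2) ℤ.^ n ℤ.∣ q (suc n) ℤ.- q n
  coh n = ℤ.*-cancelˡ-∣ (+ 2) (≡.subst (_ ℤ.∣_)
    (≡.trans (≡.cong₂ ℤ._-_ (double (suc n)) (double n)) (eq (q (suc n)) (q n))) (coherent x (suc n)))

double-≈ : ∀ x y → (∀ n → residue x (suc n) ≡ + 2 ℤ.* residue y n) → x ≈ℤ₂ ℤ⇒ℤ₂ (+ 2) *ℤ₂ y
double-≈ x y double = mk≈ λ n → ≡.subst (λ r → _ ℤ.∣ residue x n ℤ.- r) (double n)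
  (≡.subst (_ ℤ.∣_) (eq (residue x (suc n)) (residue x n)) (ℤ.∣m⇒∣-m (coherent x n)))
  where
  eq : ∀ a b → ℤ.- (a ℤ.- b) ≡ b ℤ.- a
  eq = solve-∀

module ℤ₂× = Mult (CommutativeRing.semiring ℤ₂-commutativeRing)

module OddInverse (u : ℤ) (u-odd : + 2 ℤ.∣ + 1 ℤ.- u) where

  -- Newton's iteration: 1 − u i is squared at every step.
  inverse-residue : ℕ → ℤ
  inverse-residue zero    = + 1
  inverse-residue (suc n) = let i = inverse-residue n in i ℤ.* (+ 2 ℤ.- u ℤ.* i)

  inverse-error : ∀ n → (+ 2) ℤ.^ suc n ℤ.∣ + 1 ℤ.- u ℤ.* inverse-residue n
  inverse-error zero    = ≡.subst (_ ℤ.∣_) (eq u) u-odd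
    where
    eq : ∀ u → + 1 ℤ.- u ≡ + 1 ℤ.- u ℤ.* + 1
    eq = solve-∀
  inverse-error (suc n) = ≡.subst (_ ℤ.∣_) (eq u (inverse-residue n))
    -- Squaring the error nearly doubles its exponent, but one new factor 2 per step is enough; so
    -- one of the two factors is weakened to divisibility by 2.
    (∣-*-∣ e e (ℤ.∣-trans (2∣2^1+n n) (inverse-error n)) (inverse-error n))
    where
    e = + 1 ℤ.- u ℤ.* inverse-residue n
    eq : ∀ u i → (+ 1 ℤ.- u ℤ.* i) ℤ.* (+ 1 ℤ.- u ℤ.* i) ≡ + 1 ℤ.- u ℤ.* (i ℤ.* (+ 2 ℤ.- u ℤ.* i))
    eq = solve-∀

  inverse : ℤ₂
  inverse = mkℤ₂ inverse-residue λ n → ≡.subst (_ ℤ.∣_) (eq u (inverse-residue n))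
    (ℤ.∣n⇒∣m*n (inverse-residue n) (ℤ.∣-trans (2^n∣2^1+n n) (inverse-error n)))
    where
    eq : ∀ u i → i ℤ.* (+ 1 ℤ.- u ℤ.* i) ≡ i ℤ.* (+ 2 ℤ.- u ℤ.* i) ℤ.- i
    eq = solve-∀

  *-inverse : ℤ⇒ℤ₂ u *ℤ₂ inverse ≈ℤ₂ ℤ⇒ℤ₂ (+ 1)
  *-inverse = mk≈ λ n → ≡.subst (_ ℤ.∣_) (eq (u ℤ.* inverse-residue n))
    (ℤ.∣m⇒∣-m (ℤ.∣-trans (2^n∣2^1+n n) (inverse-error n)))
    where
    eq : ∀ a → ℤ.- (+ 1 ℤ.- a) ≡ a ℤ.- + 1
    eq = solve-∀

-- The properties of ℤ₂ that the argument needs; ∣2^ n x says that 2ⁿ divides x.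
record Dyadic {c ℓ} (A : CommutativeRing c ℓ) (2# : CommutativeRing.Carrier A) : Set
    (Level.suc (c ⊔ ℓ)) where
  open CommutativeRing A
  open Mult semiring renaming (_×_ to _·_)
  field
    2#≈1+1     : 2# ≈ 1# + 1#
    ∣2^        : ℕ → Carrier → Set (c ⊔ ℓ)
    ∣2^-resp   : ∀ {n x y} → x ≈ y → ∣2^ n x → ∣2^ n y
    ∣2^-zero   : ∀ {x} → ∣2^ 0 x
    ∣2^-*      : ∀ {n} x {y} → ∣2^ n y → ∣2^ n (x * y)
    ∣2^-double : ∀ {n y} → ∣2^ n y → ∣2^ (suc n) (2# * y)
    ∣2^-halve  : ∀ {n x} → ∣2^ (suc n) x → ∃[ y ] x ≈ 2# * y × ∣2^ n y
    ∣2^-numeral : ∀ n a → ∣2^ n (a · 1#) → 2 ℕ.^ n ℕ.∣ a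
    digit      : ∀ x → ∣2^ 1 x ⊎ ∣2^ 1 (x - 1#)
    separated  : ∀ {x} → (∀ n → ∣2^ n x) → x ≈ 0#
    ι          : ℤ → Carrier
    ι-+        : ∀ a b → ι (a ℤ.+ b) ≈ ι a + ι b
    ι-*        : ∀ a b → ι (a ℤ.* b) ≈ ι a * ι b
    ι-0        : ι (+ 0) ≈ 0#
    ι-1        : ι (+ 1) ≈ 1#
    ι-2        : ι (+ 2) ≈ 2#
    ι-inverse  : ∀ u → + 2 ℤ.∣ + 1 ℤ.- u → ∃[ ν ] ι u * ν ≈ 1#
    complete   : ∀ (f : ℕ → Carrier) → (∀ n → ∣2^ n (f (suc n) - f n)) → ∃[ l ] ∀ n → ∣2^ n (l - f n)

-- The diagonal sequence: the term with index n is correct modulo 2ⁿ, and only this part of it is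
-- used.
limit : ∀ (f : ℕ → ℤ₂) → (∀ n → (+ 2) ℤ.^ n ℤ.∣ residue (f (suc n)) n ℤ.- residue (f n) n) → ℤ₂
limit f cauchy = mkℤ₂ (λ n → residue (f n) n) λ n → ≡.subst (_ ℤ.∣_)
  (eq (residue (f (suc n)) (suc n)) (residue (f (suc n)) n) (residue (f n) n))
  (ℤ.∣m∣n⇒∣m+n (coherent (f (suc n)) n) (cauchy n))
  where
  eq : ∀ a b c → a ℤ.- b ℤ.+ (b ℤ.- c) ≡ a ℤ.- c
  eq = solve-∀

halves : ∀ n x → (+ 2) ℤ.^ suc n ℤ.∣ residue x (suc n) →
  ∃[ y ] x ≈ℤ₂ ℤ⇒ℤ₂ (+ 2) *ℤ₂ y × (+ 2) ℤ.^ n ℤ.∣ residue y n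
halves n x p =
  let y , double = halve x (even-residue-1 x n (ℤ.∣-trans (2∣2^1+n n) p))
  in y , double-≈ x y double , ℤ.*-cancelˡ-∣ (+ 2) {(+ 2) ℤ.^ n} {residue y n}
      (≡.subst (_ ℤ.∣_) (double n) p)

residue-numeral : ∀ a n → residue (a ℤ₂×.× ℤ⇒ℤ₂ (+ 1)) n ≡ + a
residue-numeral zero    n = ≡.refl
residue-numeral (suc a) n = ≡.cong (λ r → + 1 ℤ.+ r) (residue-numeral a n)

abs-2^ : ∀ n → ℤ.∣ (+ 2) ℤ.^ n ∣ ≡ 2 ℕ.^ n
abs-2^ zero    = ≡.refl
abs-2^ (suc n) = ≡.trans (ℤ.abs-* (+ 2) ((+ 2) ℤ.^ n)) (≡.cong (2 ℕ.*_) (abs-2^ n))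

residue-digit : ∀ x → + 2 ℤ.∣ residue x 1 ⊎ + 2 ℤ.∣ residue x 1 ℤ.- + 1
residue-digit x = split (residue x 1 ℤ.%ℕ 2) (ℤ.n%ℕd<d (residue x 1) 2)
    (ℤ.a≡a%ℕn+[a/ℕn]*n (residue x 1) 2)
  where
  q = residue x 1 ℤ./ℕ 2
  eq : ∀ q → + 1 ℤ.+ q ℤ.* + 2 ℤ.- + 1 ≡ q ℤ.* + 2
  eq = solve-∀
  split : ∀ r → r ℕ.< 2 → residue x 1 ≡ + r ℤ.+ q ℤ.* + 2 →
      + 2 ℤ.∣ residue x 1 ⊎ + 2 ℤ.∣ residue x 1 ℤ.- + 1
  split 0 _ e = inj₁ (divides q (≡.trans e (ℤ.+-identityˡ (q ℤ.* + 2))))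
  split 1 _ e = inj₂ (divides q (≡.trans (≡.cong (ℤ._- + 1) e) (eq q)))
  split (suc (suc _)) (ℕ.s≤s (ℕ.s≤s ())) _

pointwise-≈ : ∀ {x y} → (∀ n → residue x n ≡ residue y n) → x ≈ℤ₂ y
pointwise-≈ {x} {y} p = mk≈ λ n → ≡.subst (λ r → _ ℤ.∣ residue x n ℤ.- r) (p n)
    (divides (+ 0) (ℤ.+-inverseʳ (residue x n)))

ℤ₂-dyadic : Dyadic ℤ₂-commutativeRing (ℤ⇒ℤ₂ (+ 2))
ℤ₂-dyadic = record
  { 2#≈1+1     = mk≈ λ _ → divides (+ 0) ≡.refl
  ; ∣2^        = λ n x → (+ 2) ℤ.^ n ℤ.∣ residue x n
  ; ∣2^-resp   = λ {n} p → ∣-difference′ _ _ (congruent p n)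
  ; ∣2^-zero   = 1∣ _
  ; ∣2^-*      = λ {n} x → ℤ.∣n⇒∣m*n (residue x n)
  ; ∣2^-double = λ {n} {y} p → ∣-*-∣ (+ 2) (residue y (suc n)) ℤ.∣-refl (∣residue-suc y n p)
  ; ∣2^-halve  = λ {n} {x} → halves n x
  ; ∣2^-numeral = λ n a p → ≡.subst (ℕ._∣ a) (abs-2^ n)
      (ℤ.∣⇒∣ᵤ (≡.subst (_ ℤ.∣_) (residue-numeral a n) p))
  ; digit      = residue-digit
  ; separated  = λ v → mk≈ λ n → ≡.subst (_ ℤ.∣_) (≡.sym (ℤ.+-identityʳ _)) (v n)
  ; ι          = ℤ⇒ℤ₂
  ; ι-+        = λ a b → pointwise-≈ {ℤ⇒ℤ₂ (a ℤ.+ b)} {ℤ⇒ℤ₂ a +ℤ₂ ℤ⇒ℤ₂ b} λ _ → ≡.refl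
  ; ι-*        = λ a b → pointwise-≈ {ℤ⇒ℤ₂ (a ℤ.* b)} {ℤ⇒ℤ₂ a *ℤ₂ ℤ⇒ℤ₂ b} λ _ → ≡.refl
  ; ι-0        = pointwise-≈ λ _ → ≡.refl
  ; ι-1        = pointwise-≈ λ _ → ≡.refl
  ; ι-2        = pointwise-≈ λ _ → ≡.refl
  ; ι-inverse  = λ u u-odd → let open OddInverse u u-odd in inverse , *-inverse
  ; complete   = λ f cauchy → limit f cauchy , λ n → divides (+ 0) (ℤ.+-inverseʳ (residue (f n) n))
  }

-- Powers of π in a ramified quadratic extension

module Divisibility {c ℓ} (R : CommutativeRing c ℓ) (π : CommutativeRing.Carrier R) where
  open CommutativeRing R
  open import Algebra.Properties.Ring ring using (-‿distribʳ-*)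
  open import Algebra.Properties.CommutativeSemigroup *-commutativeSemigroup using (x∙yz≈y∙xz)
  open import Relation.Binary.Reasoning.Setoid setoid

  telescope : ∀ x y z → (x - y) + (y - z) ≈ x - z
  telescope x y z = begin
    (x - y) + (y - z)    ≈⟨ +-assoc x (- y) (y - z) ⟩
    x + (- y + (y - z))  ≈⟨ +-congˡ (+-assoc (- y) y (- z)) ⟨
    x + ((- y + y) - z)  ≈⟨ +-congˡ (+-congʳ (-‿inverseˡ y)) ⟩
    x + (0# - z)         ≈⟨ +-congˡ (+-identityˡ (- z)) ⟩
    x - z                ∎

  Div : ℕ → Carrier → Set (c ⊔ ℓ)
  Div zero    x = ⊤
  Div (suc n) x = ∃[ y ] x ≈ π * y × Div n y

  Div-resp : ∀ n {x y} → x ≈ y → Div n x → Div n y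
  Div-resp zero    x≈y _           = _
  Div-resp (suc n) x≈y (z , p , d) = z , trans (sym x≈y) p , d

  Div-+ : ∀ n {x y} → Div n x → Div n y → Div n (x + y)
  Div-+ zero    _           _             = _
  Div-+ (suc n) (z , p , d) (z′ , p′ , d′) =
    z + z′ , trans (+-cong p p′) (sym (distribˡ π z z′)) , Div-+ n d d′

  Div-neg : ∀ n {x} → Div n x → Div n (- x)
  Div-neg zero    _           = _
  Div-neg (suc n) (z , p , d) = - z , trans (-‿cong p) (-‿distribʳ-* π z) , Div-neg n d

  Div-* : ∀ n x {y} → Div n y → Div n (x * y)
  Div-* zero    x _           = _
  Div-* (suc n) x (z , p , d) = x * z , trans (*-congˡ p) (x∙yz≈y∙xz x π z) , Div-* n x d

  Div-pred : ∀ n {x} → Div (suc n) x → Div n x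
  Div-pred zero    _               = _
  Div-pred (suc n) (y , p , d) = y , p , Div-pred n d

-- As π² is 2 times a unit, the exponent `twice n` of π corresponds to the exponent n of 2. Two
-- explicit successors make `Div` unfold into two successive quotients.
twice : ℕ → ℕ
twice zero    = zero
twice (suc n) = suc (suc (twice n))

Cancellative : ∀ {c ℓ} (A : CommutativeRing c ℓ) → CommutativeRing.Carrier A → Set (c ⊔ ℓ)
Cancellative A t = let open CommutativeRing A in ∀ x y → t * x ≈ t * y → x ≈ y

-- Only two invariants of `D` enter the computations. The parity `δ` of (υ - 1)/2 governs the change
-- from 1 to 1 + π in the upper bound, and the residue `d` modulo 16 governs multiplication in the
-- lower bound.
record RamifiedDiscriminant {c ℓ} (A : CommutativeRing c ℓ) (2# D : CommutativeRing.Carrier A) : Set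
    (c ⊔ ℓ) where
  open CommutativeRing A
  open Mult semiring renaming (_×_ to _·_)
  field
    {υ ν w₁ w₂ e} : Carrier
    δ d           : ℕ
    D≈2υ          : D ≈ 2# * υ
    υν≈1          : υ * ν ≈ 1#
    υ≈1+2w₁       : υ ≈ 1# + 2# * w₁
    w₁≈δ+2w₂      : w₁ ≈ δ · 1# + 2# * w₂
    D≈d+16e       : D ≈ d · 1# + 2# * (2# * (2# * (2# * e)))

module Ramified {c ℓ} {A : CommutativeRing c ℓ} {2# D : CommutativeRing.Carrier A}
    (2-cancel : Cancellative A 2#)
  (dyadic : Dyadic A 2#) (discriminant : RamifiedDiscriminant A 2# D) where
  open CommutativeRing A
  open Dyadic dyadic
  open RamifiedDiscriminant discriminant using (υ; ν; D≈2υ; υν≈1)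
  open import Algebra.Solver.Ring.NaturalCoefficients.Default commutativeSemiring using (solve; con; _:+_; _:*_; _:=_)
  open import Relation.Binary.Reasoning.Setoid setoid

  Dν≈2 : D * ν ≈ 2#
  Dν≈2 = begin
    D * ν         ≈⟨ *-congʳ D≈2υ ⟩
    2# * υ * ν    ≈⟨ *-assoc 2# υ ν ⟩
    2# * (υ * ν)  ≈⟨ *-congˡ υν≈1 ⟩
    2# * 1#       ≈⟨ *-identityʳ 2# ⟩
    2#            ∎

  D-cancel : ∀ {a b} → D * a ≈ D * b → a ≈ b
  D-cancel {a} {b} Da≈Db = 2-cancel a b (begin
    2# * a       ≈⟨ *-congʳ Dν≈2 ⟨
    D * ν * a    ≈⟨ solve 3 (λ D ν a → D :* ν :* a := ν :* (D :* a)) refl D ν a ⟩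
    ν * (D * a)  ≈⟨ *-congˡ Da≈Db ⟩
    ν * (D * b)  ≈⟨ solve 3 (λ D ν a → D :* ν :* a := ν :* (D :* a)) refl D ν b ⟨
    D * ν * b    ≈⟨ *-congʳ Dν≈2 ⟩
    2# * b       ∎)

  ∣2^-D* : ∀ {n x} → ∣2^ n x → ∣2^ (suc n) (D * x)
  ∣2^-D* {n} {x} v = ∣2^-resp (trans (*-congˡ (*-comm x υ))
      (trans (sym (*-assoc 2# υ x)) (*-congʳ (sym D≈2υ))))
    (∣2^-double (∣2^-resp (*-comm υ x) (∣2^-* υ v)))

  open AdjoinSqrt A D using (Element; _+_√; re; im; _≈√_; _,_; re-≈; im-≈)
  open AdjoinSqrt A D using () renaming (commutativeRing to O) public
  private module O = CommutativeRing O

  π : Element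
  π = 0# + 1# √

  open Divisibility O π public

  π*-re : ∀ x → re (π O.* x) ≈ D * im x
  π*-re (a + b √) = solve 3 (λ D a b → con 0 :* a :+ D :* (con 1 :* b) := D :* b) refl D a b

  π*-im : ∀ x → im (π O.* x) ≈ re x
  π*-im (a + b √) = solve 2 (λ a b → con 0 :* b :+ con 1 :* a := a) refl a b

  π-cancel : ∀ {x y} → π O.* x ≈√ π O.* y → x ≈√ y
  π-cancel {x} {y} (p , q) =
      trans (sym (π*-im x)) (trans q (π*-im y))
    , D-cancel (trans (sym (π*-re x)) (trans p (π*-re y)))

  Vanishes : ℕ → Element → Set (c ⊔ ℓ)
  Vanishes n x = ∣2^ n (re x) × ∣2^ n (im x)

  -- A single factor π exchanges the two coordinates, up to a factor `D`; two of them multiply both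
  -- coordinates by `D`, which is 2 times `υ`.
  Div⇒Vanishes : ∀ n {x} → Div (twice n) x → Vanishes n x
  Div⇒Vanishes zero    _                              = ∣2^-zero , ∣2^-zero
  Div⇒Vanishes (suc n) {x} (y , x≈πy , z , y≈πz , d) =
    let p , q = Div⇒Vanishes n d
    in ∣2^-resp (sym re≈) (∣2^-D* p) , ∣2^-resp (sym im≈) (∣2^-D* q)
    where
    re≈ : re x ≈ D * re z
    re≈ = trans (re-≈ x≈πy) (trans (π*-re y) (*-congˡ (trans (im-≈ y≈πz) (π*-im z))))
    im≈ : im x ≈ D * im z
    im≈ = trans (im-≈ x≈πy) (trans (π*-im y) (trans (re-≈ y≈πz) (π*-re z)))

  -- Multiplication by ν turns divisibility by 2 into divisibility by D = π².
  ∣2^-/D : ∀ {n x} → ∣2^ (suc n) x → ∃[ y ] x ≈ D * y × ∣2^ n y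
  ∣2^-/D {n} {x} v =
    let y , x≈2y , w = ∣2^-halve v
    in ν * y , trans x≈2y (trans (*-congʳ (sym Dν≈2)) (*-assoc D ν y)) , ∣2^-* ν w

  Vanishes⇒Div : ∀ n {x} → Vanishes n x → Div (twice n) x
  Vanishes⇒Div zero    _       = _
  Vanishes⇒Div (suc n) {x} (p , q) =
    let a , x≈Da , v = ∣2^-/D p
        b , y≈Db , w = ∣2^-/D q
        z = a + b √
    in π O.* z
     , (trans x≈Da (sym (trans (π*-re (π O.* z)) (*-congˡ (π*-im z)))) ,
        trans y≈Db (sym (trans (π*-im (π O.* z)) (π*-re z))))
     , z , O.refl , Vanishes⇒Div n (v , w)

  Div-separated : ∀ {x} → (∀ n → Div (twice n) x) → x ≈√ O.0#
  Div-separated d = separated (λ n → proj₁ (Div⇒Vanishes n (d n)))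
                  , separated (λ n → proj₂ (Div⇒Vanishes n (d n)))

  even⇒π* : ∀ {x} → ∣2^ 1 (re x) → ∃[ y ] x ≈√ (π O.* y)
  even⇒π* {x} v =
    let a , x≈Da , _ = ∣2^-/D v
        y = im x + a √
    in y , (trans x≈Da (sym (π*-re y)) , sym (π*-im y))

  π*⇒even : ∀ {x} y → x ≈√ (π O.* y) → ∣2^ 1 (re x)
  π*⇒even y x≈πy = ∣2^-resp (sym (trans (re-≈ x≈πy) (π*-re y))) (∣2^-D* ∣2^-zero)

  -- Consecutive terms agree modulo ever higher powers of π, so every other term
  -- gives the successive residues of the limit.
  Div-complete : ∀ (f : ℕ → Element) → (∀ n → Div n (f (suc n) O.- f n)) →
                 ∃[ l ] ∀ n → Div (twice n) (l O.- f (twice n))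
  Div-complete f cauchy =
    let a , p = complete (re ∘ f ∘ twice) (λ n → proj₁ (Div⇒Vanishes n (two-steps n)))
        b , q = complete (im ∘ f ∘ twice) (λ n → proj₂ (Div⇒Vanishes n (two-steps n)))
    in (a + b √) , λ n → Vanishes⇒Div n (p n , q n)
    where
    two-steps : ∀ n → Div (twice n) (f (twice (suc n)) O.- f (twice n))
    two-steps n = Div-resp (twice n) (telescope _ _ _)
      (Div-+ (twice n) (Div-pred (twice n) (cauchy (suc (twice n)))) (cauchy (twice n)))

-- Hensel's lemma for fourth powers

record AdicallyComplete {c ℓ} (R : CommutativeRing c ℓ) (π : CommutativeRing.Carrier R) : Set
    (c ⊔ ℓ) where
  open CommutativeRing R
  open Divisibility R π
  field
    Div-separated : ∀ {x} → (∀ n → Div (twice n) x) → x ≈ 0#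
    Div-complete  : ∀ (f : ℕ → Carrier) → (∀ n → Div n (f (suc n) - f n)) →
                    ∃[ l ] ∀ n → Div (twice n) (l - f (twice n))

module Hensel {c ℓ} (R : CommutativeRing c ℓ) {π : CommutativeRing.Carrier R}
    (adic : AdicallyComplete R π) where
  open CommutativeRing R
  open Divisibility R π
  open AdicallyComplete adic
  open import Algebra.Properties.Ring ring using (-‿+-comm; -‿involutive; -‿distribʳ-*)
  open import Algebra.Properties.Group +-group using () renaming (x∙y⁻¹≈ε⇒x≈y to x-y≈0⇒x≈y)
  open import Algebra.Properties.AbelianGroup +-abelianGroup using (xyx⁻¹≈y)
  open import Algebra.Properties.Semiring.Exp semiring using (_^_; ^-congˡ)
  open import Algebra.Solver.Ring.NaturalCoefficients.Default commutativeSemiring using (solve; con; _:+_; _:*_; _:^_; _:=_)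
  open import Relation.Binary.Reasoning.Setoid setoid

  flip : ∀ x y → - (x - y) ≈ y - x
  flip x y = begin
    - (x - y)      ≈⟨ -‿+-comm x (- y) ⟨
    - x + - - y    ≈⟨ +-congˡ (-‿involutive y) ⟩
    - x + y        ≈⟨ +-comm (- x) y ⟩
    y - x          ∎

  split : ∀ x y → x ≈ y + (x - y)
  split x y = begin
    x              ≈⟨ +-identityʳ x ⟨
    x + 0#         ≈⟨ +-congˡ (-‿inverseˡ y) ⟨
    x + (- y + y)  ≈⟨ +-assoc x (- y) y ⟨
    (x - y) + y    ≈⟨ +-comm (x - y) y ⟩
    y + (x - y)    ∎

  Contraction : (Carrier → Carrier) → Set (c ⊔ ℓ)
  Contraction G = ∀ n x y → Div n (x - y) → Div (suc n) (G x - G y)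

  -- The contraction principle for the π-adic metric, with iteration starting from `0#`.
  fixpoint : ∀ {G} → Contraction G → ∃[ z ] z ≈ G z
  fixpoint {G} contract = l , sym (x-y≈0⇒x≈y _ _ (Div-separated fixed))
    where
    f : ℕ → Carrier
    f zero    = 0#
    f (suc n) = G (f n)
    cauchy : ∀ n → Div n (f (suc n) - f n)
    cauchy zero    = _
    cauchy (suc n) = contract n _ _ (cauchy n)
    l = proj₁ (Div-complete f cauchy)
    close : ∀ n → Div (twice n) (l - f (twice n))
    close = proj₂ (Div-complete f cauchy)
    fixed : ∀ n → Div (twice n) (G l - l)
    -- With k = `twice n`, the chain is G l, f (k + 1), f k, l: its neighbours agree modulo πᵏ by
    -- contraction, by the Cauchy property and by convergence.
    fixed n = Div-resp (twice n) (telescope _ _ _)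
      (Div-+ (twice n) (Div-pred (twice n) (contract (twice n) _ _ (close n)))
        (Div-resp (twice n) (telescope _ _ _)
          (Div-+ (twice n) (cauchy (twice n))
            (Div-resp (twice n) (flip _ _) (Div-neg (twice n) (close n))))))

  2# : Carrier
  2# = 1# + 1#

  -- With y = x + 2πz the equation becomes z + f + πP(z) = 0, where P is the polynomial below.
  hensel : ∀ {b x r c f} → b * x ^ 3 ≈ 1# + π * c → b * x ^ 4 + r ≈ 2# * (2# * (2# * (π * f))) →
           ∃[ z ] b * (x + 2# * π * z) ^ 4 + r ≈ 0#
  hensel {b} {x} {r} {c} {f} bx³≈1+πc bx⁴+r≈8πf = z , root
    where
    3# 4# 6# : Carrier
    3# = 2# + 1#
    4# = 3# + 1#
    6# = 4# + 1# + 1#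

    P : Carrier → Carrier
    P z = c * z + 3# * (b * x ^ 2 * z ^ 2) + 4# * (π * b * x * z ^ 3) + 2# * (π ^ 2 * b * z ^ 4)

    -- The difference quotient of `P`. It shows that P (z + d) and P z differ by a multiple of d, so
    -- the factor π in front of `P` gains one power of π.
    Q : Carrier → Carrier → Carrier
    Q z d = c + 3# * (b * x ^ 2 * (2# * z + d))
          + 4# * (π * b * x * (3# * z ^ 2 + 3# * z * d + d ^ 2))
          + 2# * (π ^ 2 * b * (4# * z ^ 3 + 6# * z ^ 2 * d + 4# * z * d ^ 2 + d ^ 3))

    P-cong : ∀ {z w} → z ≈ w → P z ≈ P w
    P-cong e = +-cong (+-cong (+-cong (*-congˡ e) (*-congˡ (*-congˡ (^-congˡ 2 e))))
      (*-congˡ (*-congˡ (^-congˡ 3 e)))) (*-congˡ (*-congˡ (^-congˡ 4 e)))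

    P-+ : ∀ z d → P (z + d) ≈ P z + Q z d * d
    P-+ z d = solve 6 (λ b x c π z d →
        c :* (z :+ d) :+ con 3 :* (b :* x :^ 2 :* (z :+ d) :^ 2) :+ con 4 :*
            (π :* b :* x :* (z :+ d) :^ 3) :+ con 2 :* (π :^ 2 :* b :* (z :+ d) :^ 4)
        := c :* z :+ con 3 :* (b :* x :^ 2 :* z :^ 2) :+ con 4 :* (π :* b :* x :* z :^ 3) :+ con 2 :*
            (π :^ 2 :* b :* z :^ 4)
        :+ (c :+ con 3 :* (b :* x :^ 2 :* (con 2 :* z :+ d))
          :+ con 4 :* (π :* b :* x :* (con 3 :* z :^ 2 :+ con 3 :* z :* d :+ d :^ 2))
          :+ con 2 :* (π :^ 2 :* b :* (con 4 :* z :^ 3 :+ con 6 :* z :^ 2 :* d :+ con 4 :* z :* d :^ 2 :+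
              d :^ 3))) :* d)
        refl b x c π z d

    G : Carrier → Carrier
    G z = - (f + π * P z)

    contract : Contraction G
    contract n z w d = Div-resp (suc n) (sym G-G)
        (Div-neg (suc n) (Q w (z - w) * (z - w) , refl , Div-* n (Q w (z - w)) d))
      where
      πPz≈ : f + π * P z ≈ (f + π * P w) + π * (Q w (z - w) * (z - w))
      πPz≈ = begin
        f + π * P z                                           ≈⟨ +-congˡ
            (*-congˡ (trans (P-cong (split z w)) (P-+ w (z - w)))) ⟩
        f + π * (P w + Q w (z - w) * (z - w))                 ≈⟨ +-congˡ (distribˡ π (P w) _) ⟩
        f + (π * P w + π * (Q w (z - w) * (z - w)))           ≈⟨ +-assoc f (π * P w) _ ⟨
        (f + π * P w) + π * (Q w (z - w) * (z - w))           ∎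
      G-G : G z - G w ≈ - (π * (Q w (z - w) * (z - w)))
      G-G = begin
        - (f + π * P z) - - (f + π * P w)                                            ≈⟨ flip′ _ _ ⟩
        - ((f + π * P z) - (f + π * P w))                                            ≈⟨ -‿cong
            (+-congʳ πPz≈) ⟩
        - ((f + π * P w) + π * (Q w (z - w) * (z - w)) - (f + π * P w))              ≈⟨ -‿cong
            (xyx⁻¹≈y _ _) ⟩
        - (π * (Q w (z - w) * (z - w)))                                              ∎
        where
        flip′ : ∀ x y → - x - - y ≈ - (x - y)
        flip′ x y = -‿+-comm x (- y)

    solution = fixpoint contract
    z = proj₁ solution

    z-root : z + f + π * P z ≈ 0#
    z-root = begin
      z + f + π * P z          ≈⟨ +-assoc z f _ ⟩
      z + (f + π * P z)        ≈⟨ +-congʳ (proj₂ solution) ⟩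
      G z + (f + π * P z)      ≈⟨ -‿inverseˡ _ ⟩
      0#                       ∎

    root : b * (x + 2# * π * z) ^ 4 + r ≈ 0#
    root = begin
      b * (x + 2# * π * z) ^ 4 + r
        ≈⟨ expand ⟩
      (b * x ^ 4 + r) + 2# * (2# * (2# *
          (π * (b * x ^ 3 * z + π * (3# * (b * x ^ 2 * z ^ 2) + 4# * (π * b * x * z ^ 3) + 2# *
          (π ^ 2 * b * z ^ 4))))))
        ≈⟨ +-cong bx⁴+r≈8πf (*-congˡ (*-congˡ (*-congˡ (*-congˡ (+-congʳ (*-congʳ bx³≈1+πc)))))) ⟩
      2# * (2# * (2# * (π * f))) + 2# *
          (2# * (2# * (π * ((1# + π * c) * z + π *
          (3# * (b * x ^ 2 * z ^ 2) + 4# * (π * b * x * z ^ 3) + 2# * (π ^ 2 * b * z ^ 4))))))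
        ≈⟨ collect ⟩
      2# * (2# * (2# * (π * (z + f + π * P z))))
        ≈⟨ *-congˡ (*-congˡ (*-congˡ (*-congˡ z-root))) ⟩
      2# * (2# * (2# * (π * 0#)))
        ≈⟨ solve 1 (λ π → con 2 :* (con 2 :* (con 2 :* (π :* con 0))) := con 0) refl π ⟩
      0#  ∎
      where
      expand = solve 5 (λ b x r π z →
        b :* (x :+ con 2 :* π :* z) :^ 4 :+ r :=
        (b :* x :^ 4 :+ r) :+ con 2 :*
            (con 2 :* (con 2 :* (π :* (b :* x :^ 3 :* z :+ π :*
            (con 3 :* (b :* x :^ 2 :* z :^ 2) :+ con 4 :* (π :* b :* x :* z :^ 3) :+ con 2 :*
            (π :^ 2 :* b :* z :^ 4)))))))
        refl b x r π z
      collect = solve 6 (λ b x f c π z →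
        let q = con 3 :* (b :* x :^ 2 :* z :^ 2) ; s = con 4 :* (π :* b :* x :* z :^ 3) ; t = con 2 :*
                (π :^ 2 :* b :* z :^ 4) in
        con 2 :* (con 2 :* (con 2 :* (π :* f))) :+ con 2 :*
            (con 2 :* (con 2 :* (π :* ((con 1 :+ π :* c) :* z :+ π :* (q :+ s :+ t))))) :=
        con 2 :* (con 2 :* (con 2 :* (π :* (z :+ f :+ π :* (c :* z :+ q :+ s :+ t))))))
        refl b x f c π z

-- The finite search over classes of coefficients modulo 4

-- Bit bᵢⱼ records that the value of the form can be changed by 4 (i + jπ) modulo 8π.
data Mask : Set where
  mask : (b₀₀ b₁₀ b₂₀ b₃₀ b₀₁ b₁₁ b₂₁ b₃₁ : Bool) → Mask

_∪_ : Mask → Mask → Mask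
mask a b c d e f g h ∪ mask a′ b′ c′ d′ e′ f′ g′ h′ =
  mask (a ∨ a′) (b ∨ b′) (c ∨ c′) (d ∨ d′) (e ∨ e′) (f ∨ f′) (g ∨ g′) (h ∨ h′)

full : Mask → Bool
full (mask a b c d e f g h) = a ∧ b ∧ c ∧ d ∧ e ∧ f ∧ g ∧ h

+1ᵐ +πᵐ : Mask → Mask
+1ᵐ (mask a b c d e f g h) = mask d a b c h e f g
+πᵐ (mask a b c d e f g h) = mask e f g h a b c d

iter : ∀ {A : Set} → ℕ → (A → A) → A → A
iter zero f x = x
iter (suc n) f x = iter n f (f x)

shift : ℕ → ℕ → Mask → Mask
shift a b M = iter a +1ᵐ (iter b +πᵐ M)

grow : ℕ → ℕ → Mask → Mask
grow a b M = M ∪ shift a b M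

-- entry i j M stands for a set T of odd arguments with Σ_T aᵢ ≡ i + jπ modulo 4, containing an
-- argument at level 0, and the changes M that it allows; the mask of a state belongs to T = ∅.
data Entry : Set where
  entry : ℕ → ℕ → Mask → Entry

data State : Set where
  state : Mask → List Entry → State

Class = ℕ × ℕ

module _ (δ : ℕ) where
  -- `growR` is the change from 0 to π, with effect 4a, and `growT` the change from 1 to 1 + π, with
  -- effect 4(π + 2δ)a. For a = p + qπ the latter is 4(2(δp + q) + pπ): π² is 2 modulo 4, and 8δqπ
  -- vanishes modulo 8π.
  growR growT : Class → Mask → Mask
  growR (p , q) = grow (p ℕ.% 4) (q ℕ.% 2)
  growT (p , q) = grow ((2 ℕ.* (δ ℕ.* p ℕ.+ q)) ℕ.% 4) (p ℕ.% 2)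

  stepE : Class → List Entry → List Entry
  stepE c [] = []
  stepE c@(p , q) (entry i j M ∷ es) =
    entry i j (growR c M) ∷ entry ((i ℕ.+ p) ℕ.% 4) ((j ℕ.+ q) ℕ.% 4) (growT c M) ∷ stepE c es

  step : Class → State → State
  step c@(p , q) (state M es) with p ℕ.% 2
  -- Only an odd coefficient may found a set T, here with itself as the single element. The changes
  -- collected in `M` while T was empty remain available.
  ... | 1 = state (growR c M) (entry p q (growT c M) ∷ stepE c es)
  ... | _ = state (growR c M) (stepE c es)

  done : List Entry → Bool
  done [] = false
  done (entry 0 0 M ∷ es) = full M ∨ done es
  done (_ ∷ es) = done es

  doneS : State → Bool
  doneS (state _ es) = done es

  -- Multisets of n classes: either the first class occurs once more or it is discarded.
  level : (State → Bool) → List Class → ℕ → State → Bool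
  level k cs zero st = k st
  level k [] (suc n) st = true
  level k (c ∷ cs) (suc n) st = doneS st ∨ (level k (c ∷ cs) n (step c st) ∧ level k cs (suc n) st)

-- The classes modulo 4 of odd elements and of their products with π, π² and π³. Multiplication by π
-- sends (p , q) to (2q , p), which halves the number of classes each time.
L0 L1 L2 L3 : List Class
L0 = (1 , 0) ∷ (1 , 1) ∷ (1 , 2) ∷ (1 , 3) ∷ (3 , 0) ∷ (3 , 1) ∷ (3 , 2) ∷ (3 , 3) ∷ []
L1 = (0 , 1) ∷ (0 , 3) ∷ (2 , 1) ∷ (2 , 3) ∷ []
L2 = (2 , 0) ∷ (2 , 2) ∷ []
L3 = (0 , 2) ∷ []

init : State
init = state (mask true false false false false false false false) []

-- Each level is the continuation of the one before. Level 0 comes first, so every set T is founded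
-- before the higher levels extend it.
search : ℕ → ℕ → ℕ → ℕ → ℕ → Bool
search δ a b c d = level δ (level δ (level δ (level δ (doneS δ) L3 d) L2 c) L1 b) L0 a init

T-∨ : ∀ x y {p} {P : Set p} → (T x → P) → (T y → P) → T (x ∨ y) → P
T-∨ true  y f g t = f tt
T-∨ false y f g t = g t

-- Congruences modulo 8π and soundness of the search

record Ramification {c ℓ} (R : CommutativeRing c ℓ) : Set (c ⊔ ℓ) where
  open CommutativeRing R
  open Mult semiring renaming (_×_ to _·_)
  field
    {π υ ν w₁ w₂} : Carrier
    δ             : ℕ
    π²≈2υ         : π * π ≈ (1# + 1#) * υ
    υν≈1          : υ * ν ≈ 1#
    υ≈1+2w₁       : υ ≈ 1# + (1# + 1#) * w₁
    w₁≈δ+2w₂      : w₁ ≈ δ · 1# + (1# + 1#) * w₂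

module Congruences {c ℓ} (R : CommutativeRing c ℓ) (ramification : Ramification R) where
  open CommutativeRing R
  open Mult semiring renaming (_×_ to _·_)
  open Ramification ramification
  open import Algebra.Properties.Ring ring using (-‿distribʳ-*)
  open import Algebra.Properties.Semiring.Exp semiring using (_^_; ^-congˡ)
  open import Algebra.Solver.Ring.NaturalCoefficients.Default commutativeSemiring using (solve; con; _:+_; _:*_; _:^_; _:=_)
  open import Relation.Binary.Reasoning.Setoid setoid

  2# : Carrier
  2# = 1# + 1#

  ⟦_⟧ : ℕ → Carrier
  ⟦ n ⟧ = n · 1#

  infix 4 _~_ _≡₄_
  record _~_ (x y : Carrier) : Set (c ⊔ ℓ) where
    constructor mod8π
    field
      {quotient} : Carrier
      equality   : x ≈ y + 2# * (2# * (2# * (π * quotient)))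

  ~-reflexive : ∀ {x y} → x ≈ y → x ~ y
  ~-reflexive {x} {y} e = mod8π (trans e
      (solve 2 (λ y π → y := y :+ con 2 :* (con 2 :* (con 2 :* (π :* con 0)))) refl y π))

  ~-refl : ∀ {x} → x ~ x
  ~-refl = ~-reflexive refl

  ~-sym : ∀ {x y} → x ~ y → y ~ x
  ~-sym {x} {y} (mod8π {f} e) = mod8π {quotient = - f} (begin
    y                                   ≈⟨ +-identityʳ y ⟨
    y + 0#                              ≈⟨ solve 2
        (λ y π → y :+ con 0 := y :+ con 2 :* (con 2 :* (con 2 :* (π :* con 0)))) refl y π ⟩
    y + k 0#                            ≈⟨ +-congˡ (k-cong (-‿inverseʳ f)) ⟨
    y + k (f - f)                       ≈⟨ solve 4
        (λ y f g π → y :+ con 2 :* (con 2 :* (con 2 :* (π :* (f :+ g))))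
                                            := y :+ con 2 :* (con 2 :* (con 2 :* (π :* f))) :+ con 2 :*
                                                (con 2 :* (con 2 :* (π :* g)))) refl y f (- f) π ⟩
    y + k f + k (- f)                   ≈⟨ +-congʳ e ⟨
    x + k (- f)                         ∎)
    where
    k : Carrier → Carrier
    k z = 2# * (2# * (2# * (π * z)))
    k-cong : ∀ {z z′} → z ≈ z′ → k z ≈ k z′
    k-cong p = *-congˡ (*-congˡ (*-congˡ (*-congˡ p)))

  ~-trans : ∀ {x y z} → x ~ y → y ~ z → x ~ z
  ~-trans {x} {y} {z} (mod8π {f} e) (mod8π {g} e′) = mod8π {quotient = f + g} (trans e (trans (+-congʳ e′)
    (solve 4 (λ z f g π → z :+ con 2 :* (con 2 :* (con 2 :* (π :* g))) :+ con 2 :*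
        (con 2 :* (con 2 :* (π :* f)))
      := z :+ con 2 :* (con 2 :* (con 2 :* (π :* (f :+ g))))) refl z f g π)))

  ~-+ : ∀ {x y x′ y′} → x ~ y → x′ ~ y′ → x + x′ ~ y + y′
  ~-+ {x} {y} {x′} {y′} (mod8π {f} e) (mod8π {g} e′) = mod8π {quotient = f + g} (trans (+-cong e e′)
    (solve 5 (λ y y′ f g π → y :+ con 2 :* (con 2 :* (con 2 :* (π :* f))) :+
        (y′ :+ con 2 :* (con 2 :* (con 2 :* (π :* g))))
      := y :+ y′ :+ con 2 :* (con 2 :* (con 2 :* (π :* (f :+ g))))) refl y y′ f g π))

  2≈ππν : 2# ≈ π * (π * ν)
  2≈ππν = begin
    2#               ≈⟨ *-identityʳ 2# ⟨
    2# * 1#          ≈⟨ *-congˡ υν≈1 ⟨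
    2# * (υ * ν)     ≈⟨ *-assoc 2# υ ν ⟨
    2# * υ * ν       ≈⟨ *-congʳ π²≈2υ ⟨
    π * π * ν        ≈⟨ *-assoc π π ν ⟩
    π * (π * ν)      ∎

  -- As 2 is π² times the unit `ν`, 16 is a multiple of 8π.
  16#~ : ∀ {x y} z → x ≈ y + 2# * (2# * (2# * (2# * z))) → x ~ y
  16#~ {x} {y} z e = mod8π {quotient = π * ν * z}
      (trans e (+-congˡ (*-congˡ (*-congˡ (*-congˡ (trans (*-congʳ 2≈ππν)
    (solve 3 (λ π ν z → π :* (π :* ν) :* z := π :* (π :* ν :* z)) refl π ν z)))))))

  -- The residues modulo 2π are a + bπ with a taken modulo 4 and b modulo 2;
  -- V a b is 4 (a + bπ), a multiple of 4 modulo 8π.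
  V : ℕ → ℕ → Carrier
  V a b = 2# * (2# * (⟦ a ⟧ + ⟦ b ⟧ * π))

  V-+ : ∀ a b a′ b′ → V a b + V a′ b′ ≈ V (a ℕ.+ a′) (b ℕ.+ b′)
  V-+ a b a′ b′ = trans
    (solve 5 (λ a b a′ b′ π → con 2 :* (con 2 :* (a :+ b :* π)) :+ con 2 :* (con 2 :* (a′ :+ b′ :* π))
      := con 2 :* (con 2 :* ((a :+ a′) :+ (b :+ b′) :* π))) refl ⟦ a ⟧ ⟦ b ⟧ ⟦ a′ ⟧ ⟦ b′ ⟧ π)
    (*-congˡ (*-congˡ (+-cong (sym (×-homo-+ 1# a a′)) (*-congʳ (sym (×-homo-+ 1# b b′))))))

  ⟦⟧-% : ∀ a n .{{_ : ℕ.NonZero n}} → ⟦ a ⟧ ≈ ⟦ a ℕ.% n ⟧ + ⟦ a ℕ./ n ⟧ * ⟦ n ⟧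
  ⟦⟧-% a n = trans (×-congˡ (ℕ.m≡m%n+[m/n]*n a n))
    (trans (×-homo-+ 1# (a ℕ.% n) _) (+-congˡ (×1-homo-* (a ℕ./ n) n)))

  -- 4 · 4 vanishes modulo 8π by `16#~`, and so does 4 · 2π. This is why eight bits describe all
  -- multiples of 4.
  V-% : ∀ a b → V a b ~ V (a ℕ.% 4) (b ℕ.% 2)
  V-% a b = ~-trans (16#~ ⟦ a ℕ./ 4 ⟧ (trans (*-congˡ (*-congˡ (+-congʳ (⟦⟧-% a 4))))
      (solve 4 (λ a k b π → con 2 :*
          (con 2 :* (a :+ k :* (con 1 :+ (con 1 :+ (con 1 :+ (con 1 :+ con 0)))) :+ b :* π))
        := con 2 :* (con 2 :* (a :+ b :* π)) :+ con 2 :* (con 2 :* (con 2 :* (con 2 :* k)))) refl ⟦ a ℕ.%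
            4 ⟧ ⟦ a ℕ./ 4 ⟧ ⟦ b ⟧ π)))
    (mod8π {quotient = ⟦ b ℕ./ 2 ⟧} (trans (*-congˡ (*-congˡ (+-congˡ (*-congʳ (⟦⟧-% b 2)))))
      (solve 4 (λ a k b π → con 2 :* (con 2 :* (a :+ (b :+ k :* (con 1 :+ (con 1 :+ con 0))) :* π))
        := con 2 :* (con 2 :* (a :+ b :* π)) :+ con 2 :* (con 2 :* (con 2 :* (π :* k)))) refl ⟦ a ℕ.% 4 ⟧
            ⟦ b ℕ./ 2 ⟧ ⟦ b ℕ.% 2 ⟧ π)))

  record _≡₄_ (x y : Carrier) : Set (c ⊔ ℓ) where
    constructor mod4
    field
      {quotient} : Carrier
      equality   : x ≈ y + 2# * (2# * quotient)

  residue₄ : ℕ → ℕ → Carrier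
  residue₄ p q = ⟦ p ⟧ + ⟦ q ⟧ * π

  residue₄-+ : ∀ {x y} p q p′ q′ → x ≡₄ residue₄ p q → y ≡₄ residue₄ p′ q′ →
               x + y ≡₄ residue₄ ((p ℕ.+ p′) ℕ.% 4) ((q ℕ.+ q′) ℕ.% 4)
  residue₄-+ p q p′ q′ (mod4 {f} e)
      (mod4 {g} e′) = mod4 {quotient = f + g + (⟦ (p ℕ.+ p′) ℕ./ 4 ⟧ + ⟦ (q ℕ.+ q′) ℕ./ 4 ⟧ * π)} (begin
    _ + _   ≈⟨ +-cong e e′ ⟩
    (⟦ p ⟧ + ⟦ q ⟧ * π + 2# * (2# * f)) + (⟦ p′ ⟧ + ⟦ q′ ⟧ * π + 2# * (2# * g))
      ≈⟨ solve 7 (λ p q p′ q′ f g π →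
          (p :+ q :* π :+ con 2 :* (con 2 :* f)) :+ (p′ :+ q′ :* π :+ con 2 :* (con 2 :* g))
           := (p :+ p′) :+ (q :+ q′) :* π :+ con 2 :* (con 2 :* (f :+ g))) refl ⟦ p ⟧ ⟦ q ⟧ ⟦ p′ ⟧ ⟦ q′ ⟧
               f g π ⟩
    (⟦ p ⟧ + ⟦ p′ ⟧) + (⟦ q ⟧ + ⟦ q′ ⟧) * π + 2# * (2# * (f + g))
      ≈⟨ +-congʳ (+-cong (red p p′) (*-congʳ (red q q′))) ⟩
    _ ≈⟨ solve 7 (λ p q p′ q′ f g π → p :+ p′ :* (con 1 :+ (con 1 :+ (con 1 :+ (con 1 :+ con 0)))) :+
        (q :+ q′ :* (con 1 :+ (con 1 :+ (con 1 :+ (con 1 :+ con 0))))) :* π :+ con 2 :*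
        (con 2 :* (f :+ g))
           := p :+ q :* π :+ con 2 :* (con 2 :* (f :+ g :+ (p′ :+ q′ :* π)))) refl
           ⟦ (p ℕ.+ p′) ℕ.% 4 ⟧ ⟦ (q ℕ.+ q′) ℕ.% 4 ⟧ ⟦ (p ℕ.+ p′) ℕ./ 4 ⟧ ⟦ (q ℕ.+ q′) ℕ./ 4 ⟧ f g π ⟩
    _ ∎)
    where
    red : ∀ p p′ → ⟦ p ⟧ + ⟦ p′ ⟧ ≈ ⟦ (p ℕ.+ p′) ℕ.% 4 ⟧ + ⟦ (p ℕ.+ p′) ℕ./ 4 ⟧ * ⟦ 4 ⟧
    red p p′ = trans (sym (×-homo-+ 1# p p′)) (⟦⟧-% (p ℕ.+ p′) 4)

  HasClass : Class → Pred Carrier (c ⊔ ℓ)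
  HasClass (p , q) x = x ≡₄ residue₄ p q

  υ² : ∃[ s ] υ * υ ≈ 1# + 2# * (2# * s)
  υ² = w₁ + w₁ * w₁ , trans (*-cong υ≈1+2w₁ υ≈1+2w₁)
    (solve 1 (λ w → (con 1 :+ con 2 :* w) :* (con 1 :+ con 2 :* w) :=
        con 1 :+ con 2 :* (con 2 :* (w :+ w :* w))) refl w₁)

  HasClass⇒V : ∀ {p q x} → HasClass (p , q) x → 2# * (2# * x) ~ V p q
  HasClass⇒V {p} {q} {x} (mod4 {w} e) = 16#~ w (trans (*-congˡ (*-congˡ e))
    (solve 2 (λ r w → con 2 :* (con 2 :* (r :+ con 2 :* (con 2 :* w))) :=
        con 2 :* (con 2 :* r) :+ con 2 :* (con 2 :* (con 2 :* (con 2 :* w))))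
      refl (residue₄ p q) w))

  -- π⁴ = 4υ², and the square of the odd element `υ` is 1 modulo 4; so π⁴ is 4 modulo 16.
  *π⁴~ : ∀ {p q x} → HasClass (p , q) x → x * π ^ 4 ~ V (p ℕ.% 4) (q ℕ.% 2)
  *π⁴~ {p} {q} {x} x∈ = ~-trans (16#~ (x * proj₁ υ²) (begin
    x * π ^ 4                    ≈⟨ solve 2 (λ x π → x :* π :^ 4 := x :* ((π :* π) :* (π :* π))) refl x π
        ⟩
    x * ((π * π) * (π * π))      ≈⟨ *-congˡ (*-cong π²≈2υ π²≈2υ) ⟩
    x * ((2# * υ) * (2# * υ))    ≈⟨ solve 2
        (λ x υ → x :* ((con 2 :* υ) :* (con 2 :* υ)) := con 2 :* (con 2 :* (x :* (υ :* υ)))) refl x υ ⟩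
    2# * (2# * (x * (υ * υ)))    ≈⟨ *-congˡ (*-congˡ (*-congˡ (proj₂ υ²))) ⟩
    2# * (2# * (x * (1# + 2# * (2# * proj₁ υ²))))
      ≈⟨ solve 2 (λ x s → con 2 :* (con 2 :* (x :* (con 1 :+ con 2 :* (con 2 :* s))))
           := con 2 :* (con 2 :* x) :+ con 2 :* (con 2 :* (con 2 :* (con 2 :* (x :* s))))) refl x
               (proj₁ υ²) ⟩
    2# * (2# * x) + 2# * (2# * (2# * (2# * (x * proj₁ υ²)))) ∎))
    (~-trans (HasClass⇒V {p} {q} x∈) (V-% p q))

  -- The origin of `δ`: the terms 6π² + π⁴ of (1 + π)⁴ add up to 4υ(3 + υ). With υ = 1 + 2w the
  -- product υ(3 + υ) is (1 + 2w)(4 + 2w), which is 2w modulo 4.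
  υ[3+υ] : υ * (2# + 1# + υ) ≈ 2# * ⟦ δ ⟧ + 2# * (2# * (υ + w₁ * w₁ + w₂))
  υ[3+υ] = begin
    υ * (2# + 1# + υ)
      ≈⟨ *-congˡ (+-congˡ υ≈1+2w₁) ⟩
    υ * (2# + 1# + (1# + 2# * w₁))
      ≈⟨ solve 2 (λ υ w → υ :* (con 2 :+ con 1 :+ (con 1 :+ con 2 :* w)) :=
          con 2 :* (con 2 :* υ) :+ con 2 :* (υ :* w)) refl υ w₁ ⟩
    2# * (2# * υ) + 2# * (υ * w₁)
      ≈⟨ +-congˡ (*-congˡ (*-congʳ υ≈1+2w₁)) ⟩
    2# * (2# * υ) + 2# * ((1# + 2# * w₁) * w₁)
      ≈⟨ solve 2 (λ υ w → con 2 :* (con 2 :* υ) :+ con 2 :* ((con 1 :+ con 2 :* w) :* w) :=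
          con 2 :* w :+ con 2 :* (con 2 :* (υ :+ w :* w))) refl υ w₁ ⟩
    2# * w₁ + 2# * (2# * (υ + w₁ * w₁))
      ≈⟨ +-congʳ (*-congˡ w₁≈δ+2w₂) ⟩
    2# * (⟦ δ ⟧ + 2# * w₂) + 2# * (2# * (υ + w₁ * w₁))
      ≈⟨ solve 3 (λ d w υ → con 2 :* (d :+ con 2 :* w) :+ con 2 :* (con 2 :* υ) :=
          con 2 :* d :+ con 2 :* (con 2 :* (υ :+ w))) refl ⟦ δ ⟧ w₂ (υ + w₁ * w₁) ⟩
    2# * ⟦ δ ⟧ + 2# * (2# * (υ + w₁ * w₁ + w₂)) ∎

  -- As `υ` is odd, π² = 2υ is 2 modulo 4; so π exchanges the two digits and doubles one of them.
  π*≡₄ : ∀ {p q x} → HasClass (p , q) x → π * x ≡₄ residue₄ (2 ℕ.* q) p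
  π*≡₄ {p} {q} {x} (mod4 {w} e) = mod4 {quotient = ⟦ q ⟧ * w₁ + π * w} (begin
    π * x
      ≈⟨ *-congˡ e ⟩
    π * (⟦ p ⟧ + ⟦ q ⟧ * π + 2# * (2# * w))
      ≈⟨ solve 4 (λ p q π w → π :* (p :+ q :* π :+ con 2 :* (con 2 :* w)) :=
          p :* π :+ q :* (π :* π) :+ con 2 :* (con 2 :* (π :* w))) refl ⟦ p ⟧ ⟦ q ⟧ π w ⟩
    ⟦ p ⟧ * π + ⟦ q ⟧ * (π * π) + 2# * (2# * (π * w))
      ≈⟨ +-congʳ (+-congˡ (*-congˡ (trans π²≈2υ (*-congˡ υ≈1+2w₁)))) ⟩
    ⟦ p ⟧ * π + ⟦ q ⟧ * (2# * (1# + 2# * w₁)) + 2# * (2# * (π * w))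
      ≈⟨ solve 5 (λ p q π w w₁ → p :* π :+ q :* (con 2 :* (con 1 :+ con 2 :* w₁)) :+ con 2 :*
          (con 2 :* (π :* w))
          := (con 1 :+ (con 1 :+ con 0)) :* q :+ p :* π :+ con 2 :* (con 2 :* (q :* w₁ :+ π :* w))) refl
              ⟦ p ⟧ ⟦ q ⟧ π w w₁ ⟩
    ⟦ 2 ⟧ * ⟦ q ⟧ + ⟦ p ⟧ * π + 2# * (2# * (⟦ q ⟧ * w₁ + π * w))
      ≈⟨ +-congʳ (+-congʳ (×1-homo-* 2 q)) ⟨
    ⟦ 2 ℕ.* q ⟧ + ⟦ p ⟧ * π + 2# * (2# * (⟦ q ⟧ * w₁ + π * w)) ∎)

  -- (1 + π)⁴ = 1 + 4π + 4υ(3 + υ) + 8πυ. The last term vanishes modulo 8π and the third becomes 8δ.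
  *[1+π]⁴~ : ∀ {p q x} → HasClass (p , q) x →
             x * (1# + π) ^ 4 ~ x + V ((2 ℕ.* (δ ℕ.* p ℕ.+ q)) ℕ.% 4) (p ℕ.% 2)
  *[1+π]⁴~ {p} {q} {x} x∈@(mod4 {w} e) =
    ~-trans (~-reflexive expand)
    (~-trans (mod8π {quotient = υ * x} refl)
    (~-trans (16#~ ((υ + w₁ * w₁ + w₂) * x) (trans (+-congˡ (*-congˡ (*-congˡ (*-congʳ υ[3+υ]))))
       (solve 5 (λ a b d s x → a :+ b :+ con 2 :* (con 2 :* ((con 2 :* d :+ con 2 :* (con 2 :* s)) :* x))
          := (a :+ b :+ con 2 :* (con 2 :* (con 2 :* d :* x))) :+ con 2 :*
              (con 2 :* (con 2 :* (con 2 :* (s :* x)))))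
          refl x (2# * (2# * (π * x))) ⟦ δ ⟧ (υ + w₁ * w₁ + w₂) x)))
    (~-trans (~-+ (~-+ ~-refl (HasClass⇒V {2 ℕ.* q} {p} (π*≡₄ {p} {q} x∈))) 8δx~)
    (~-trans (~-reflexive (trans (+-assoc x _ _)
        (+-congˡ (trans (V-+ (2 ℕ.* q) p (2 ℕ.* (δ ℕ.* p)) 0)
        (reflexive (≡.cong₂ V arith (ℕ.+-identityʳ p)))))))
    (~-+ ~-refl (V-% (2 ℕ.* (δ ℕ.* p ℕ.+ q)) p))))))
    where
    arith : 2 ℕ.* q ℕ.+ 2 ℕ.* (δ ℕ.* p) ≡ 2 ℕ.* (δ ℕ.* p ℕ.+ q)
    arith = ≡.trans (≡.sym (ℕ.*-distribˡ-+ 2 q (δ ℕ.* p))) (≡.cong (2 ℕ.*_) (ℕ.+-comm q (δ ℕ.* p)))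
    -- The expansion with every π² replaced by a variable, so that π² = 2υ enters by congruence: the
    -- ring solver knows no relation for π.
    F : Carrier → Carrier
    F t = x + 2# * (2# * (π * x)) + ((2# + 2# + 2# + t) * t * x + 2# * (2# * (π * (t * x))))
    expand : x * (1# + π) ^ 4 ≈ x + 2# * (2# * (π * x)) + 2# * (2# * (υ * (2# + 1# + υ) * x)) + 2# *
        (2# * (2# * (π * (υ * x))))
    expand = begin
      x * (1# + π) ^ 4  ≈⟨ solve 2 (λ x π → let t = π :* π in x :* (con 1 :+ π) :^ 4
          := x :+ con 2 :* (con 2 :* (π :* x)) :+
              ((con 2 :+ con 2 :+ con 2 :+ t) :* t :* x :+ con 2 :* (con 2 :* (π :* (t :* x))))) refl x π
              ⟩
      F (π * π)         ≈⟨ +-congˡ (+-cong (*-congʳ (*-cong (+-congˡ π²≈2υ) π²≈2υ))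
          (*-congˡ (*-congˡ (*-congˡ (*-congʳ π²≈2υ))))) ⟩
      F (2# * υ)        ≈⟨ solve 3 (λ x π υ → let t = con 2 :* υ in
          x :+ con 2 :* (con 2 :* (π :* x)) :+
              ((con 2 :+ con 2 :+ con 2 :+ t) :* t :* x :+ con 2 :* (con 2 :* (π :* (t :* x))))
          := x :+ con 2 :* (con 2 :* (π :* x)) :+ con 2 :*
              (con 2 :* (υ :* (con 2 :+ con 1 :+ υ) :* x)) :+ con 2 :*
              (con 2 :* (con 2 :* (π :* (υ :* x))))) refl x π υ ⟩
      _ ∎
    8δx~ : 2# * (2# * (2# * ⟦ δ ⟧ * x)) ~ V (2 ℕ.* (δ ℕ.* p)) 0
    8δx~ = ~-trans (16#~ (2# * ⟦ δ ⟧ * w) (trans (*-congˡ (*-congˡ (*-congˡ e)))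
        (solve 5 (λ d p q π w → con 2 :* (con 2 :* (con 2 :* d :* (p :+ q :* π :+ con 2 :* (con 2 :* w))))
          := (con 2 :* (con 2 :* ((con 1 :+ (con 1 :+ con 0)) :* (d :* p))) :+ con 2 :*
              (con 2 :* (con 2 :* (π :* (d :* q))))) :+ con 2 :*
              (con 2 :* (con 2 :* (con 2 :* (con 2 :* d :* w)))))
          refl ⟦ δ ⟧ ⟦ p ⟧ ⟦ q ⟧ π w)))
      (mod8π {quotient = ⟦ δ ⟧ * ⟦ q ⟧} (+-congʳ (*-congˡ (*-congˡ (trans (*-congˡ (sym (×1-homo-* δ p)))
        (trans (sym (×1-homo-* 2 (δ ℕ.* p))) (trans (sym (+-identityʳ _)) (+-congˡ (sym (zeroˡ π))))))))))

  move : ∀ a b a′ b′ → V a b + V a′ b′ ~ V ((a ℕ.+ a′) ℕ.% 4) ((b ℕ.+ b′) ℕ.% 2)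
  move a b a′ b′ = ~-trans (~-reflexive (V-+ a b a′ b′)) (V-% (a ℕ.+ a′) (b ℕ.+ b′))

  Predicate : Set (Level.suc (c ⊔ ℓ))
  Predicate = Pred Carrier (c ⊔ ℓ)

  -- A mask is a lower bound for what can be reached: a cleared bit claims nothing.
  Holds : Mask → Predicate → Set (c ⊔ ℓ)
  Holds (mask b₀₀ b₁₀ b₂₀ b₃₀ b₀₁ b₁₁ b₂₁ b₃₁) P =
    (T b₀₀ → P (V 0 0)) × (T b₁₀ → P (V 1 0)) × (T b₂₀ → P (V 2 0)) × (T b₃₀ → P (V 3 0)) ×
    (T b₀₁ → P (V 0 1)) × (T b₁₁ → P (V 1 1)) × (T b₂₁ → P (V 2 1)) × (T b₃₁ → P (V 3 1))

  private
    variable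
      P Q : Predicate

  Holds-map : ∀ M → (∀ v → P v → Q v) → Holds M P → Holds M Q
  Holds-map (mask _ _ _ _ _ _ _ _) f (a , b , d , e , g , h , i , j) =
    f _ ∘ a , f _ ∘ b , f _ ∘ d , f _ ∘ e , f _ ∘ g , f _ ∘ h , f _ ∘ i , f _ ∘ j

  Holds-∪ : ∀ M N → Holds M P → Holds N P → Holds (M ∪ N) P
  Holds-∪ (mask x₁ x₂ x₃ x₄ x₅ x₆ x₇ x₈) (mask y₁ y₂ y₃ y₄ y₅ y₆ y₇ y₈)
    (a , b , d , e , g , h , i , j) (a′ , b′ , d′ , e′ , g′ , h′ , i′ , j′) =
    T-∨ x₁ y₁ a a′ , T-∨ x₂ y₂ b b′ , T-∨ x₃ y₃ d d′ , T-∨ x₄ y₄ e e′ ,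
    T-∨ x₅ y₅ g g′ , T-∨ x₆ y₆ h h′ , T-∨ x₇ y₇ i i′ , T-∨ x₈ y₈ j j′

  Holds-full : ∀ M → T (full M) → Q Respects _~_ → Holds M Q → ∀ a b → Q (V a b)
  Holds-full {Q} (mask true true true true true true true true) _ resp
      (h₀₀ , h₁₀ , h₂₀ , h₃₀ , h₀₁ , h₁₁ , h₂₁ , h₃₁) a b =
    resp (~-sym (V-% a b)) (reduced (a ℕ.% 4) (b ℕ.% 2) (ℕ.m%n<n a 4) (ℕ.m%n<n b 2))
    where
    reduced : ∀ a b → a ℕ.< 4 → b ℕ.< 2 → Q (V a b)
    reduced 0 0 _ _ = h₀₀ tt
    reduced 1 0 _ _ = h₁₀ tt
    reduced 2 0 _ _ = h₂₀ tt
    reduced 3 0 _ _ = h₃₀ tt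
    reduced 0 1 _ _ = h₀₁ tt
    reduced 1 1 _ _ = h₁₁ tt
    reduced 2 1 _ _ = h₂₁ tt
    reduced 3 1 _ _ = h₃₁ tt
    reduced (suc (suc (suc (suc _)))) _ (ℕ.s≤s (ℕ.s≤s (ℕ.s≤s (ℕ.s≤s ())))) _
    reduced _ (suc (suc _)) _ (ℕ.s≤s (ℕ.s≤s ()))

  -- Source and target predicate differ because a change goes with a new coefficient: `P` concerns
  -- the coefficients before it and `Q` those including it.
  Translates : (Mask → Mask) → ℕ → ℕ → Set _
  Translates f a b = ∀ {P Q : Predicate} M → Q Respects _~_ →
      (∀ v → P v → Q (v + V a b)) → Holds M P → Holds (f M) Q

  +1-translates : Translates +1ᵐ 1 0
  +1-translates (mask _ _ _ _ _ _ _ _) resp s (h₀₀ , h₁₀ , h₂₀ , h₃₀ , h₀₁ , h₁₁ , h₂₁ , h₃₁) =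
    resp (move 3 0 1 0) ∘ s _ ∘ h₃₀ , resp (move 0 0 1 0) ∘ s _ ∘ h₀₀ , resp (move 1 0 1 0) ∘ s _ ∘ h₁₀ ,
        resp (move 2 0 1 0) ∘ s _ ∘ h₂₀ ,
    resp (move 3 1 1 0) ∘ s _ ∘ h₃₁ , resp (move 0 1 1 0) ∘ s _ ∘ h₀₁ , resp (move 1 1 1 0) ∘ s _ ∘ h₁₁ ,
        resp (move 2 1 1 0) ∘ s _ ∘ h₂₁

  +π-translates : Translates +πᵐ 0 1
  +π-translates (mask _ _ _ _ _ _ _ _) resp s (h₀₀ , h₁₀ , h₂₀ , h₃₀ , h₀₁ , h₁₁ , h₂₁ , h₃₁) =
    resp (move 0 1 0 1) ∘ s _ ∘ h₀₁ , resp (move 1 1 0 1) ∘ s _ ∘ h₁₁ , resp (move 2 1 0 1) ∘ s _ ∘ h₂₁ ,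
        resp (move 3 1 0 1) ∘ s _ ∘ h₃₁ ,
    resp (move 0 0 0 1) ∘ s _ ∘ h₀₀ , resp (move 1 0 0 1) ∘ s _ ∘ h₁₀ , resp (move 2 0 0 1) ∘ s _ ∘ h₂₀ ,
        resp (move 3 0 0 1) ∘ s _ ∘ h₃₀

  V-00 : ∀ v → v + V 0 0 ≈ v
  V-00 v = solve 2 (λ v π → v :+ con 2 :* (con 2 :* (con 0 :+ con 0 :* π)) := v) refl v π

  V-shift : ∀ v a b a′ b′ → v + V a b + V a′ b′ ≈ v + V (a ℕ.+ a′) (b ℕ.+ b′)
  V-shift v a b a′ b′ = trans (+-assoc v _ _) (+-congˡ (V-+ a b a′ b′))

  iter-translates : ∀ {f a b} → Translates f a b → ∀ n → Translates (iter n f) (n ℕ.* a) (n ℕ.* b)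
  iter-translates tr zero    M resp s h = Holds-map M (λ v p → resp (~-reflexive (V-00 v)) (s v p)) h
  iter-translates {f} {a} {b} tr (suc n) {P} {Q} M resp s h =
    iter-translates tr n {P = Intermediate} (f M) resp
      (λ { w (v , p , w~) → resp (~-trans (~-reflexive (sym (V-shift v a b _ _)))
          (~-+ (~-sym w~) ~-refl)) (s v p) })
      (tr {P} {Intermediate} M (λ { x~y (v , p , x~) → v , p , ~-trans (~-sym x~y) x~ })
          (λ v p → v , p , ~-refl) h)
    where
    -- The translate of `P` closed under congruence, since `Translates` asks its target to respect
    -- congruence.
    Intermediate : Predicate
    Intermediate w = ∃[ v ] P v × w ~ v + V a b

  shift-translates : ∀ a b → Translates (shift a b) a b
  shift-translates a b {P} {Q} M resp s h =
    iter-translates {+1ᵐ} {1} {0} +1-translates a {P = Intermediate} (iter b +πᵐ M) resp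
      (λ { w (v , p , w~) → resp (~-trans
          (~-reflexive (sym (trans (V-shift v (b ℕ.* 0) (b ℕ.* 1) (a ℕ.* 1) (a ℕ.* 0))
          (+-congˡ (reflexive (≡.cong₂ V eqa eqb)))))) (~-+ (~-sym w~) ~-refl)) (s v p) })
      (iter-translates {+πᵐ} {0} {1} +π-translates b {P} {Intermediate} M
          (λ { x~y (v , p , x~) → v , p , ~-trans (~-sym x~y) x~ }) (λ v p → v , p , ~-refl) h)
    where
    Intermediate : Predicate
    Intermediate w = ∃[ v ] P v × w ~ v + V (b ℕ.* 0) (b ℕ.* 1)
    eqa : b ℕ.* 0 ℕ.+ a ℕ.* 1 ≡ a
    eqa = ≡.cong₂ ℕ._+_ (ℕ.*-zeroʳ b) (ℕ.*-identityʳ a)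
    eqb : b ℕ.* 1 ℕ.+ a ℕ.* 0 ≡ b
    eqb = ≡.trans (≡.cong₂ ℕ._+_ (ℕ.*-identityʳ b) (ℕ.*-zeroʳ a)) (ℕ.+-identityʳ b)

  Holds-grow : ∀ a b M → Q Respects _~_ → (∀ v → P v → Q v) → (∀ v → P v → Q (v + V a b)) →
               Holds M P → Holds (grow a b M) Q
  Holds-grow a b M resp f s h = Holds-∪ M (shift a b M) (Holds-map M f h)
      (shift-translates a b M resp s h)

  open Quartic R

  Unit : Pred Carrier (c ⊔ ℓ)
  Unit x = ∃[ k ] x ≈ 1# + π * k

  Primary : Pred (Carrier × Carrier) (c ⊔ ℓ)
  Primary (b , x) = Unit b × Unit x

  Solved : Pred (List Carrier) (c ⊔ ℓ)
  Solved = Represents (_~ 0#) Primary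

  ~0-resp : (_~ 0#) Respects _≈_
  ~0-resp x≈y = ~-trans (~-reflexive (sym x≈y))

  Reaches ReachesPrimary : List Carrier → Predicate
  Reaches        bs v = ∃[ ps ] map proj₁ ps ≡ bs × form ps ~ v
  ReachesPrimary bs v = Represents (_~ v) Primary bs

  extend : ∀ {b bs v w} x → b * x ^ 4 ~ w → Reaches bs v → Reaches (b ∷ bs) (w + v)
  extend x e (ps , ≡.refl , z) = (_ , x) ∷ ps , ≡.refl , ~-+ e z

  extendPrimary : ∀ {b bs v w} x → b * x ^ 4 ~ w → ReachesPrimary bs v → ReachesPrimary (b ∷ bs) (w + v)
  extendPrimary x e (ps , ≡.refl , z , a) = (_ , x) ∷ ps , ≡.refl , ~-+ e z , there a

  startPrimary : ∀ {b bs v w} x → b * x ^ 4 ~ w → Unit b → Unit x → Reaches bs v →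
      ReachesPrimary (b ∷ bs) (w + v)
  startPrimary x e ub ux (ps , ≡.refl , z) = (_ , x) ∷ ps , ≡.refl , ~-+ e z , here (ub , ux)

  reaches-resp : ∀ {bs} → Reaches bs Respects _~_
  reaches-resp v~w (ps , eq , z) = ps , eq , ~-trans z v~w

  reachesPrimary-resp : ∀ {bs} → ReachesPrimary bs Respects _~_
  reachesPrimary-resp v~w (ps , eq , z , a) = ps , eq , ~-trans z v~w , a

  *0⁴ : ∀ b → b * 0# ^ 4 ~ 0#
  *0⁴ b = ~-reflexive (solve 1 (λ b → b :* con 0 :^ 4 := con 0) refl b)

  *1⁴ : ∀ b → b * 1# ^ 4 ~ b
  *1⁴ b = ~-reflexive (solve 1 (λ b → b :* con 1 :^ 4 := b) refl b)

  unit-1 : Unit 1#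
  unit-1 = 0# , solve 1 (λ π → con 1 := con 1 :+ π :* con 0) refl π

  unit-1+π : Unit (1# + π)
  unit-1+π = 1# , +-congˡ (sym (*-identityʳ π))

  odd-class⇒unit : ∀ p {q b} → p ℕ.% 2 ≡ 1 → HasClass (p , q) b → Unit b
  odd-class⇒unit p {q} {b} odd (mod4 {w} e) = ⟦ q ⟧ + π * ν * (⟦ p ℕ./ 2 ⟧ + 2# * w) , (begin
    b                                                      ≈⟨ e ⟩
    ⟦ p ⟧ + ⟦ q ⟧ * π + 2# * (2# * w)                      ≈⟨ +-congʳ
        (+-congʳ (trans (⟦⟧-% p 2) (+-congʳ (×-congˡ odd)))) ⟩
    ⟦ 1 ⟧ + ⟦ p ℕ./ 2 ⟧ * ⟦ 2 ⟧ + ⟦ q ⟧ * π + 2# * (2# * w)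
      ≈⟨ solve 4 (λ h q π w → con 1 :+ con 0 :+ h :* (con 1 :+ (con 1 :+ con 0)) :+ q :* π :+ con 2 :*
          (con 2 :* w)
           := con 1 :+ q :* π :+ con 2 :* (h :+ con 2 :* w)) refl ⟦ p ℕ./ 2 ⟧ ⟦ q ⟧ π w ⟩
    1# + ⟦ q ⟧ * π + 2# * (⟦ p ℕ./ 2 ⟧ + 2# * w)           ≈⟨ +-congˡ (*-congʳ 2≈ππν) ⟩
    1# + ⟦ q ⟧ * π + π * (π * ν) * (⟦ p ℕ./ 2 ⟧ + 2# * w)
      ≈⟨ solve 4 (λ q π ν s → con 1 :+ q :* π :+ π :* (π :* ν) :* s := con 1 :+ π :* (q :+ π :* ν :* s))
          refl ⟦ q ⟧ π ν (⟦ p ℕ./ 2 ⟧ + 2# * w) ⟩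
    1# + π * (⟦ q ⟧ + π * ν * (⟦ p ℕ./ 2 ⟧ + 2# * w))      ∎)

  -- `B` plays the part of the exact sum over T. The entry records only its class modulo 4, and the
  -- mask measures values relative to `B`.
  SatEntry : List Carrier → Entry → Set (c ⊔ ℓ)
  SatEntry bs (entry i j M) = ∃[ B ] B ≡₄ residue₄ i j × Holds M (λ v → ReachesPrimary bs (B + v))

  Sat : List Carrier → State → Set (c ⊔ ℓ)
  Sat bs (state M es) = Holds M (Reaches bs) × All (SatEntry bs) es

  swapʳ : ∀ x y z → x + (y + z) ≈ y + (z + x)
  swapʳ = solve 3 (λ x y z → x :+ (y :+ z) := y :+ (z :+ x)) refl

  SatEntry-R : ∀ {p q b bs i j M} → HasClass (p , q) b → SatEntry bs (entry i j M) →
               SatEntry (b ∷ bs) (entry i j (growR δ (p , q) M))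
  SatEntry-R {p} {q} {b} {M = M} b∈ (B , B≡ , h) = B , B≡ ,
    Holds-grow (p ℕ.% 4) (q ℕ.% 2) M (reachesPrimary-resp ∘ ~-+ ~-refl)
      (λ v r → reachesPrimary-resp (~-reflexive (+-identityˡ _)) (extendPrimary 0# (*0⁴ b) r))
      (λ v r → reachesPrimary-resp (~-reflexive (swapʳ _ _ _)) (extendPrimary π (*π⁴~ {p} {q} b∈) r)) h

  SatEntry-T : ∀ {p q b bs i j M} → HasClass (p , q) b → SatEntry bs (entry i j M) →
               SatEntry (b ∷ bs) (entry ((i ℕ.+ p) ℕ.% 4) ((j ℕ.+ q) ℕ.% 4) (growT δ (p , q) M))
  SatEntry-T {p} {q} {b} {i = i} {j = j} {M = M} b∈ (B , B≡ , h) = B + b , residue₄-+ i j p q B≡ b∈ ,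
    Holds-grow ((2 ℕ.* (δ ℕ.* p ℕ.+ q)) ℕ.% 4) (p ℕ.% 2) M (reachesPrimary-resp ∘ ~-+ ~-refl)
      (λ v r → reachesPrimary-resp (~-reflexive
          (solve 3 (λ b B v → b :+ (B :+ v) := B :+ b :+ v) refl _ _ _)) (extendPrimary 1# (*1⁴ b) r))
      (λ v r → reachesPrimary-resp (~-reflexive
          (solve 4 (λ b t B v → (b :+ t) :+ (B :+ v) := B :+ b :+ (v :+ t)) refl _ _ _ _))
        (extendPrimary (1# + π) (*[1+π]⁴~ {p} {q} b∈) r)) h

  SatEntry-start : ∀ {p q b bs M} → p ℕ.% 2 ≡ 1 → HasClass (p , q) b → Holds M (Reaches bs) →
                   SatEntry (b ∷ bs) (entry p q (growT δ (p , q) M))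
  SatEntry-start {p} {q} {b} {M = M} odd b∈ h = b , b∈ ,
    Holds-grow ((2 ℕ.* (δ ℕ.* p ℕ.+ q)) ℕ.% 4) (p ℕ.% 2) M (reachesPrimary-resp ∘ ~-+ ~-refl)
      (λ v → startPrimary 1# (*1⁴ b) (odd-class⇒unit p {q} odd b∈) unit-1)
      (λ v r → reachesPrimary-resp (~-reflexive
          (solve 3 (λ b t v → (b :+ t) :+ v := b :+ (v :+ t)) refl _ _ _))
        (startPrimary (1# + π) (*[1+π]⁴~ {p} {q} b∈) (odd-class⇒unit p {q} odd b∈) unit-1+π r)) h

  stepE-sound : ∀ {cl b bs es} → HasClass cl b → All (SatEntry bs) es →
      All (SatEntry (b ∷ bs)) (stepE δ cl es)
  stepE-sound                                b∈ []       = []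
  stepE-sound {p , q} {es = entry i j M ∷ _} b∈ (s ∷ ss) =
    SatEntry-R {p} {q} {i = i} {j = j} {M = M} b∈ s ∷ SatEntry-T {p} {q} {i = i} {j = j} {M = M} b∈ s
        ∷ stepE-sound {p , q} b∈ ss

  Reaches-grow : ∀ {p q b bs} M → HasClass (p , q) b → Holds M (Reaches bs) →
      Holds (growR δ (p , q) M) (Reaches (b ∷ bs))
  Reaches-grow {p} {q} {b} M b∈ = Holds-grow (p ℕ.% 4) (q ℕ.% 2) M reaches-resp
    (λ v r → reaches-resp (~-reflexive (+-identityˡ v)) (extend 0# (*0⁴ b) r))
    (λ v r → reaches-resp (~-reflexive (+-comm _ v)) (extend π (*π⁴~ {p} {q} b∈) r))

  step-sound : ∀ {cl b bs} st → HasClass cl b → Sat bs st → Sat (b ∷ bs) (step δ cl st)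
  step-sound {p , q} (state M es) b∈ (h , ss) with p ℕ.% 2 in odd
  ... | 0           = Reaches-grow {p} {q} M b∈ h , stepE-sound {p , q} b∈ ss
  ... | 1           = Reaches-grow {p} {q} M b∈ h , SatEntry-start {p} {q} {M = M} odd b∈ h
      ∷ stepE-sound {p , q} b∈ ss
  ... | suc (suc _) = Reaches-grow {p} {q} M b∈ h , stepE-sound {p , q} b∈ ss

  HasClassIn : List Class → Predicate
  HasClassIn cls b = Any (λ cl → HasClass cl b) cls

  module _ (digits : ∀ x → ∃[ p ] ∃[ q ] x ≡₄ residue₄ p q) where

    done-sound : ∀ {bs} es → T (done δ es) → All (SatEntry bs) es → Solved bs
    done-sound {bs} (entry 0 0 M ∷ es) t ((B , mod4 {β} B≡ , h) ∷ ss) = T-∨ (full M) (done δ es) finish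
        (λ t → done-sound es t ss) t
      where
      finish : T (full M) → Solved bs
      -- `B` is 4β, and the form reaches B + 4(a + bπ) for all a and b. The digits of -β modulo 4
      -- give the change that cancels `B` modulo 16, hence modulo 8π.
      finish t = let a , b , mod4 {w} e = digits (- β) in
        reachesPrimary-resp (~-sym (16#~ w (begin
          0#                                       ≈⟨ solve 0 (con 0 := con 2 :* (con 2 :* con 0)) refl ⟩
          2# * (2# * 0#)                           ≈⟨ *-congˡ (*-congˡ (-‿inverseʳ β)) ⟨
          2# * (2# * (β - β))                      ≈⟨ *-congˡ (*-congˡ (+-congˡ e)) ⟩
          2# * (2# * (β + (residue₄ a b + 2# * (2# * w))))
            ≈⟨ solve 4 (λ β r w π → con 2 :* (con 2 :* (β :+ (r :+ con 2 :* (con 2 :* w))))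
                 := con 0 :+ con 0 :* π :+ con 2 :* (con 2 :* β) :+ con 2 :* (con 2 :* r) :+ con 2 :*
                     (con 2 :* (con 2 :* (con 2 :* w))))
                 refl β (residue₄ a b) w π ⟩
          residue₄ 0 0 + 2# * (2# * β) + V a b + 2# * (2# * (2# * (2# * w)))   ≈⟨ +-congʳ (+-congʳ B≡) ⟨
          B + V a b + 2# * (2# * (2# * (2# * w)))  ∎)))
          (Holds-full M t (reachesPrimary-resp ∘ ~-+ ~-refl) h a b)
    done-sound (entry 0 (suc _) _ ∷ es) t (_ ∷ ss) = done-sound es t ss
    done-sound (entry (suc _) _ _ ∷ es) t (_ ∷ ss) = done-sound es t ss

    doneS-sound : ∀ {bs} st → Sat bs st → T (doneS δ st) → Solved bs
    doneS-sound (state _ es) (_ , ss) t = done-sound es t ss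

    -- `cs` are the coefficients already consumed, described by the state; `bs` are those still to
    -- come.
    Sound : (State → Bool) → List Carrier → Set (c ⊔ ℓ)
    Sound k bs = ∀ {cs} st → Sat cs st → T (k st) → Solved (bs ++ cs)

    -- The two outcomes are the two branches of `level`: the first class is discarded, or a
    -- coefficient of that class is consumed.
    extract : ∀ {cl cls bs} → All (HasClassIn (cl ∷ cls)) bs →
              All (HasClassIn cls) bs ⊎ ∃[ b ] ∃[ bs′ ] HasClass cl b × bs ↭ b ∷ bs′
    extract [] = inj₁ []
    extract (here b∈ ∷ _) = inj₂ (_ , _ , b∈ , Perm.refl)
    extract {cl} (there b∈ ∷ bs∈) with extract {cl} bs∈
    ... | inj₁ rest                   = inj₁ (b∈ ∷ rest)
    ... | inj₂ (b , bs′ , b∈cl , perm) = inj₂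
        (b , _ , b∈cl , Perm.trans (Perm.prep _ perm) (Perm.swap _ b Perm.refl))

    level-sound : ∀ {k rest} → Sound k rest → ∀ cls n bs → n ℕ.≤ List.length bs →
        All (HasClassIn cls) bs →
                  Sound (level δ k cls n) (bs ++ rest)
    level-sound {rest = rest} sound cls zero bs _ _ {cs} st sat t =
      -- Enough coefficients of this level have been consumed; those left over receive the argument
      -- 0.
      ≡.subst Solved (≡.sym (++-assoc bs rest cs)) (Represents-++ˡ ~0-resp bs (sound st sat t))
    level-sound sound [] (suc n) (b ∷ bs) _ (() ∷ _)
    level-sound {k} {rest} sound (cl ∷ cls) (suc n) bs n<len bs∈ {cs} st sat t =
      T-∨ (doneS δ st) _ (λ t → Represents-++ˡ ~0-resp (bs ++ rest) (doneS-sound st sat t))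
        (λ t →
          [ (λ bs∈cls → level-sound sound cls (suc n) bs n<len bs∈cls st sat
              (proj₂ (Equivalence.to (T-∧ {level δ k (cl ∷ cls) n (step δ cl st)}) t)))
          , (λ (b , bs′ , b∈ , perm) → Represents-resp-↭ ~0-resp
              (Perm.trans (Perm.shift b (bs′ ++ rest) cs) (Perm.++⁺ʳ cs (Perm.++⁺ʳ rest (↭-sym perm))))
              (level-sound sound (cl ∷ cls) n bs′
                (ℕ.s≤s⁻¹ (≡.subst (suc n ℕ.≤_) (Perm.↭-length perm) n<len))
                (All.tail (Perm.All-resp-↭ perm bs∈)) (step δ cl st) (step-sound {cl} st b∈ sat)
                (proj₁ (Equivalence.to T-∧ t))))
          ]′ (extract {cl} bs∈)) t

    search-sound : ∀ {n₀ n₁ n₂ n₃ l₀ l₁ l₂ l₃} → T (search δ n₀ n₁ n₂ n₃) →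
      n₀ ℕ.≤ List.length l₀ → All (HasClassIn L0) l₀ → n₁ ℕ.≤ List.length l₁ → All (HasClassIn L1) l₁ →
      n₂ ℕ.≤ List.length l₂ → All (HasClassIn L2) l₂ → n₃ ℕ.≤ List.length l₃ → All (HasClassIn L3) l₃ →
      Solved (l₀ ++ l₁ ++ l₂ ++ l₃)
    search-sound {n₀} {n₁} {n₂} {n₃} {l₀} {l₁} {l₂} {l₃} t p₀ a₀ p₁ a₁ p₂ a₂ p₃ a₃ =
      ≡.subst Solved (≡.trans (++-assoc l₀ _ [])
          (≡.cong (l₀ ++_) (≡.trans (++-assoc l₁ _ []) (≡.cong (l₁ ++_)
          (≡.trans (++-assoc l₂ _ []) (≡.cong (l₂ ++_) (≡.trans (++-identityʳ _) (++-identityʳ l₃))))))))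
        (level-sound (level-sound (level-sound (level-sound (λ st → doneS-sound st)
          L3 n₃ l₃ p₃ a₃) L2 n₂ l₂ p₂ a₂) L1 n₁ l₁ p₁ a₁) L0 n₀ l₀ p₀ a₀
          init (((λ _ → [] , ≡.refl , ~-reflexive (trans (sym (V-00 0#)) (+-identityˡ _))) ,
            (λ ()) , (λ ()) , (λ ()) , (λ ()) , (λ ()) , (λ ()) , (λ ())) , []) t)

record RamifiedIntegers {c ℓ} (R : CommutativeRing c ℓ) (ramification : Ramification R) : Set
    (c ⊔ ℓ) where
  open CommutativeRing R
  open Ramification ramification
  open Congruences R ramification
  field
    digits     : ∀ x → ∃[ p ] ∃[ q ] x ≡₄ residue₄ p q
    parity     : ∀ x → (∃[ y ] x ≈ π * y) ⊎ HasClassIn L0 x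
    π-cancel   : ∀ {x} → π * x ≈ 0# → x ≈ 0#
    π-nonunit  : ∀ y → ¬ 1# ≈ π * y
    adic       : AdicallyComplete R π
    d          : ℕ
    {e}        : Carrier
    π²≈d+16e   : π * π ≈ ⟦ d ⟧ + 2# * (2# * (2# * (2# * e)))
    faithful   : ∀ a b {y} → residue₄ a b ≈ 2# * (2# * (2# * (2# * y))) → a ℕ.% 16 ≡ 0 × b ℕ.% 16 ≡ 0

-- Distributions of eleven coefficients over the levels

covers : ℕ → ℕ → ℕ → ℕ → ℕ × ℕ × ℕ × ℕ → Bool
covers n₀ n₁ n₂ n₃ (k₀ , k₁ , k₂ , k₃) = (k₀ ℕ.≤ᵇ n₀) ∧ (k₁ ℕ.≤ᵇ n₁) ∧ (k₂ ℕ.≤ᵇ n₂) ∧ (k₃ ℕ.≤ᵇ n₃)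

-- Numbers of coefficients on levels 0 to 3 for which the search succeeds with either value of δ.
-- The distribution 6, 0, 0, 4 dominates none of them after any rotation. It is the distribution of
-- the ten coefficients in the lower bound, where β has valuation 3.
configurations : List (ℕ × ℕ × ℕ × ℕ)
configurations = (7 , 0 , 0 , 0) ∷ (6 , 0 , 1 , 0) ∷ (5 , 4 , 0 , 0) ∷ (3 , 0 , 2 , 1) ∷ (3 , 4 , 1 , 0)
    ∷ []

covered : ℕ → ℕ → ℕ → ℕ → Bool
covered n₀ n₁ n₂ n₃ = any (covers n₀ n₁ n₂ n₃) configurations

coveredUpToRotation : ℕ → ℕ → ℕ → ℕ → Bool
coveredUpToRotation n₀ n₁ n₂ n₃ =
  covered n₀ n₁ n₂ n₃ ∨ covered n₁ n₂ n₃ n₀ ∨ covered n₂ n₃ n₀ n₁ ∨ covered n₃ n₀ n₁ n₂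

all< : ℕ → (ℕ → Bool) → Bool
all< zero    p = true
all< (suc n) p = p n ∧ all< n p

all<-sound : ∀ n {p} → T (all< n p) → ∀ {i} → i ℕ.< n → T (p i)
all<-sound (suc n) {p} t {i} i<1+n with Equivalence.to (T-∧ {p n}) t | ℕ.m<1+n⇒m<n∨m≡n i<1+n
... | _  , t′ | inj₁ i<n    = all<-sound n t′ i<n
... | t′ , _  | inj₂ ≡.refl = t′

coverage : ∀ n₀ n₁ n₂ n₃ → n₀ ℕ.+ (n₁ ℕ.+ (n₂ ℕ.+ n₃)) ≡ 11 → T (coveredUpToRotation n₀ n₁ n₂ n₃)
coverage n₀ n₁ n₂ n₃ eq = ≡.subst (T ∘ coveredUpToRotation n₀ n₁ n₂) n₃≡
  (all<-sound 12 {check n₀ n₁} (all<-sound 12 {λ b → all< 12 (check n₀ b)}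
    (all<-sound 12 {λ a → all< 12 λ b → all< 12 (check a b)} tt
      (bound (ℕ.m≤m+n n₀ _)))
      (bound (ℕ.≤-trans (ℕ.m≤m+n n₁ _) (ℕ.m≤n+m _ n₀))))
      (bound (ℕ.≤-trans (ℕ.m≤m+n n₂ n₃) (ℕ.≤-trans (ℕ.m≤n+m _ n₁) (ℕ.m≤n+m _ n₀)))))
  where
  check : ℕ → ℕ → ℕ → Bool
  -- The subtraction is truncated: triples with a sum above 11 are tested too, with 0 as the fourth
  -- number, and pass as well.
  check a b d = coveredUpToRotation a b d (11 ℕ.∸ (a ℕ.+ (b ℕ.+ d)))
  bound : ∀ {k} → k ℕ.≤ n₀ ℕ.+ (n₁ ℕ.+ (n₂ ℕ.+ n₃)) → k ℕ.< 12
  bound {k} k≤ = ℕ.s≤s (≡.subst (k ℕ.≤_) eq k≤)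
  n₃≡ : 11 ℕ.∸ (n₀ ℕ.+ (n₁ ℕ.+ n₂)) ≡ n₃
  n₃≡ = ≡.trans (≡.cong (ℕ._∸ (n₀ ℕ.+ (n₁ ℕ.+ n₂)))
      (≡.trans (≡.sym eq) (≡.trans (≡.cong (n₀ ℕ.+_) (≡.sym (ℕ.+-assoc n₁ n₂ n₃)))
          (≡.sym (ℕ.+-assoc n₀ (n₁ ℕ.+ n₂) n₃)))))
    (ℕ.m+n∸m≡n (n₀ ℕ.+ (n₁ ℕ.+ n₂)) n₃)

searchAll : ℕ → Bool
searchAll δ = all (λ (k₀ , k₁ , k₂ , k₃) → search δ k₀ k₁ k₂ k₃) configurations

-- The upper bound over the ring of integers

module Isotropy (R : CommutativeRing 0ℓ 0ℓ) (ramification : Ramification R)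
    (integers : RamifiedIntegers R ramification)
  (searched : T (searchAll (Ramification.δ ramification))) where
  open CommutativeRing R
  open Ramification ramification using (π; δ)
  open Congruences R ramification
  open RamifiedIntegers integers using (digits; parity; π-cancel; π-nonunit; adic)
  open AdicallyComplete adic using (Div-separated)
  open Divisibility R π
  open import Algebra.Properties.Semiring.Exp semiring using (_^_; ^-congˡ)
  open import Algebra.Solver.Ring.NaturalCoefficients.Default commutativeSemiring using (solve; con; _:+_; _:*_; _:^_; _:=_)
  open import Relation.Binary.Reasoning.Setoid setoid
  open Quartic R
  open Hensel R adic using (hensel)

  Odd : Carrier → Set
  Odd = HasClassIn L0

  unit-* : ∀ {x y} → Unit x → Unit y → Unit (x * y)
  unit-* (k , e) (l , e′) = k + l + π * (k * l) , trans (*-cong e e′)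
    (solve 3 (λ k l π → (con 1 :+ π :* k) :* (con 1 :+ π :* l) :=
        con 1 :+ π :* (k :+ l :+ π :* (k :* l))) refl k l π)

  unit+π≉0 : ∀ {x} y → Unit x → ¬ x + π * y ≈ 0#
  unit+π≉0 {x} y (k , e) x+πy≈0 = π-nonunit (- (k + y)) (begin
    1#                                    ≈⟨ +-identityʳ 1# ⟨
    1# + 0#                               ≈⟨ +-congˡ
        (trans (sym (zeroʳ π)) (*-congˡ (sym (-‿inverseʳ (k + y))))) ⟩
    1# + π * (k + y - (k + y))            ≈⟨ solve 4 (λ π k y n → con 1 :+ π :* (k :+ y :+ n) :=
        (con 1 :+ π :* k :+ π :* y) :+ π :* n) refl π k y (- (k + y)) ⟩
    1# + π * k + π * y + π * - (k + y)    ≈⟨ +-congʳ (trans (+-congʳ (sym e)) x+πy≈0) ⟩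
    0# + π * - (k + y)                    ≈⟨ +-identityˡ _ ⟩
    π * - (k + y)                         ∎)

  Any⇒↭ : ∀ {ps} → Any Primary ps → ∃[ p ] ∃[ qs ] Primary p × ps ↭ p ∷ qs
  Any⇒↭ (here pr)         = _ , _ , pr , Perm.refl
  Any⇒↭ (there {p} a) = let q , qs , pr , perm = Any⇒↭ a in
    q , p ∷ qs , pr , Perm.trans (Perm.prep p perm) (Perm.swap p q Perm.refl)

  unit-*³ : ∀ {b x} → Unit b → Unit x → Unit (b * x ^ 3)
  unit-*³ {b} {x} ub ux = unit-* {b} {x ^ 3} ub
      (unit-* {x} {x ^ 2} ux (unit-* {x} {x ^ 1} ux (unit-* {x} {1#} ux unit-1)))

  -- Hensel's lemma alters only the argument of one primary pair, moved to the front. The altered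
  -- argument is still 1 modulo π, hence nonzero.
  Solved⇒HasZero : ∀ {bs} → Solved bs → HasZero bs
  Solved⇒HasZero (ps , ≡.refl , mod8π {f} e , a) = lift (Any⇒↭ a)
    where
    lift : ∃[ p ] ∃[ qs ] Primary p × ps ↭ p ∷ qs → HasZero (map proj₁ ps)
    lift ((b , x) , qs , (ub , ux) , perm) = root (hensel (proj₂ (unit-*³ ub ux)) 8π∣)
      where
      8π∣ : b * x ^ 4 + form qs ≈ 2# * (2# * (2# * (π * f)))
      8π∣ = trans (sym (form-↭ perm)) (trans e (+-identityˡ _))
      root : ∃[ z ] b * (x + 2# * π * z) ^ 4 + form qs ≈ 0# → HasZero (map proj₁ ps)
      root (z , vanish) = Represents-resp-↭ ≈0-resp (↭-sym (Perm.map⁺ proj₁ perm))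
        ((b , x + 2# * π * z) ∷ qs , ≡.refl , vanish ,
         here λ y≈0 → unit+π≉0 {x} (2# * z) ux
             (trans (+-congˡ (solve 2 (λ π z → π :* (con 2 :* z) := con 2 :* π :* z) refl π z)) y≈0))

  Levels : (l₀ l₁ l₂ l₃ : List Carrier) → List Carrier
  Levels l₀ l₁ l₂ l₃ = l₀ ++ map (π *_) (l₁ ++ map (π *_) (l₂ ++ map (π *_) l₃))

  ++-map-↭ : ∀ l {b xs ys} → xs ↭ b ∷ ys → l ++ map (π *_) xs ↭ π * b ∷ l ++ map (π *_) ys
  ++-map-↭ l {b} perm = Perm.trans (Perm.++⁺ˡ l (Perm.map⁺ (π *_) perm)) (Perm.shift (π * b) l _)

  Levels≡ : ∀ l₀ l₁ l₂ l₃ → l₀ ++ map (π *_) l₁ ++ map (π *_) (map (π *_) l₂) ++ map (π *_)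
      (map (π *_) (map (π *_) l₃)) ≡ Levels l₀ l₁ l₂ l₃
  Levels≡ l₀ l₁ l₂ l₃ = ≡.cong (l₀ ++_) (≡.sym (≡.trans (map-++ (π *_) l₁ _) (≡.cong (map (π *_) l₁ ++_)
    (≡.trans (≡.cong (map (π *_)) (map-++ (π *_) l₂ _)) (map-++ (π *_) (map (π *_) l₂) _)))))

  -- Multiplication by π puts `l₁`, `l₂` and `l₃` on their levels in the target, while `l₀` acquires
  -- the factor π⁴, which is absorbed into its arguments.
  HasZero-rotate : ∀ l₀ l₁ l₂ l₃ → HasZero (Levels l₁ l₂ l₃ l₀) → HasZero (Levels l₀ l₁ l₂ l₃)
  HasZero-rotate l₀ l₁ l₂ l₃ h = ≡.subst HasZero (Levels≡ l₀ l₁ l₂ l₃)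
    (HasZero-≼ (m l₁ ++ m (m l₂) ++ m (m (m l₃))) (π⁴-≼ l₀)
      (Represents-resp-↭ ≈0-resp (Perm.trans (Perm.↭-reflexive eq)
          (Perm.++-comm (m l₁ ++ m (m l₂) ++ m (m (m l₃))) _)) (HasZero-map-* π h)))
    where
    m = map (π *_)
    eq : m (Levels l₁ l₂ l₃ l₀) ≡ (m l₁ ++ m (m l₂) ++ m (m (m l₃))) ++ m (m (m (m l₀)))
    eq = ≡.trans (≡.cong m (≡.sym (Levels≡ l₁ l₂ l₃ l₀))) (≡.trans (map-++ (π *_) l₁ _)
      (≡.trans (≡.cong (m l₁ ++_) (≡.trans (map-++ (π *_) (m l₂) _)
          (≡.cong (m (m l₂) ++_) (map-++ (π *_) (m (m l₃)) _))))
        (≡.trans (≡.cong (m l₁ ++_) (≡.sym (++-assoc (m (m l₂)) _ _))) (≡.sym (++-assoc (m l₁) _ _)))))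
    π⁴-≼ : ∀ bs → Pointwise _≼_ bs (m (m (m (m bs))))
    π⁴-≼ []       = []
    π⁴-≼ (b ∷ bs) = HasZero-/⁴ {π} π-cancel
        (solve 2 (λ π b → π :* (π :* (π :* (π :* b))) := b :* π :^ 4) refl π b) ∷ π⁴-≼ bs

  -- The summands 0 come from adding the class of `0#` with `residue₄-+`, which reduces both digits
  -- modulo 4.
  timesπ : Class → Class
  timesπ (p , q) = (2 ℕ.* q ℕ.+ 0) ℕ.% 4 , (p ℕ.+ 0) ℕ.% 4

  HasClass-π : ∀ {cl x} → HasClass cl x → HasClass (timesπ cl) (π * x)
  HasClass-π {p , q} {x} x∈ = +0 (residue₄-+ (2 ℕ.* q) p 0 0 (π*≡₄ {p} {q} x∈) (mod4 {quotient = 0#}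
    (solve 1 (λ π → con 0 := con 0 :+ con 0 :* π :+ con 2 :* (con 2 :* con 0)) refl π)))
    where
    +0 : ∀ {x y} → x + 0# ≡₄ y → x ≡₄ y
    +0 (mod4 e) = mod4 (trans (sym (+-identityʳ _)) e)

  HasClassIn-π : ∀ {cls cls′ x} → All (λ cl → timesπ cl ∈ cls′) cls → HasClassIn cls x →
      HasClassIn cls′ (π * x)
  HasClassIn-π {cl ∷ _} (cl∈ ∷ _) (here x∈)  = Any.map (λ { ≡.refl → HasClass-π {cl} x∈ }) cl∈
  HasClassIn-π          (_ ∷ all) (there x∈) = HasClassIn-π all x∈

  π-L0 : All (λ cl → timesπ cl ∈ L1) L0
  π-L0 = from-yes (All.all? (λ cl → timesπ cl ∈? L1) L0)

  π-L1 : All (λ cl → timesπ cl ∈ L2) L1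
  π-L1 = from-yes (All.all? (λ cl → timesπ cl ∈? L2) L1)

  π-L2 : All (λ cl → timesπ cl ∈ L3) L2
  π-L2 = from-yes (All.all? (λ cl → timesπ cl ∈? L3) L2)

  All-π : ∀ {cls cls′ bs} → All (λ cl → timesπ cl ∈ cls′) cls → All (HasClassIn cls) bs →
      All (HasClassIn cls′) (map (π *_) bs)
  All-π cls∈ bs∈ = All.map⁺ (All.map (HasClassIn-π cls∈) bs∈)

  record OddLevels (l₀ l₁ l₂ l₃ : List Carrier) : Set where
    constructor oddLevels
    field
      odd₀ : All Odd l₀
      odd₁ : All Odd l₁
      odd₂ : All Odd l₂
      odd₃ : All Odd l₃

  rotate : ∀ {l₀ l₁ l₂ l₃} → OddLevels l₀ l₁ l₂ l₃ → OddLevels l₁ l₂ l₃ l₀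
  rotate (oddLevels a b d e) = oddLevels b d e a

  module _ {l₀ l₁ l₂ l₃} (odd : OddLevels l₀ l₁ l₂ l₃) where
    open OddLevels odd

    covered⇒HasZero : T (covered (length l₀) (length l₁) (length l₂) (length l₃)) →
        HasZero (Levels l₀ l₁ l₂ l₃)
    covered⇒HasZero t = ≡.subst HasZero (Levels≡ l₀ l₁ l₂ l₃)
        (Solved⇒HasZero (solved {Any.lookup chosen} (All.lookupAny found chosen)))
      where
      chosen = Any.any⁻ (covers (length l₀) (length l₁) (length l₂) (length l₃)) configurations t
      found = All.all⁺ (λ (k₀ , k₁ , k₂ , k₃) → search δ k₀ k₁ k₂ k₃) configurations searched
      m = map (π *_)
      long : ∀ {k} (l : List Carrier) → T (k ℕ.≤ᵇ length l) → k ℕ.≤ length (m l)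
      long l t = ≡.subst (_ ℕ.≤_) (≡.sym (length-map (π *_) l)) (ℕ.≤ᵇ⇒≤ _ _ t)
      longer : ∀ {k} (l : List Carrier) → k ℕ.≤ length l → k ℕ.≤ length (m l)
      longer l = ≡.subst (_ ℕ.≤_) (≡.sym (length-map (π *_) l))
      solved : ∀ {k} → T (search δ (proj₁ k) (proj₁ (proj₂ k)) (proj₁ (proj₂ (proj₂ k)))
          (proj₂ (proj₂ (proj₂ k)))) ×
               T (covers (length l₀) (length l₁) (length l₂) (length l₃) k) →
                   Solved (l₀ ++ m l₁ ++ m (m l₂) ++ m (m (m l₃)))
      solved {k₀ , k₁ , k₂ , k₃} (s , c) =
        let c₀ , c′ = Equivalence.to (T-∧ {k₀ ℕ.≤ᵇ length l₀}) c
            c₁ , c″ = Equivalence.to (T-∧ {k₁ ℕ.≤ᵇ length l₁}) c′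
            c₂ , c₃ = Equivalence.to (T-∧ {k₂ ℕ.≤ᵇ length l₂}) c″
        in search-sound digits {k₀} {k₁} {k₂} {k₃} s
             (ℕ.≤ᵇ⇒≤ k₀ (length l₀) c₀) odd₀
             (long l₁ c₁) (All-π π-L0 odd₁)
             (longer (m l₂) (long l₂ c₂)) (All-π π-L1 (All-π π-L0 odd₂))
             (longer (m (m l₃)) (longer (m l₃) (long l₃ c₃))) (All-π π-L2 (All-π π-L1 (All-π π-L0 odd₃)))

  HasZero-Levels : ∀ {l₀ l₁ l₂ l₃} → OddLevels l₀ l₁ l₂ l₃ →
    length l₀ ℕ.+ (length l₁ ℕ.+ (length l₂ ℕ.+ length l₃)) ≡ 11 → HasZero (Levels l₀ l₁ l₂ l₃)
  HasZero-Levels {l₀} {l₁} {l₂} {l₃} odd eq =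
    T-∨ (covered n₀ n₁ n₂ n₃) _ (covered⇒HasZero odd) (
    T-∨ (covered n₁ n₂ n₃ n₀) _ (HasZero-rotate l₀ l₁ l₂ l₃ ∘ covered⇒HasZero (rotate odd)) (
    T-∨ (covered n₂ n₃ n₀ n₁) _ (HasZero-rotate l₀ l₁ l₂ l₃ ∘ HasZero-rotate l₁ l₂ l₃ l₀ ∘
        covered⇒HasZero (rotate (rotate odd)))
    (HasZero-rotate l₀ l₁ l₂ l₃ ∘ HasZero-rotate l₁ l₂ l₃ l₀ ∘ HasZero-rotate l₂ l₃ l₀ l₁ ∘
        covered⇒HasZero (rotate (rotate (rotate odd))))))
    (coverage n₀ n₁ n₂ n₃ eq)
    where
    n₀ = length l₀
    n₁ = length l₁
    n₂ = length l₂
    n₃ = length l₃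

  coef : ℕ → Carrier → Carrier
  coef zero    u = u
  coef (suc k) u = π * coef k u

  ≈⇒≼ : ∀ {b c} → b ≈ c → b ≼ c
  ≈⇒≼ {b} {c} e = HasZero-*⁴ {1#} (λ {x} → trans (sym (*-identityˡ x)))
      (trans e (solve 1 (λ c → c := c :* con 1 :^ 4) refl c))

  reduceLevel : ∀ k {b u} → b ≈ coef k u → ∃[ l ] l ℕ.< 4 × b ≼ coef l u
  reduceLevel 0 e = 0 , ℕ.s≤s ℕ.z≤n , ≈⇒≼ e
  reduceLevel 1 e = 1 , ℕ.s≤s (ℕ.s≤s ℕ.z≤n) , ≈⇒≼ e
  reduceLevel 2 e = 2 , ℕ.s≤s (ℕ.s≤s (ℕ.s≤s ℕ.z≤n)) , ≈⇒≼ e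
  reduceLevel 3 e = 3 , ℕ.s≤s (ℕ.s≤s (ℕ.s≤s (ℕ.s≤s ℕ.z≤n))) , ≈⇒≼ e
  reduceLevel (suc (suc (suc (suc k)))) {b} {u} e =
    let l , l<4 , c≼ = reduceLevel k {coef k u} refl
    in l , l<4 , λ h → HasZero-*⁴ {π} π-cancel (trans e
         (solve 2 (λ π c → π :* (π :* (π :* (π :* c))) := c :* π :^ 4) refl π (coef k u))) (c≼ h)

  record Bucketed (bs : List Carrier) : Set where
    constructor bucketed
    field
      {cs l₀ l₁ l₂ l₃} : List Carrier
      dominated : Pointwise _≼_ bs cs
      arranged  : cs ↭ Levels l₀ l₁ l₂ l₃
      odd       : OddLevels l₀ l₁ l₂ l₃
      counted   : length l₀ ℕ.+ (length l₁ ℕ.+ (length l₂ ℕ.+ length l₃)) ≡ length bs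

  insert : ∀ {b u bs} l → l ℕ.< 4 → b ≼ coef l u → Odd u → Bucketed bs → Bucketed (b ∷ bs)
  insert {u = u} 0 _ b≼ o (bucketed {l₀ = l₀} d a (oddLevels o₀ o₁ o₂ o₃) n) =
    bucketed {l₀ = u ∷ l₀} (b≼ ∷ d) (Perm.prep u a) (oddLevels (o ∷ o₀) o₁ o₂ o₃) (≡.cong suc n)
  insert {u = u} 1 _ b≼ o (bucketed {l₀ = l₀} {l₁} d a (oddLevels o₀ o₁ o₂ o₃) n) =
    bucketed {l₁ = u ∷ l₁} (b≼ ∷ d)
      (Perm.trans (Perm.prep _ a) (↭-sym (++-map-↭ l₀ Perm.refl))) (oddLevels o₀ (o ∷ o₁) o₂ o₃)
      (≡.trans (ℕ.+-suc (length l₀) _) (≡.cong suc n))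
  insert {u = u} 2 _ b≼ o (bucketed {l₀ = l₀} {l₁} {l₂} d a (oddLevels o₀ o₁ o₂ o₃) n) =
    bucketed {l₂ = u ∷ l₂} (b≼ ∷ d)
      (Perm.trans (Perm.prep _ a) (↭-sym (++-map-↭ l₀ (++-map-↭ l₁ Perm.refl))))
          (oddLevels o₀ o₁ (o ∷ o₂) o₃)
      (≡.trans (≡.cong (length l₀ ℕ.+_) (ℕ.+-suc (length l₁) _))
          (≡.trans (ℕ.+-suc (length l₀) _) (≡.cong suc n)))
  insert {u = u} 3 _ b≼ o (bucketed {l₀ = l₀} {l₁} {l₂} {l₃} d a (oddLevels o₀ o₁ o₂ o₃) n) =
    bucketed {l₃ = u ∷ l₃} (b≼ ∷ d)
      (Perm.trans (Perm.prep _ a) (↭-sym (++-map-↭ l₀ (++-map-↭ l₁ (++-map-↭ l₂ Perm.refl)))))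
          (oddLevels o₀ o₁ o₂ (o ∷ o₃))
      (≡.trans (≡.cong (λ k → length l₀ ℕ.+ (length l₁ ℕ.+ k)) (ℕ.+-suc (length l₂) _))
        (≡.trans (≡.cong (length l₀ ℕ.+_) (ℕ.+-suc (length l₁) _))
            (≡.trans (ℕ.+-suc (length l₀) _) (≡.cong suc n))))
  insert (suc (suc (suc (suc _)))) (ℕ.s≤s (ℕ.s≤s (ℕ.s≤s (ℕ.s≤s ())))) _ _ _

  -- Stopping after n quotients makes the search for the valuation constructive.
  peel : ∀ n b → (∃[ k ] ∃[ u ] Odd u × b ≈ coef k u) ⊎ Div n b
  peel zero    b = inj₂ _
  peel (suc n) b = [ even , (λ o → inj₁ (0 , b , o , refl)) ]′ (parity b)
    where
    even : ∃[ y ] b ≈ π * y → _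
    even (y , e) = [ (λ (k , u , o , e′) → inj₁ (suc k , u , o , trans e (*-congˡ e′))) ,
        (λ d → inj₂ (y , e , d)) ]′ (peel n y)

  module _ (em : ExcludedMiddle 0ℓ) where

    -- No finite number of quotients decides whether `b` is zero. This is the one place where the
    -- excluded middle is applied; without a valuation every `peel` ends in divisibility, and
    -- separatedness gives zero.
    valuation : ∀ b → b ≈ 0# ⊎ ∃[ k ] ∃[ u ] Odd u × b ≈ coef k u
    valuation b with em {∃[ k ] ∃[ u ] Odd u × b ≈ coef k u}
    ... | yes v = inj₂ v
    ... | no ¬v = inj₁ (Div-separated λ n → [ (λ v → contradiction v ¬v) ,
        (λ d → d) ]′ (peel (twice n) b))

    bucket : ∀ bs → HasZero bs ⊎ Bucketed bs
    bucket []       = inj₂ (bucketed [] Perm.refl (oddLevels [] [] [] []) ≡.refl)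
    bucket (b ∷ bs) = [ (λ b≈0 → inj₁ (HasZero-∷-0 1≉0 b≈0)) ,
        (λ (k , u , o , e) → let l , l<4 , b≼ = reduceLevel k e in
          [ (λ h → inj₁ (Represents-++ˡ ≈0-resp (b ∷ []) h)) ,
              (λ β → inj₂ (insert l l<4 b≼ o β)) ]′ (bucket bs)) ]′ (valuation b)
      where
      1≉0 : ¬ 1# ≈ 0#
      1≉0 e = π-nonunit 0# (trans e (sym (zeroʳ π)))

    HasZero-11 : ∀ bs → length bs ≡ 11 → HasZero bs
    HasZero-11 bs len = [ (λ h → h) , finish ]′ (bucket bs)
      where
      finish : Bucketed bs → HasZero bs
      finish (bucketed {cs} d a o n) = ≡.subst HasZero (++-identityʳ bs)
        (HasZero-≼ [] d (≡.subst HasZero (≡.sym (++-identityʳ cs))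
          (Represents-resp-↭ ≈0-resp (↭-sym a) (HasZero-Levels o (≡.trans n len)))))

-- The lower bound: sums of fourth powers modulo 16

-- The pair a , b stands for a + b π modulo 16, where π² ≡ d.
module Mod16 (d : ℕ) where

  add mul : ℕ × ℕ → ℕ × ℕ → ℕ × ℕ
  add (a , b) (a′ , b′) = (a ℕ.+ a′) ℕ.% 16 , (b ℕ.+ b′) ℕ.% 16
  mul (a , b) (a′ , b′) = (a ℕ.* a′ ℕ.+ d ℕ.* (b ℕ.* b′)) ℕ.% 16 , (a ℕ.* b′ ℕ.+ b ℕ.* a′) ℕ.% 16

  pow⁴ : ℕ × ℕ → ℕ × ℕ
  pow⁴ r = mul r (mul r (mul r r))

  Value : Set
  Value = (ℕ × ℕ) × Bool

  isOdd : ℕ → Bool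
  isOdd p = p ℕ.% 2 ℕ.≡ᵇ 1

  -- Keeps each list of sums within the 16 · 16 · 2 possible values, so that its length does not
  -- grow exponentially with the number of terms.
  dedup : List Value → List Value
  dedup = deduplicate (≡-dec (≡-dec ℕ._≟_ ℕ._≟_) Bool._≟_)

  ∈-dedup : ∀ {v vs} → v ∈ vs → v ∈ dedup vs
  ∈-dedup = ∈-deduplicate⁺ (≡-dec (≡-dec ℕ._≟_ ℕ._≟_) Bool._≟_)

  fourth : ℕ × ℕ → Value
  fourth (p , q) = pow⁴ (p , q) , isOdd p

  residues : List (ℕ × ℕ)
  residues = cartesianProduct (upTo 4) (upTo 4)

  fourths : List Value
  fourths = dedup (map fourth residues)

  fourth∈fourths : ∀ p q → p ℕ.< 4 → q ℕ.< 4 → fourth (p , q) ∈ fourths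
  fourth∈fourths p q p<4 q<4 = ∈-dedup {fourth (p , q)} {map fourth residues}
      (∈-map⁺ fourth {xs = residues} (∈-cartesianProduct⁺ (∈-upTo⁺ p<4) (∈-upTo⁺ q<4)))

  plus : ℕ × ℕ → Value → Value → Value
  plus g (x , f) (s , f′) = add (mul g x) s , f ∨ f′

  -- The flag records whether an odd argument has been used.
  sums : ℕ × ℕ → ℕ → List Value
  sums g zero    = ((0 , 0) , false) ∷ []
  sums g (suc n) = dedup (cartesianProductWith (plus g) fourths (sums g n))

  ∈-sums : ∀ g n {v w} → v ∈ fourths → w ∈ sums g n → plus g v w ∈ sums g (suc n)
  ∈-sums g n {v} {w} v∈ w∈ = ∈-dedup {plus g v w} {cartesianProductWith (plus g) fourths (sums g n)}
      (∈-cartesianProductWith⁺ (plus g) v∈ w∈)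

  isZero : ℕ × ℕ → Bool
  isZero (a , b) = (a ℕ.≡ᵇ 0) ∧ (b ℕ.≡ᵇ 0)

  admissible : Value → Value → Bool
  admissible (s , f) (s′ , f′) = not (isZero (add s s′) ∧ (f ∨ f′))

  admissible-zero : ∀ r f → T (not (isZero r ∧ f)) → r ≡ (0 , 0) → f ≡ false
  admissible-zero r false _ _ = ≡.refl
  admissible-zero r true  t ≡.refl = contradiction t λ ()

  -- The two blocks of equal coefficients are summed separately and meet only in the final
  -- comparison of pairs.
  noPrimitiveZero : ℕ × ℕ → ℕ → ℕ × ℕ → ℕ → Bool
  noPrimitiveZero g n g′ n′ = all (λ v → all (admissible v) (sums g′ n′)) (sums g n)

-- Soundness of the check modulo 16 and infinite descent

module Descent {c ℓ} (R : CommutativeRing c ℓ) (ramification : Ramification R)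
    (integers : RamifiedIntegers R ramification) where
  open CommutativeRing R
  open Mult semiring using (×-homo-+; ×1-homo-*; ×-congˡ)
  open Ramification ramification using (π; ν)
  open Congruences R ramification
  open RamifiedIntegers integers using (digits; π-cancel; adic; d; e; faithful) renaming
      (π²≈d+16e to π²≈d)
  open AdicallyComplete adic using (Div-separated)
  open Divisibility R π
  open Mod16 d
  open Quartic R
  open import Algebra.Properties.Semiring.Exp semiring using (_^_; ^-congˡ)
  open import Algebra.Solver.Ring.NaturalCoefficients.Default commutativeSemiring using (solve; con; _:+_; _:*_; _:^_; _:=_)
  open import Relation.Binary.Reasoning.Setoid setoid

  16* : Carrier → Carrier
  16* y = 2# * (2# * (2# * (2# * y)))

  record _⊨_ (x : Carrier) (r : ℕ × ℕ) : Set (c ⊔ ℓ) where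
    constructor mod16
    field
      {quotient} : Carrier
      equality   : x ≈ residue₄ (proj₁ r) (proj₂ r) + 16* quotient

  ⊨-resp : ∀ {x y r} → x ≈ y → y ⊨ r → x ⊨ r
  ⊨-resp x≈y (mod16 e) = mod16 (trans x≈y e)

  residue-% : ∀ {x} a b → x ⊨ (a , b) → x ⊨ (a ℕ.% 16 , b ℕ.% 16)
  residue-% {x} a b (mod16 {y} e) = mod16 {quotient = y + ⟦ a ℕ./ 16 ⟧ + ⟦ b ℕ./ 16 ⟧ * π} (begin
    x
      ≈⟨ e ⟩
    ⟦ a ⟧ + ⟦ b ⟧ * π + 16* y
      ≈⟨ +-congʳ (+-cong (⟦⟧-% a 16) (*-congʳ (⟦⟧-% b 16))) ⟩
    (⟦ a ℕ.% 16 ⟧ + ⟦ a ℕ./ 16 ⟧ * ⟦ 16 ⟧) + (⟦ b ℕ.% 16 ⟧ + ⟦ b ℕ./ 16 ⟧ * ⟦ 16 ⟧) * π + 16* y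
      ≈⟨ +-congʳ (+-cong (+-congˡ (*-congˡ 16≈)) (*-congʳ (+-congˡ (*-congˡ 16≈)))) ⟩
    (⟦ a ℕ.% 16 ⟧ + ⟦ a ℕ./ 16 ⟧ * 16* 1#) + (⟦ b ℕ.% 16 ⟧ + ⟦ b ℕ./ 16 ⟧ * 16* 1#) * π + 16* y
      ≈⟨ solve 6 (λ a k b l π y → let s = λ z → con 2 :* (con 2 :* (con 2 :* (con 2 :* z))) in
           (a :+ k :* s (con 1)) :+ (b :+ l :* s (con 1)) :* π :+ s y :=
               a :+ b :* π :+ s (y :+ k :+ l :* π))
           refl ⟦ a ℕ.% 16 ⟧ ⟦ a ℕ./ 16 ⟧ ⟦ b ℕ.% 16 ⟧ ⟦ b ℕ./ 16 ⟧ π y ⟩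
    ⟦ a ℕ.% 16 ⟧ + ⟦ b ℕ.% 16 ⟧ * π + 16* (y + ⟦ a ℕ./ 16 ⟧ + ⟦ b ℕ./ 16 ⟧ * π) ∎)
    where
    16≈ : ⟦ 16 ⟧ ≈ 16* 1#
    16≈ = trans (×1-homo-* 4 4) (solve 0 (let f = con 1 :+ (con 1 :+ (con 1 :+ (con 1 :+ con 0))) in
      f :* f := con 2 :* (con 2 :* (con 2 :* (con 2 :* con 1)))) refl)

  ⊨-+ : ∀ {x y r s} → x ⊨ r → y ⊨ s → (x + y) ⊨ add r s
  ⊨-+ {x} {y} {a , b} {a′ , b′} (mod16 {k} e) (mod16 {l} e′) = residue-% (a ℕ.+ a′) (b ℕ.+ b′)
      (mod16 {quotient = k + l} (begin
    x + y
      ≈⟨ +-cong e e′ ⟩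
    (⟦ a ⟧ + ⟦ b ⟧ * π + 16* k) + (⟦ a′ ⟧ + ⟦ b′ ⟧ * π + 16* l)
      ≈⟨ solve 7 (λ a b a′ b′ π k l → let s = λ z → con 2 :* (con 2 :* (con 2 :* (con 2 :* z))) in
           (a :+ b :* π :+ s k) :+ (a′ :+ b′ :* π :+ s l) :=
               (a :+ a′) :+ (b :+ b′) :* π :+ s (k :+ l)) refl ⟦ a ⟧ ⟦ b ⟧ ⟦ a′ ⟧ ⟦ b′ ⟧ π k l ⟩
    (⟦ a ⟧ + ⟦ a′ ⟧) + (⟦ b ⟧ + ⟦ b′ ⟧) * π + 16* (k + l)
      ≈⟨ +-congʳ (+-cong (×-homo-+ 1# a a′) (*-congʳ (×-homo-+ 1# b b′))) ⟨
    ⟦ a ℕ.+ a′ ⟧ + ⟦ b ℕ.+ b′ ⟧ * π + 16* (k + l) ∎))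

  ⊨-* : ∀ {x y r s} → x ⊨ r → y ⊨ s → (x * y) ⊨ mul r s
  ⊨-* {x} {y} {a , b} {a′ , b′} (mod16 {k} h) (mod16 {l} h′) =
    residue-% (a ℕ.* a′ ℕ.+ d ℕ.* (b ℕ.* b′)) (a ℕ.* b′ ℕ.+ b ℕ.* a′)
      (mod16 {quotient = e * (⟦ b ⟧ * ⟦ b′ ⟧) +
          (k * (⟦ a′ ⟧ + ⟦ b′ ⟧ * π + 16* l) + (⟦ a ⟧ + ⟦ b ⟧ * π) * l)} (begin
    x * y
      ≈⟨ *-cong h h′ ⟩
    (⟦ a ⟧ + ⟦ b ⟧ * π + 16* k) * (⟦ a′ ⟧ + ⟦ b′ ⟧ * π + 16* l)
      ≈⟨ solve 7 (λ a b a′ b′ π k l → let s = λ z → con 2 :* (con 2 :* (con 2 :* (con 2 :* z))) in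
           (a :+ b :* π :+ s k) :* (a′ :+ b′ :* π :+ s l)
           := (a :* a′ :+ (π :* π) :* (b :* b′)) :+ (a :* b′ :+ b :* a′) :* π :+ s
               (k :* (a′ :+ b′ :* π :+ s l) :+ (a :+ b :* π) :* l))
           refl ⟦ a ⟧ ⟦ b ⟧ ⟦ a′ ⟧ ⟦ b′ ⟧ π k l ⟩
    (⟦ a ⟧ * ⟦ a′ ⟧ + (π * π) * (⟦ b ⟧ * ⟦ b′ ⟧)) + (⟦ a ⟧ * ⟦ b′ ⟧ + ⟦ b ⟧ * ⟦ a′ ⟧) * π + 16* rest
      ≈⟨ +-congʳ (+-congʳ (+-congˡ (*-congʳ π²≈d))) ⟩
    (⟦ a ⟧ * ⟦ a′ ⟧ + (⟦ d ⟧ + 16* e) * (⟦ b ⟧ * ⟦ b′ ⟧)) +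
        (⟦ a ⟧ * ⟦ b′ ⟧ + ⟦ b ⟧ * ⟦ a′ ⟧) * π + 16* rest
      ≈⟨ solve 6 (λ u d e v t r → let s = λ z → con 2 :* (con 2 :* (con 2 :* (con 2 :* z))) in
           (u :+ (d :+ s e) :* v) :+ t :+ s r := (u :+ d :* v) :+ t :+ s (e :* v :+ r)) refl
               (⟦ a ⟧ * ⟦ a′ ⟧) ⟦ d ⟧ e (⟦ b ⟧ * ⟦ b′ ⟧) ((⟦ a ⟧ * ⟦ b′ ⟧ + ⟦ b ⟧ * ⟦ a′ ⟧) * π) rest ⟩
    (⟦ a ⟧ * ⟦ a′ ⟧ + ⟦ d ⟧ * (⟦ b ⟧ * ⟦ b′ ⟧)) + (⟦ a ⟧ * ⟦ b′ ⟧ + ⟦ b ⟧ * ⟦ a′ ⟧) * π + 16*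
        (e * (⟦ b ⟧ * ⟦ b′ ⟧) + rest)
      ≈⟨ +-congʳ (+-cong re (*-congʳ im)) ⟩
    _ ∎))
    where
    rest = k * (⟦ a′ ⟧ + ⟦ b′ ⟧ * π + 16* l) + (⟦ a ⟧ + ⟦ b ⟧ * π) * l
    re : ⟦ a ⟧ * ⟦ a′ ⟧ + ⟦ d ⟧ * (⟦ b ⟧ * ⟦ b′ ⟧) ≈ ⟦ a ℕ.* a′ ℕ.+ d ℕ.* (b ℕ.* b′) ⟧
    re = sym (trans (×-homo-+ 1# (a ℕ.* a′) _)
        (+-cong (×1-homo-* a a′) (trans (×1-homo-* d _) (*-congˡ (×1-homo-* b b′)))))
    im : ⟦ a ⟧ * ⟦ b′ ⟧ + ⟦ b ⟧ * ⟦ a′ ⟧ ≈ ⟦ a ℕ.* b′ ℕ.+ b ℕ.* a′ ⟧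
    im = sym (trans (×-homo-+ 1# (a ℕ.* b′) _) (+-cong (×1-homo-* a b′) (×1-homo-* b a′)))

  ⊨-refl : ∀ a b → residue₄ a b ⊨ (a , b)
  ⊨-refl a b = mod16 {quotient = 0#}
      (solve 1 (λ r → r := r :+ con 2 :* (con 2 :* (con 2 :* (con 2 :* con 0)))) refl (residue₄ a b))

  -- In (r + 4w)⁴ every term after r⁴ is a multiple of 16, so sixteen arguments give all fourth
  -- powers modulo 16.
  ≡₄⇒⁴⊨ : ∀ {x} p q → x ≡₄ residue₄ p q → (x ^ 4) ⊨ pow⁴ (p , q)
  ≡₄⇒⁴⊨ {x} p q (mod4 {w} x≈) = raise (⊨-* r⊨ (⊨-* r⊨ (⊨-* r⊨ r⊨)))
    where
    r = residue₄ p q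
    r⊨ = ⊨-refl p q
    raise : (r * (r * (r * r))) ⊨ pow⁴ (p , q) → (x ^ 4) ⊨ pow⁴ (p , q)
    raise (mod16 {k} h) = mod16 {quotient = k +
        (r * r * r * w + (2# + 2# + 2#) * (r * r * (w * w)) + (2# * 2# * (2# * 2#)) *
        (r * (w * (w * w)) + w * (w * (w * w))))} (begin
      x ^ 4  ≈⟨ ^-congˡ 4 x≈ ⟩
      (r + 2# * (2# * w)) ^ 4
        ≈⟨ solve 2 (λ r w → (r :+ con 2 :* (con 2 :* w)) :^ 4 := r :* (r :* (r :* r)) :+ con 2 :*
            (con 2 :* (con 2 :* (con 2 :*
             (r :* r :* r :* w :+ (con 2 :+ con 2 :+ con 2) :* (r :* r :* (w :* w)) :+
                 (con 2 :* con 2 :* (con 2 :* con 2)) :*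
                 (r :* (w :* (w :* w)) :+ w :* (w :* (w :* w)))))))) refl r w ⟩
      r * (r * (r * r)) + 16* rest
        ≈⟨ +-congʳ h ⟩
      residue₄ (proj₁ (pow⁴ (p , q))) (proj₂ (pow⁴ (p , q))) + 16* k + 16* rest
        ≈⟨ solve 3 (λ a k l → let s = λ z → con 2 :* (con 2 :* (con 2 :* (con 2 :* z))) in a :+ s k :+ s l := a :+ s (k :+ l)) refl _ k rest ⟩
      _ ∎)
      where
      rest = r * r * r * w + (2# + 2# + 2#) * (r * r * (w * w)) + (2# * 2# * (2# * 2#)) *
          (r * (w * (w * w)) + w * (w * (w * w)))

  Even : Carrier → Set (c ⊔ ℓ)
  Even x = ∃[ y ] x ≈ π * y

  even-class : ∀ p q {x} → p ℕ.% 2 ≡ 0 → x ≡₄ residue₄ p q → Even x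
  even-class p q {x} even (mod4 {w} h) = ⟦ q ⟧ + π * ν * (⟦ p ℕ./ 2 ⟧ + 2# * w) , (begin
    x
      ≈⟨ h ⟩
    ⟦ p ⟧ + ⟦ q ⟧ * π + 2# * (2# * w)
      ≈⟨ +-congʳ (+-congʳ (trans (⟦⟧-% p 2) (+-congʳ (×-congˡ even)))) ⟩
    0# + ⟦ p ℕ./ 2 ⟧ * ⟦ 2 ⟧ + ⟦ q ⟧ * π + 2# * (2# * w)
      ≈⟨ solve 4 (λ h q π w → con 0 :+ h :* (con 1 :+ (con 1 :+ con 0)) :+ q :* π :+ con 2 :* (con 2 :* w)
           := q :* π :+ con 2 :* (h :+ con 2 :* w)) refl ⟦ p ℕ./ 2 ⟧ ⟦ q ⟧ π w ⟩
    ⟦ q ⟧ * π + 2# * (⟦ p ℕ./ 2 ⟧ + 2# * w)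
      ≈⟨ +-congˡ (*-congʳ 2≈ππν) ⟩
    ⟦ q ⟧ * π + π * (π * ν) * (⟦ p ℕ./ 2 ⟧ + 2# * w)
      ≈⟨ solve 4 (λ q π ν s → q :* π :+ π :* (π :* ν) :* s := π :* (q :+ π :* ν :* s)) refl ⟦ q ⟧ π ν
          (⟦ p ℕ./ 2 ⟧ + 2# * w) ⟩
    π * (⟦ q ⟧ + π * ν * (⟦ p ℕ./ 2 ⟧ + 2# * w))      ∎)

  EvenArguments : List (Carrier × Carrier) → Set (c ⊔ ℓ)
  EvenArguments = All (λ (_ , x) → Even x)

  fourth-value : ∀ x → ∃[ r ] ∃[ f ] (r , f) ∈ fourths × (x ^ 4) ⊨ r × (f ≡ false → Even x)
  fourth-value x =
    let p , q , x∈ = digits x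
        x∈′ = reduce p q x∈
    in pow⁴ (p ℕ.% 4 , q ℕ.% 4) , isOdd (p ℕ.% 4) ,
       fourth∈fourths (p ℕ.% 4) (q ℕ.% 4) (ℕ.m%n<n p 4) (ℕ.m%n<n q 4) ,
       ≡₄⇒⁴⊨ (p ℕ.% 4) (q ℕ.% 4) x∈′ ,
       λ f → even-class (p ℕ.% 4) (q ℕ.% 4) (not-odd (p ℕ.% 4) f) x∈′
    where
    reduce : ∀ p q → x ≡₄ residue₄ p q → x ≡₄ residue₄ (p ℕ.% 4) (q ℕ.% 4)
    reduce p q x∈ = ≡.subst₂ (λ a b → x ≡₄ residue₄ (a ℕ.% 4) (b ℕ.% 4)) (ℕ.+-identityʳ p)
        (ℕ.+-identityʳ q)
      (+0 (residue₄-+ p q 0 0 x∈ (mod4 {quotient = 0#}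
          (solve 1 (λ π → con 0 := con 0 :+ con 0 :* π :+ con 2 :* (con 2 :* con 0)) refl π))))
      where
      +0 : ∀ {x y} → x + 0# ≡₄ y → x ≡₄ y
      +0 (mod4 e) = mod4 (trans (sym (+-identityʳ _)) e)
    not-odd : ∀ p → isOdd p ≡ false → p ℕ.% 2 ≡ 0
    not-odd p f with p ℕ.% 2 | ℕ.m%n<n p 2
    ... | 0           | _                = ≡.refl
    ... | suc (suc _) | ℕ.s≤s (ℕ.s≤s ())

  Summed : ℕ × ℕ → ℕ → List (Carrier × Carrier) → Set (c ⊔ ℓ)
  Summed g n ps = ∃[ s ] ∃[ f ] (s , f) ∈ sums g n × form ps ⊨ s × (f ≡ false → EvenArguments ps)

  Summed-∷ : ∀ {b x ps g} n → b ⊨ g → Summed g n ps → Summed g (suc n) ((b , x) ∷ ps)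
  Summed-∷ {b} {x} {ps} {g} n b⊨ (s , f′ , s∈ , ps⊨ , evens) = combine (fourth-value x)
    where
    combine : (∃[ r ] ∃[ f ] (r , f) ∈ fourths × (x ^ 4) ⊨ r × (f ≡ false → Even x)) →
        Summed g (suc n) ((b , x) ∷ ps)
    combine (r , f , r∈ , x⊨ , even) =
      add (mul g r) s , f ∨ f′ , ∈-sums g n r∈ s∈ , ⊨-+ (⊨-* b⊨ x⊨) ps⊨ ,
      λ ff → even (Bool.∨-conicalˡ f f′ ff) ∷ evens (Bool.∨-conicalʳ f f′ ff)

  sums-sound : ∀ {γ g} → γ ⊨ g → ∀ n ps → map proj₁ ps ≡ replicate n γ → Summed g n ps
  sums-sound {γ} {g} γ⊨ zero    []             _  = (0 , 0) , false , here ≡.refl ,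
      ⊨-resp (solve 1 (λ π → con 0 := con 0 :+ con 0 :* π) refl π) (⊨-refl 0 0) , λ _ → []
  sums-sound {γ} {g} γ⊨ (suc n) ((b , x) ∷ ps) eq =
    Summed-∷ n (≡.subst (_⊨ g) (≡.sym (∷-injectiveˡ eq)) γ⊨) (sums-sound γ⊨ n ps (∷-injectiveʳ eq))

  -- All arguments are divided by π. The last component carries divisibility of the quotients back
  -- to the original arguments, one power higher.
  scaled-values : ∀ {ps} → EvenArguments ps →
      ∃[ qs ] map proj₁ qs ≡ map proj₁ ps × form ps ≈ π ^ 4 * form qs ×
    (∀ n → All (λ (_ , x) → Div n x) qs → All (λ (_ , x) → Div (suc n) x) ps)
  scaled-values []                                     = [] , ≡.refl , sym (zeroʳ _) , λ _ _ → []
  scaled-values {(b , x) ∷ ps} ((y , x≈πy) ∷ evens) = extend-by (scaled-values evens)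
    where
    extend-by : (∃[ qs ] map proj₁ qs ≡ map proj₁ ps × form ps ≈ π ^ 4 * form qs ×
        (∀ n → All (λ (_ , x) → Div n x) qs → All (λ (_ , x) → Div (suc n) x) ps)) →
      ∃[ qs ] map proj₁ qs ≡ b ∷ map proj₁ ps × form ((b , x) ∷ ps) ≈ π ^ 4 * form qs ×
        (∀ n → All (λ (_ , x) → Div n x) qs → All (λ (_ , x) → Div (suc n) x) ((b , x) ∷ ps))
    extend-by (qs , eq , e , divs) = (b , y) ∷ qs , ≡.cong (b ∷_) eq ,
      trans (+-cong (*-congˡ (^-congˡ 4 x≈πy)) e)
        (solve 4 (λ b π y f → b :* (π :* y) :^ 4 :+ π :^ 4 :* f := π :^ 4 :* (b :* y :^ 4 :+ f)) refl b π
            y (form qs)) ,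
      λ { n (d ∷ ds) → (y , x≈πy , d) ∷ divs n ds }

  π⁴-cancel : ∀ {x} → π ^ 4 * x ≈ 0# → x ≈ 0#
  π⁴-cancel {x} e = π-cancel (π-cancel (π-cancel (π-cancel
    (trans (solve 2 (λ π x → π :* (π :* (π :* (π :* x))) := π :^ 4 :* x) refl π x) e))))

  -- The descent runs as an induction on n showing that πⁿ divides every argument of every zero:
  -- dividing by π yields another zero of the same form. Separatedness then makes the arguments
  -- vanish.
  descent : ∀ {bs} → (∀ ps → map proj₁ ps ≡ bs → form ps ≈ 0# → EvenArguments ps) → Anisotropic bs
  descent {bs} even ps eq z = All.tabulate λ p∈ → Div-separated λ n →
      All.lookup (divisible (twice n) ps eq z) p∈
    where
    divisible : ∀ n ps → map proj₁ ps ≡ bs → form ps ≈ 0# → All (λ (_ , x) → Div n x) ps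
    divisible zero    ps _  _ = All.universal _ ps
    divisible (suc n) ps eq z =
      let qs , eq′ , e , divs = scaled-values (even ps eq z)
      in divs n (divisible n qs (≡.trans eq′ eq) (π⁴-cancel (trans (sym e) z)))

  module _ {γ γ′ g g′} (γ⊨ : γ ⊨ g) (γ′⊨ : γ′ ⊨ g′) (n n′ : ℕ)
      (checked : T (noPrimitiveZero g n g′ n′)) where

    even-zero : ∀ ps qs → map proj₁ ps ≡ replicate n γ → map proj₁ qs ≡ replicate n′ γ′ →
        form (ps ++ qs) ≈ 0# → EvenArguments (ps ++ qs)
    even-zero ps qs eqp eqq z = conclude (sums-sound γ⊨ n ps eqp) (sums-sound γ′⊨ n′ qs eqq)
      where
      conclude : Summed g n ps → Summed g′ n′ qs → EvenArguments (ps ++ qs)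
      conclude (s , f , s∈ , ps⊨ , evens) (s′ , f′ , s∈′ , qs⊨ , evens′) =
        All.++⁺ (evens (Bool.∨-conicalˡ f f′ none)) (evens′ (Bool.∨-conicalʳ f f′ none))
        where
        s+s′≡0 : ∀ r → (form ps + form qs) ⊨ r → proj₁ r ℕ.% 16 ≡ 0 × proj₂ r ℕ.% 16 ≡ 0
        s+s′≡0 r (mod16 {y} e) = faithful (proj₁ r) (proj₂ r) {(- y)} (begin
          residue₄ (proj₁ r) (proj₂ r)
            ≈⟨ +-identityʳ _ ⟨
          residue₄ (proj₁ r) (proj₂ r) + 0#
            ≈⟨ +-congˡ (trans (solve 0 (con 0 := con 2 :* (con 2 :* (con 2 :* (con 2 :* con 0)))) refl)
                (*-congˡ (*-congˡ (*-congˡ (*-congˡ (sym (-‿inverseʳ y))))))) ⟩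
          residue₄ (proj₁ r) (proj₂ r) + 16* (y - y)
            ≈⟨ solve 3 (λ r y z → let s = λ z → con 2 :* (con 2 :* (con 2 :* (con 2 :* z))) in r :+ s (y :+ z) := (r :+ s y) :+ s z) refl _ y (- y) ⟩
          residue₄ (proj₁ r) (proj₂ r) + 16* y + 16* (- y)
            ≈⟨ +-congʳ (trans (sym e) (trans (sym (form-++ ps qs)) z)) ⟩
          0# + 16* (- y)
            ≈⟨ +-identityˡ _ ⟩
          16* (- y) ∎)
        reduced : add s s′ ≡ (0 , 0)
        reduced = let p , q = s+s′≡0 (add s s′) (⊨-+ ps⊨ qs⊨) in
          ≡.cong₂ _,_ (≡.trans (≡.sym (ℕ.m%n%n≡m%n (proj₁ s ℕ.+ proj₁ s′) 16)) p)
              (≡.trans (≡.sym (ℕ.m%n%n≡m%n (proj₂ s ℕ.+ proj₂ s′) 16)) q)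
        none : f ∨ f′ ≡ false
        none = admissible-zero (add s s′) (f ∨ f′)
          (All.lookup (All.all⁺ (admissible (s , f)) (sums g′ n′)
              (All.lookup (All.all⁺ (λ v → all (admissible v) (sums g′ n′)) (sums g n) checked) s∈)) s∈′)
              reduced

    anisotropic : Anisotropic (replicate n γ ++ replicate n′ γ′)
    anisotropic = descent λ ps eq z →
      let qs , rs , ps≡ , eqq , eqr = split (replicate n γ) ps eq
      in ≡.subst EvenArguments (≡.sym ps≡) (even-zero qs rs eqq eqr (≡.subst (λ ps → form ps ≈ 0#) ps≡ z))
      where
      split : ∀ bs {cs} ps → map proj₁ ps ≡ bs ++ cs →
        ∃[ qs ] ∃[ rs ] ps ≡ qs ++ rs × map proj₁ qs ≡ bs × map proj₁ rs ≡ cs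
      split []       ps       eq = [] , ps , ≡.refl , ≡.refl , eq
      split (b ∷ bs) (p ∷ ps) eq =
        let qs , rs , ps≡ , eqq , eqr = split bs ps (∷-injectiveʳ eq)
        in p ∷ qs , rs , ≡.cong (p ∷_) ps≡ , ≡.cong₂ _∷_ (∷-injectiveˡ eq) eqq , eqr

-- Passage from the ring of integers to its fractions

module Fractions {c ℓ} (A : CommutativeRing c ℓ) (t D : CommutativeRing.Carrier A)
    (t-cancelˡ : Cancellative A t) where
  open CommutativeRing A using (0#; 1#)
  private module A = CommutativeRing A
  open import Algebra.Properties.Semiring.Exp A.semiring using (_^_; ^-homo-*)
  module L = Localization A t t-cancelˡ
  open L using (_/t^_; mk≈ᶠ; embed)
  private module F = CommutativeRing L.commutativeRing
  private
    O K : CommutativeRing c ℓ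
    O = AdjoinSqrt.commutativeRing A D
    K = AdjoinSqrt.commutativeRing L.commutativeRing (embed D)
    module O = CommutativeRing O
    module K = CommutativeRing K
  open AdjoinSqrt using (_+_√; re; im; _,_; re-≈; im-≈)

  embed-cong : ∀ {a b} → a A.≈ b → embed a F.≈ embed b
  embed-cong e = mk≈ᶠ (A.*-congʳ e)

  embed-injective : ∀ {a b} → embed a F.≈ embed b → a A.≈ b
  embed-injective (mk≈ᶠ e) = A.trans (A.sym (A.*-identityʳ _)) (A.trans e (A.*-identityʳ _))

  embed-+ : ∀ a b → embed (a A.+ b) F.≈ embed a F.+ embed b
  embed-+ a b = mk≈ᶠ (A.*-congʳ (A.sym (A.+-cong (A.*-identityʳ a) (A.*-identityʳ b))))

  embed-* : ∀ a b → embed (a A.* b) F.≈ embed a F.* embed b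
  embed-* a b = mk≈ᶠ A.refl

  emb : O.Carrier → K.Carrier
  emb (a + b √) = embed a + embed b √

  emb-cong : ∀ {x y} → x O.≈ y → emb x K.≈ emb y
  emb-cong (p , q) = embed-cong p , embed-cong q

  emb-injective : ∀ {x y} → emb x K.≈ emb y → x O.≈ y
  emb-injective (p , q) = embed-injective p , embed-injective q

  emb-+ : ∀ x y → emb (x O.+ y) K.≈ emb x K.+ emb y
  emb-+ (a + b √) (a′ + b′ √) = embed-+ a a′ , embed-+ b b′

  emb-* : ∀ x y → emb (x O.* y) K.≈ emb x K.* emb y
  emb-* (a + b √) (a′ + b′ √) =
      F.trans (embed-+ _ _) (F.+-cong (embed-* a a′) (F.trans (embed-* D _) (F.*-congˡ (embed-* b b′))))
    , F.trans (embed-+ _ _) (F.+-cong (embed-* a b′) (embed-* b a′))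

  scalar : A.Carrier → O.Carrier
  scalar a = a + 0# √

  t^-cancel : ∀ n {a} → t ^ n A.* a A.≈ 0# → a A.≈ 0#
  t^-cancel zero    e = A.trans (A.sym (A.*-identityˡ _)) e
  t^-cancel (suc n) e = t^-cancel n
      (t-cancelˡ _ _ (A.trans (A.sym (A.*-assoc t (t ^ n) _)) (A.trans e (A.sym (A.zeroʳ t)))))

  module _ where
    open import Algebra.Solver.Ring.NaturalCoefficients.Default A.commutativeSemiring using (solve; con; _:+_; _:*_; _:=_)

    scalar-re : ∀ a x → re (scalar a O.* x) A.≈ a A.* re x
    scalar-re a x = solve 4 (λ D a x y → a :* x :+ D :* (con 0 :* y) := a :* x) A.refl D a (re x) (im x)

    scalar-im : ∀ a x → im (scalar a O.* x) A.≈ a A.* im x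
    scalar-im a x = solve 3 (λ a x y → a :* y :+ con 0 :* x := a :* y) A.refl a (re x) (im x)

  scalar-cancel : ∀ n {x} → scalar (t ^ n) O.* x O.≈ O.0# → x O.≈ O.0#
  scalar-cancel n {x} (p , q) =
      t^-cancel n (A.trans (A.sym (scalar-re (t ^ n) x)) p)
    , t^-cancel n (A.trans (A.sym (scalar-im (t ^ n) x)) q)

  clear-fraction : ∀ a k l → embed (t ^ (k ℕ.+ l)) F.* (a /t^ k) F.≈ embed (a A.* t ^ l)
  clear-fraction a k l = mk≈ᶠ (A.trans (A.*-identityʳ _) (A.trans (A.*-congʳ (^-homo-* t k l))
    (solve 3 (λ x y a → x :* y :* a := a :* y :* x) A.refl (t ^ k) (t ^ l) a)))
    where open import Algebra.Solver.Ring.NaturalCoefficients.Default A.commutativeSemiring using (solve; con; _:+_; _:*_; _:=_)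

  clear : ∀ z → ∃[ n ] ∃[ x ] emb (scalar (t ^ n)) K.* z K.≈ emb x
  clear ((a /t^ k) + (b /t^ l) √) = k ℕ.+ l , (a A.* t ^ l) + (b A.* t ^ k) √ ,
    ( F.trans (F.+-congˡ (zero-im (b /t^ l))) (F.trans (F.+-identityʳ _) (clear-fraction a k l))
    , F.trans (F.+-congˡ (F.zeroˡ (a /t^ k)))
        (F.trans (F.+-identityʳ _) (F.trans
        (F.*-congʳ (F.reflexive (≡.cong (embed ∘ (t ^_)) (ℕ.+-comm k l)))) (clear-fraction b l k))))
    where
    zero-im : ∀ z → embed D F.* (embed 0# F.* z) F.≈ F.0#
    zero-im z = F.trans (F.*-congˡ (F.zeroˡ z)) (F.zeroʳ (embed D))

  embed-cancel : ∀ n z → embed (t ^ n) F.* z F.≈ F.0# → z F.≈ F.0#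
  embed-cancel n (a /t^ k) (mk≈ᶠ e) = mk≈ᶠ (A.trans (A.*-identityʳ a) (A.trans
    (t^-cancel n (A.trans (A.sym (A.*-identityʳ _)) (A.trans e (A.zeroˡ _)))) (A.sym (A.zeroˡ _))))

  emb-cancel : ∀ n z → emb (scalar (t ^ n)) K.* z K.≈ K.0# → z K.≈ K.0#
  emb-cancel n (x + y √) (p , q) =
      embed-cancel n x (F.trans (F.sym (F.trans (F.+-congˡ zero-im) (F.+-identityʳ _))) p)
    , embed-cancel n y (F.trans (F.sym (F.trans (F.+-congˡ (F.zeroˡ x)) (F.+-identityʳ _))) q)
    where
    zero-im : embed D F.* (embed 0# F.* y) F.≈ F.0#
    zero-im = F.trans (F.*-congˡ (F.zeroˡ y)) (F.zeroʳ (embed D))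

  scalar-* : ∀ k n → scalar (t ^ (k ℕ.+ n)) O.≈ scalar (t ^ k) O.* scalar (t ^ n)
  scalar-* k n = A.trans (^-homo-* t k n) (A.sym (scalar-re (t ^ k) (scalar (t ^ n))))
               , A.sym (A.trans (scalar-im (t ^ k) (scalar (t ^ n))) (A.zeroʳ _))

-- emb makes K a ring of fractions of O with denominators den n.
record FractionRing {c ℓ} (O K : CommutativeRing c ℓ) : Set (c ⊔ ℓ) where
  private
    module O = CommutativeRing O
    module K = CommutativeRing K
  field
    emb           : O.Carrier → K.Carrier
    emb-cong      : ∀ {x y} → x O.≈ y → emb x K.≈ emb y
    emb-injective : ∀ {x y} → emb x K.≈ emb y → x O.≈ y
    emb-+         : ∀ x y → emb (x O.+ y) K.≈ emb x K.+ emb y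
    emb-*         : ∀ x y → emb (x O.* y) K.≈ emb x K.* emb y
    emb-0         : emb O.0# K.≈ K.0#
    emb-1         : emb O.1# K.≈ K.1#
    den           : ℕ → O.Carrier
    den-*         : ∀ k n → den (k ℕ.+ n) O.≈ den k O.* den n
    den-cancel    : ∀ n {x} → den n O.* x O.≈ O.0# → x O.≈ O.0#
    den-cancelᴷ   : ∀ n z → emb (den n) K.* z K.≈ K.0# → z K.≈ K.0#
    clear         : ∀ z → ∃[ n ] ∃[ x ] emb (den n) K.* z K.≈ emb x

module Transfer {c ℓ} (O K : CommutativeRing c ℓ) (fractions : FractionRing O K) where
  private
    module O = CommutativeRing O
    module K = CommutativeRing K
  open FractionRing fractions
  open import Algebra.Properties.Semiring.Exp O.semiring using () renaming (_^_ to _^ᴼ_)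
  open import Algebra.Properties.Semiring.Exp K.semiring using () renaming (_^_ to _^ᴷ_; ^-congˡ to ^ᴷ-congˡ)
  open import Algebra.Solver.Ring.NaturalCoefficients.Default K.commutativeSemiring using (solve; con; _:+_; _:*_; _:^_; _:=_)
  open Quartic O
  open AdditiveForms K

  emb-^ : ∀ x n → emb (x ^ᴼ n) K.≈ emb x ^ᴷ n
  emb-^ x zero    = emb-1
  emb-^ x (suc n) = K.trans (emb-* x (x ^ᴼ n)) (K.*-congˡ (emb-^ x n))

  emb-*⁴ : ∀ b y → emb (b O.* y ^ᴼ 4) K.≈ emb b K.* emb y ^ᴷ 4
  emb-*⁴ b y = K.trans (emb-* b (y ^ᴼ 4)) (K.*-congˡ (emb-^ y 4))

  -- A coefficient is multiplied by the fourth power of its denominator, because such a factor can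
  -- be moved into the argument.
  clear⁴ : ∀ a → ∃[ n ] ∃[ b ] a K.* emb (den n) ^ᴷ 4 K.≈ emb b
  clear⁴ a =
    let n , x , e = clear a
        τ = den n
    in n , x O.* τ ^ᴼ 3 , K.trans (solve 2 (λ a τ → a :* τ :^ 4 := (τ :* a) :* τ :^ 3) K.refl a (emb τ))
         (K.trans (K.*-cong e (K.sym (emb-^ τ 3))) (K.sym (emb-* x (τ ^ᴼ 3))))

  private
    denominator⁴ : K.Carrier → O.Carrier
    denominator⁴ a = den (proj₁ (clear⁴ a))

    numerator⁴ : K.Carrier → O.Carrier
    numerator⁴ a = proj₁ (proj₂ (clear⁴ a))

  Zero : ∀ {s} → Vector K.Carrier s → List (O.Carrier × O.Carrier) → Set _
  Zero a ps = Σ[ x ∈ Vector K.Carrier _ ] additiveForm 4 a x K.≈ emb (form ps) ×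
      (Any Nonzero ps → ¬ (∀ i → x i K.≈ K.0#))

  clear-form : ∀ {s} (a : Vector K.Carrier s) ps → map proj₁ ps ≡ List.tabulate (numerator⁴ ∘ a) →
      Zero a ps
  clear-form {zero}  a []             _  = (λ ()) , K.sym emb-0 , λ ()
  clear-form {suc s} a ((b , y) ∷ ps) eq = combine (clear-form (a ∘ suc) ps (∷-injectiveʳ eq))
    where
    τ = denominator⁴ (a zero)
    τ-cancel : ∀ {y} → emb τ K.* emb y K.≈ K.0# → y O.≈ O.0#
    τ-cancel {y} e = den-cancel (proj₁ (clear⁴ (a zero)))
        (emb-injective (K.trans (emb-* τ y) (K.trans e (K.sym emb-0))))
    combine : Zero (a ∘ suc) ps → Zero a ((b , y) ∷ ps)
    combine (x , e , nz) = x′ , form≈ , nonzero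
      where
      x′ : Vector K.Carrier (suc s)
      x′ zero    = emb τ K.* emb y
      x′ (suc i) = x i
      form≈ : additiveForm 4 a x′ K.≈ emb (form ((b , y) ∷ ps))
      form≈ = K.trans (K.+-cong (K.trans
        (solve 3 (λ a τ y → a :* (τ :* y) :^ 4 := (a :* τ :^ 4) :* y :^ 4) K.refl (a zero) (emb τ)
            (emb y))
        (K.trans (K.*-congʳ (K.trans (proj₂ (proj₂ (clear⁴ (a zero))))
            (K.reflexive (≡.cong emb (≡.sym (∷-injectiveˡ eq))))))
          (K.sym (emb-*⁴ b y)))) e) (K.sym (emb-+ _ _))
      nonzero : Any Nonzero ((b , y) ∷ ps) → ¬ (∀ i → x′ i K.≈ K.0#)
      nonzero (here y≉0) z = y≉0 (τ-cancel (z zero))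
      nonzero (there a)  z = nz a (z ∘ suc)

  isotropic : ∀ n → (∀ bs → length bs ≡ n → HasZero bs) → ∀ s → n ℕ.≤ s →
      (a : Vector K.Carrier s) → HasNontrivialZero 4 a
  isotropic n all s n≤s a = transfer (≡.subst HasZero (take++drop≡id n bs)
      -- The first n coefficients already give a zero; all further arguments are 0.
      (Represents-++ʳ ≈0-resp (List.drop n bs) (all (List.take n bs)
        (≡.trans (length-take n bs) (≡.trans (≡.cong (n ℕ.⊓_) (length-tabulate _)) (ℕ.m≤n⇒m⊓n≡m n≤s))))))
    where
    bs = List.tabulate (numerator⁴ ∘ a)
    transfer : HasZero bs → HasNontrivialZero 4 a
    transfer (ps , eq , z , nz) = let x , e , nonzero = clear-form a ps eq in
      x , nonzero nz , K.trans e (K.trans (emb-cong z) emb-0)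

  common-denominator : ∀ {s} (x : Vector K.Carrier s) →
    ∃[ n ] Σ[ y ∈ Vector O.Carrier s ] (∀ i → emb (den n) K.* x i K.≈ emb (y i))
  common-denominator {zero}  x = 0 , (λ ()) , λ ()
  common-denominator {suc s} x with common-denominator (x ∘ suc) | clear (x zero)
  ... | n , y , e | k , z , e′ = k ℕ.+ n , y′ , cleared
    where
    y′ : Vector O.Carrier (suc s)
    y′ zero    = den n O.* z
    y′ (suc i) = den k O.* y i
    τ≈ : emb (den (k ℕ.+ n)) K.≈ emb (den k) K.* emb (den n)
    τ≈ = K.trans (emb-cong (den-* k n)) (emb-* (den k) (den n))
    cleared : ∀ i → emb (den (k ℕ.+ n)) K.* x i K.≈ emb (y′ i)
    cleared zero    = K.trans (K.*-congʳ τ≈) (K.trans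
      (solve 3 (λ s t x → s :* t :* x := t :* (s :* x)) K.refl (emb (den k)) (emb (den n)) (x zero))
      (K.trans (K.*-congˡ e′) (K.sym (emb-* (den n) z))))
    cleared (suc i) = K.trans (K.*-congʳ τ≈) (K.trans (K.*-assoc _ _ _)
      (K.trans (K.*-congˡ (e i)) (K.sym (emb-* (den k) (y i)))))

  emb-form : ∀ {s} (b y : Vector O.Carrier s) (x : Vector K.Carrier s) τ →
      (∀ i → τ K.* x i K.≈ emb (y i)) →
    emb (form (List.tabulate λ i → b i , y i)) K.≈ τ ^ᴷ 4 K.* additiveForm 4 (emb ∘ b) x
  emb-form {zero}  b y x τ e = K.trans emb-0 (K.sym (K.zeroʳ _))
  emb-form {suc s} b y x τ e = K.trans (emb-+ _ _) (K.trans
    (K.+-cong (K.trans (emb-*⁴ (b zero) (y zero)) (K.*-congˡ (^ᴷ-congˡ 4 (K.sym (e zero)))))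
        (emb-form (b ∘ suc) (y ∘ suc) (x ∘ suc) τ (e ∘ suc)))
    (solve 4 (λ b τ x f → b :* (τ :* x) :^ 4 :+ τ :^ 4 :* f := τ :^ 4 :* (b :* x :^ 4 :+ f)) K.refl
      (emb (b zero)) τ (x zero) (additiveForm 4 (emb ∘ b ∘ suc) (x ∘ suc))))

  -- A common denominator of the arguments multiplies the value of the form by its fourth power
  -- only, so a zero over the fractions becomes a zero over the integers.
  anisotropic : ∀ {s} (b : Vector O.Carrier s) → Anisotropic (List.tabulate b) →
      ¬ HasNontrivialZero 4 (emb ∘ b)
  anisotropic b aniso (x , x≉0 , z) with common-denominator x
  ... | n , y , e = x≉0 λ i → den-cancelᴷ n (x i) (K.trans (e i) (K.trans (emb-cong (y≈0 i)) emb-0))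
    where
    τ = emb (den n)
    vanish : form (List.tabulate λ i → b i , y i) O.≈ O.0#
    vanish = emb-injective (K.trans (emb-form b y x τ e)
        (K.trans (K.*-congˡ z) (K.trans (K.zeroʳ _) (K.sym emb-0))))
    y≈0 : ∀ i → y i O.≈ O.0#
    y≈0 = All.tabulate⁻ (aniso _ (map-tabulate _ proj₁) vanish)

-- The quadratic ring as an instance, and the theorem for its fractions

Γ*[4]≡11 : CommutativeRing 0ℓ 0ℓ → Set
Γ*[4]≡11 K =
  let open CommutativeRing K using (Carrier)
      open AdditiveForms K
  in (Γ*[ 4 ]≡ 11)
     × (∀ s → s ℕ.≥ 11 → (a : Vector Carrier s) → HasNontrivialZero 4 a)
     × (∃[ a ] ¬ HasNontrivialZero 4 {10} a)

module QuadraticIntegers {A : CommutativeRing 0ℓ 0ℓ} {2# D : CommutativeRing.Carrier A}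
    (2-cancel : Cancellative A 2#)
  (dyadic : Dyadic A 2#) (discriminant : RamifiedDiscriminant A 2# D) where
  open CommutativeRing A
  open Mult semiring renaming (_×_ to _·_)
  open Dyadic dyadic
  open RamifiedDiscriminant discriminant
  open Ramified 2-cancel dyadic discriminant
  open AdjoinSqrt A D using (Element; _+_√; re; im; _≈√_; _,_; re-≈; im-≈)
  private
    module O = CommutativeRing O
    module O× = Mult O.semiring
  open import Algebra.Solver.Ring.NaturalCoefficients.Default commutativeSemiring using (solve; con; _:+_; _:*_; _:=_)
  open import Relation.Binary.Reasoning.Setoid setoid

  2ᴼ : Element
  2ᴼ = O.1# O.+ O.1#

  scalar : Carrier → Element
  scalar a = a + 0# √

  scalar-cong : ∀ {a b} → a ≈ b → scalar a ≈√ scalar b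
  scalar-cong p = p , refl

  scalar-+ : ∀ a b → scalar (a + b) ≈√ scalar a O.+ scalar b
  scalar-+ a b = refl , sym (+-identityˡ 0#)

  scalar-* : ∀ a b → scalar (a * b) ≈√ scalar a O.* scalar b
  scalar-* a b = solve 3 (λ D a b → a :* b := a :* b :+ D :* (con 0 :* con 0)) refl D a b
               , solve 2 (λ a b → con 0 := a :* con 0 :+ con 0 :* b) refl a b

  scalar-numeral : ∀ n → scalar (n · 1#) ≈√ n O×.× O.1#
  scalar-numeral zero    = refl , refl
  scalar-numeral (suc n) = O.trans (scalar-+ 1# (n · 1#)) (O.+-congˡ {scalar 1#} (scalar-numeral n))

  scalar-2 : scalar 2# ≈√ 2ᴼ
  scalar-2 = 2#≈1+1 , sym (+-identityˡ 0#)

  scalar-2* : ∀ {a y} → scalar a ≈√ y → scalar (2# * a) ≈√ 2ᴼ O.* y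
  scalar-2* {a} {y} p = O.trans (scalar-* 2# a) (O.*-cong scalar-2 p)

  π²≈D : π O.* π ≈√ scalar D
  π²≈D = solve 1 (λ D → con 0 :* con 0 :+ D :* (con 1 :* con 1) := D) refl D
       , solve 0 (con 0 :* con 1 :+ con 1 :* con 0 := con 0) refl

  π²≈2υᴼ : π O.* π ≈√ 2ᴼ O.* scalar υ
  π²≈2υᴼ = O.trans π²≈D (O.trans (scalar-cong D≈2υ) (scalar-2* {υ} O.refl))

  υν≈1ᴼ : scalar υ O.* scalar ν ≈√ O.1#
  υν≈1ᴼ = O.trans (O.sym (scalar-* υ ν)) (scalar-cong υν≈1)

  υ≈1+2w₁ᴼ : scalar υ ≈√ O.1# O.+ 2ᴼ O.* scalar w₁
  υ≈1+2w₁ᴼ = O.trans (scalar-cong υ≈1+2w₁)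
      (O.trans (scalar-+ 1# (2# * w₁)) (O.+-congˡ {scalar 1#} (scalar-2* {w₁} O.refl)))

  w₁≈δ+2w₂ᴼ : scalar w₁ ≈√ δ O×.× O.1# O.+ 2ᴼ O.* scalar w₂
  w₁≈δ+2w₂ᴼ = O.trans (scalar-cong w₁≈δ+2w₂) (O.trans (scalar-+ (δ · 1#) (2# * w₂))
    (O.+-cong (scalar-numeral δ) (scalar-2* {w₂} O.refl)))

  π²≈d+16e : π O.* π ≈√ d O×.× O.1# O.+ 2ᴼ O.* (2ᴼ O.* (2ᴼ O.* (2ᴼ O.* scalar e)))
  π²≈d+16e = O.trans π²≈D (O.trans (scalar-cong D≈d+16e) (O.trans (scalar-+ (d · 1#) _)
    (O.+-cong (scalar-numeral d) (scalar-2* (scalar-2* (scalar-2* (scalar-2* {e} O.refl)))))))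

  numeral₂ : ∀ x → (∃[ y ] x ≈ 2# * y) ⊎ (∃[ y ] x ≈ 1# + 2# * y)
  numeral₂ x = [ (λ v → let y , p , _ = ∣2^-halve v in inj₁ (y , p))
               , (λ v → let y , p , _ = ∣2^-halve v in inj₂ (y , trans (split x) (+-congˡ p))) ]′ (digit x)
    where
    split : ∀ x → x ≈ 1# + (x - 1#)
    split x = begin
      x                  ≈⟨ +-identityʳ x ⟨
      x + 0#             ≈⟨ +-congˡ (-‿inverseˡ 1#) ⟨
      x + (- 1# + 1#)    ≈⟨ +-assoc x (- 1#) 1# ⟨
      (x - 1#) + 1#      ≈⟨ +-comm (x - 1#) 1# ⟩
      1# + (x - 1#)      ∎

  -- The list restricts the admissible digits, so that the parity of a real part survives in its
  -- digit modulo 4; `parity` needs this to land in `L0`.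
  Numeral₄ : List ℕ → Carrier → Set
  Numeral₄ ps x = ∃[ p ] p ∈ ps × ∃[ y ] x ≈ p · 1# + 2# * (2# * y)

  even-numeral₄ : ∀ {x} y → x ≈ 2# * y → Numeral₄ (0 ∷ 2 ∷ []) x
  even-numeral₄ y p = [ (λ (z , q) → 0 , here ≡.refl , z ,
      trans p (trans (*-congˡ q) (sym (+-identityˡ _))))
    , (λ (z , q) → 2 , there (here ≡.refl) , z , trans p (trans (*-congˡ q) (trans (distribˡ 2# 1# _)
        (+-congʳ (trans (*-identityʳ 2#) (trans 2#≈1+1 (+-congˡ (sym (+-identityʳ 1#)))))))))
    ]′ (numeral₂ y)

  odd-numeral₄ : ∀ {x} y → x ≈ 1# + 2# * y → Numeral₄ (1 ∷ 3 ∷ []) x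
  odd-numeral₄ y p = [ (λ (z , q) → 1 , here ≡.refl , z ,
      trans p (+-cong (sym (+-identityʳ 1#)) (*-congˡ q)))
    , (λ (z , q) → 3 , there (here ≡.refl) , z ,
        trans p (trans (+-congˡ (trans (*-congˡ q) (trans (distribˡ 2# 1# _)
        (+-congʳ (trans (*-identityʳ 2#) (trans 2#≈1+1 (+-congˡ (sym (+-identityʳ 1#)))))))))
            (sym (+-assoc 1# _ _))))
    ]′ (numeral₂ y)

  numeral₄ : ∀ x → Numeral₄ (0 ∷ 1 ∷ 2 ∷ 3 ∷ []) x
  numeral₄ x = [ (λ (y , p) → let q , q∈ , r = even-numeral₄ y p in q , evens q∈ , r)
               , (λ (y , p) → let q , q∈ , r = odd-numeral₄ y p in q , odds q∈ , r) ]′ (numeral₂ x)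
    where
    evens : ∀ {q} → q ∈ 0 ∷ 2 ∷ [] → q ∈ 0 ∷ 1 ∷ 2 ∷ 3 ∷ []
    evens (here e)         = here e
    evens (there (here e)) = there (there (here e))
    odds : ∀ {q} → q ∈ 1 ∷ 3 ∷ [] → q ∈ 0 ∷ 1 ∷ 2 ∷ 3 ∷ []
    odds (here e)         = there (here e)
    odds (there (here e)) = there (there (there (here e)))

  ramification : Ramification O
  ramification = record
    { π²≈2υ = π²≈2υᴼ ; υν≈1 = υν≈1ᴼ ; υ≈1+2w₁ = υ≈1+2w₁ᴼ ; δ = δ ; w₁≈δ+2w₂ = w₁≈δ+2w₂ᴼ }

  open Congruences O ramification using (_≡₄_; mod4; residue₄; HasClass; HasClassIn)

  residue-scalar : ∀ p q → residue₄ p q ≈√ (p · 1# + q · 1# √)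
  residue-scalar p q = O.trans (O.+-cong (O.sym (scalar-numeral p))
      (O.*-congʳ {π} (O.sym (scalar-numeral q))))
    ( solve 3 (λ D p q → p :+ (q :* con 0 :+ D :* (con 0 :* con 1)) := p) refl D (p · 1#) (q · 1#)
    , solve 1 (λ q → con 0 :+ (q :* con 1 :+ con 0 :* con 0) := q) refl (q · 1#))

  ≡₄-parts : ∀ {x} p q y z → re x ≈ p · 1# + 2# * (2# * y) → im x ≈ q · 1# + 2# * (2# * z) →
      x ≡₄ residue₄ p q
  ≡₄-parts {x} p q y z e e′ = mod4 {quotient = y + z √}
    (O.trans {x} (O.trans {x} (e , e′) (O.+-cong (O.sym (residue-scalar p q)) 4w)) O.refl)
    where
    4w : (2# * (2# * y) + 2# * (2# * z) √) ≈√ 2ᴼ O.* (2ᴼ O.* (y + z √))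
    4w = O.trans ( solve 4 (λ D t y z → t :* (t :* y) := t :* (t :* y :+ D :* (con 0 :* z)) :+ D :*
        (con 0 :* (t :* z :+ con 0 :* y))) refl D 2# y z
                 , solve 4 (λ D t y z → t :* (t :* z) := t :* (t :* z :+ con 0 :* y) :+ con 0 :*
                     (t :* y :+ D :* (con 0 :* z))) refl D 2# y z)
           (O.*-cong scalar-2 (O.*-congʳ {y + z √} scalar-2))

  digits : ∀ x → ∃[ p ] ∃[ q ] x ≡₄ residue₄ p q
  digits x =
    let p , _ , y , e  = numeral₄ (re x)
        q , _ , z , e′ = numeral₄ (im x)
    in p , q , ≡₄-parts p q y z e e′

  parity : ∀ x → (∃[ y ] x ≈√ (π O.* y)) ⊎ HasClassIn L0 x
  parity x = [ (λ (y , e) → inj₁ (even⇒π* (∣2^-resp (sym e) (∣2^-double ∣2^-zero)))) ,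
      (λ (y , e) → inj₂ (odd (odd-numeral₄ y e) (numeral₄ (im x)))) ]′ (numeral₂ (re x))
    where
    odd : Numeral₄ (1 ∷ 3 ∷ []) (re x) → Numeral₄ (0 ∷ 1 ∷ 2 ∷ 3 ∷ []) (im x) → HasClassIn L0 x
    odd (p , p∈ , y , e) (q , q∈ , z , e′) =
      -- `L0` is by computation the product of the digits 1, 3 with the digits 0, 1, 2, 3, in this
      -- order.
      Any.map (λ { ≡.refl → ≡₄-parts p q y z e e′ }) (∈-cartesianProduct⁺ p∈ q∈)

  π-cancel-0 : ∀ {x} → π O.* x ≈√ O.0# → x ≈√ O.0#
  π-cancel-0 {x} e = π-cancel {x} {O.0#} (O.trans e (O.sym (O.zeroʳ π)))

  π-nonunit : ∀ y → ¬ O.1# ≈√ (π O.* y)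
  π-nonunit y e = contradiction (∣2^-numeral 1 1 (∣2^-resp (sym (+-identityʳ 1#)) (π*⇒even y e))) λ 2∣1 →
      contradiction (ℕ.∣⇒≤ 2∣1) λ { (ℕ.s≤s ()) }

  faithful : ∀ a b {y} → residue₄ a b ≈√ (2ᴼ O.* (2ᴼ O.* (2ᴼ O.* (2ᴼ O.* y)))) →
      a ℕ.% 16 ≡ 0 × b ℕ.% 16 ≡ 0
  faithful a b {y} e = multiple a (re y) (trans (re-≈ eq) re16) , multiple b (im y) (trans (im-≈ eq) im16)
    where
    s = scalar 2#
    eq : (a · 1# + b · 1# √) ≈√ (s O.* (s O.* (s O.* (s O.* y))))
    eq = O.trans (O.sym (residue-scalar a b)) (O.trans e (O.sym
      (O.*-cong scalar-2 (O.*-cong scalar-2 (O.*-cong scalar-2 (O.*-congʳ {y} scalar-2))))))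
    dbl : ∀ x → (s O.* x) ≈√ (2# * re x + 2# * im x √)
    dbl x = solve 4 (λ D t a b → t :* a :+ D :* (con 0 :* b) := t :* a) refl D 2# (re x) (im x)
          , solve 3 (λ t a b → t :* b :+ con 0 :* a := t :* b) refl 2# (re x) (im x)
    16·y : (s O.* (s O.* (s O.* (s O.* y)))) ≈√
        (2# * (2# * (2# * (2# * re y))) + 2# * (2# * (2# * (2# * im y))) √)
    16·y = O.trans (O.*-congˡ {s} (O.trans (O.*-congˡ {s} (O.trans (O.*-congˡ {s} (dbl y)) (dbl _)))
        (dbl _))) (dbl _)
    re16 = re-≈ 16·y
    im16 = im-≈ 16·y
    multiple : ∀ n z → n · 1# ≈ 2# * (2# * (2# * (2# * z))) → n ℕ.% 16 ≡ 0
    multiple n z e = ℕ.n∣m⇒m%n≡0 n 16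
        (∣2^-numeral 4 n (∣2^-resp (sym e) (∣2^-double (∣2^-double (∣2^-double (∣2^-double ∣2^-zero))))))

  integers : RamifiedIntegers O ramification
  integers = record
    { digits    = digits
    ; parity    = parity
    ; π-cancel  = π-cancel-0
    ; π-nonunit = π-nonunit
    ; adic      = record { Div-separated = Div-separated ; Div-complete = Div-complete }
    ; d         = d
    ; π²≈d+16e  = π²≈d+16e
    ; faithful  = faithful
    }

  module Fr = Fractions A 2# D 2-cancel

  K : CommutativeRing 0ℓ 0ℓ
  K = AdjoinSqrt.commutativeRing (Localization.commutativeRing A 2# 2-cancel)
      (Localization.embed A 2# 2-cancel D)

  open import Algebra.Properties.Semiring.Exp semiring using (_^_)

  fractions : FractionRing O K
  fractions = record
    { emb           = Fr.emb
    ; emb-cong      = Fr.emb-cong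
    ; emb-injective = Fr.emb-injective
    ; emb-+         = Fr.emb-+
    ; emb-*         = Fr.emb-*
    ; emb-0         = CommutativeRing.refl K
    ; emb-1         = CommutativeRing.refl K
    ; den           = λ n → Fr.scalar (2# ^ n)
    ; den-*         = Fr.scalar-*
    ; den-cancel    = Fr.scalar-cancel
    ; den-cancelᴷ   = Fr.emb-cancel
    ; clear         = Fr.clear
    }

  module Tr = Transfer O K fractions
  module Descend = Descent O ramification integers

  open AdditiveForms K

  coefficients : ℕ → ℕ → List Element
  coefficients p q = replicate 6 (residue₄ 1 0) ++ replicate 4 (residue₄ p q)

  Γ*≡11 : ∀ p q → T (searchAll δ) → T (Mod16.noPrimitiveZero d (1 , 0) 6 (p , q) 4) → ExcludedMiddle 0ℓ →
    Γ*[4]≡11 (AdjoinSqrt.commutativeRing (Localization.commutativeRing A 2# 2-cancel)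
        (Localization.embed A 2# 2-cancel D))
  Γ*≡11 p q searched checked em =
    (isotropic 11 ℕ.≤-refl , minimal) , isotropic , Fr.emb ∘ List.lookup bs ,
        Tr.anisotropic (List.lookup bs) (≡.subst Anisotropic (≡.sym (tabulate-lookup bs)) anisotropic)
    where
    open Quartic O using (Anisotropic; Anisotropic-++⁻ˡ)
    bs = coefficients p q
    isotropic : ∀ s → s ℕ.≥ 11 → (a : Vector (CommutativeRing.Carrier K) s) → HasNontrivialZero 4 a
    isotropic = Tr.isotropic 11 (Isotropy.HasZero-11 O ramification integers searched em)
    anisotropic : Anisotropic bs
    anisotropic = Descend.anisotropic (Descend.⊨-refl 1 0) (Descend.⊨-refl p q) 6 4 checked
    minimal : ∀ t → EveryFormIsotropic 4 t → 11 ℕ.≤ t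
    minimal t all = ℕ.≮⇒≥ λ t<11 →
      -- A form on the first t of the ten coefficients is a subform of an anisotropic form, hence a
      -- counterexample for t.
      let cs = List.take t bs
          cs-anisotropic = Anisotropic-++⁻ˡ cs
              (≡.subst Anisotropic (≡.sym (take++drop≡id t bs)) anisotropic)
          length-cs = ≡.trans (length-take t bs) (ℕ.m≤n⇒m⊓n≡m (ℕ.s≤s⁻¹ t<11))
      in Tr.anisotropic (List.lookup cs) (≡.subst Anisotropic (≡.sym (tabulate-lookup cs)) cs-anisotropic)
           (≡.subst (EveryFormIsotropic 4) (≡.sym length-cs) all (Fr.emb ∘ List.lookup cs))

-- The four fields

-- L≡ and D≡ are instantiated with refl: they keep the two presentations of K from being compared
-- by unfolding.
Γ*[4]≡11-integer : {A : CommutativeRing 0ℓ 0ℓ} (let open CommutativeRing A) {2# : Carrier}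
  (2-cancel : Cancellative A 2#) (dyadic : Dyadic A 2#) (let open Dyadic dyadic)
  (m u w₁ w₂ e : ℤ) (δ d p q : ℕ) →
  m ≡ + 2 ℤ.* u → u ≡ + 1 ℤ.+ + 2 ℤ.* w₁ → w₁ ≡ + δ ℤ.+ + 2 ℤ.* w₂ →
  m ≡ + d ℤ.+ + 2 ℤ.* (+ 2 ℤ.* (+ 2 ℤ.* (+ 2 ℤ.* e))) →
  T (searchAll δ) → T (Mod16.noPrimitiveZero d (1 , 0) 6 (p , q) 4) → ExcludedMiddle 0ℓ →
  ∀ {L} (L≡ : Localization.commutativeRing A 2# 2-cancel ≡ L) {D} →
  ≡.subst CommutativeRing.Carrier L≡ (Localization.embed A 2# 2-cancel (ι m)) ≡ D →
  Γ*[4]≡11 (AdjoinSqrt.commutativeRing L D)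
Γ*[4]≡11-integer {A} {2#} 2-cancel dyadic m u w₁ w₂ e δ d p q m≡2u u≡1+2w₁ w₁≡δ+2w₂ m≡d+16e searched
    checked em ≡.refl ≡.refl =
  QuadraticIntegers.Γ*≡11 {A} {2#} {ι m} 2-cancel dyadic discriminant
    p q searched checked em
  where
  open CommutativeRing A
  open Dyadic dyadic
  open Mult semiring renaming (_×_ to _·_)
  ι-cong : ∀ {a b} → a ≡ b → ι a ≈ ι b
  ι-cong ≡.refl = refl
  2e 4e 8e : ℤ
  2e = + 2 ℤ.* e
  4e = + 2 ℤ.* 2e
  8e = + 2 ℤ.* 4e
  ι-2* : ∀ a → ι (+ 2 ℤ.* a) ≈ 2# * ι a
  ι-2* a = trans (ι-* (+ 2) a) (*-congʳ ι-2)
  ι-numeral : ∀ n → ι (+ n) ≈ n · 1#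
  ι-numeral zero    = ι-0
  ι-numeral (suc n) = trans (ι-+ (+ 1) (+ n)) (+-cong ι-1 (ι-numeral n))
  u-odd : + 2 ℤ.∣ + 1 ℤ.- u
  u-odd = divides (ℤ.- w₁) (≡.trans (≡.cong (λ v → + 1 ℤ.- v) u≡1+2w₁) (eq w₁))
    where
    eq : ∀ w → + 1 ℤ.- (+ 1 ℤ.+ + 2 ℤ.* w) ≡ (ℤ.- w) ℤ.* + 2
    eq = solve-∀
  discriminant : RamifiedDiscriminant A 2# (ι m)
  discriminant = record
    { υ        = ι u
    ; ν        = proj₁ (ι-inverse u u-odd)
    ; w₁       = ι w₁
    ; w₂       = ι w₂
    ; e        = ι e
    ; δ        = δ
    ; d        = d
    ; D≈2υ     = trans (ι-cong m≡2u) (ι-2* u)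
    ; υν≈1     = proj₂ (ι-inverse u u-odd)
    ; υ≈1+2w₁  = trans (ι-cong u≡1+2w₁) (trans (ι-+ (+ 1) (+ 2 ℤ.* w₁)) (+-cong ι-1 (ι-2* w₁)))
    ; w₁≈δ+2w₂ = trans (ι-cong w₁≡δ+2w₂) (trans (ι-+ (+ δ) (+ 2 ℤ.* w₂)) (+-cong (ι-numeral δ) (ι-2* w₂)))
    ; D≈d+16e  = trans (ι-cong m≡d+16e) (trans (ι-+ (+ d) (+ 2 ℤ.* 8e)) (+-cong (ι-numeral d)
        (trans (ι-2* 8e) (*-congˡ (trans (ι-2* 4e) (*-congˡ (trans (ι-2* 2e) (*-congˡ (ι-2* e)))))))))
    }

ℚ₂[√]-elim : ∀ (P : CommutativeRing 0ℓ 0ℓ → Set) m →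
  (∀ L (L≡ : Localization.commutativeRing ℤ₂-commutativeRing (ℤ⇒ℤ₂ (+ 2)) 2-cancelˡ ≡ L) D →
    ≡.subst CommutativeRing.Carrier L≡
        (Localization.embed ℤ₂-commutativeRing (ℤ⇒ℤ₂ (+ 2)) 2-cancelˡ (Dyadic.ι ℤ₂-dyadic m)) ≡ D →
    P (AdjoinSqrt.commutativeRing L D)) → P ℚ₂[√ m ]
ℚ₂[√]-elim P m h = h ℚ₂-commutativeRing ≡.refl (ℚ₂.embed (ℤ⇒ℤ₂ m)) ≡.refl

Γ*[4]≡11-ramified : ∀ (m u w₁ w₂ e : ℤ) (δ d p q : ℕ) →
  m ≡ + 2 ℤ.* u → u ≡ + 1 ℤ.+ + 2 ℤ.* w₁ → w₁ ≡ + δ ℤ.+ + 2 ℤ.* w₂ →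
  m ≡ + d ℤ.+ + 2 ℤ.* (+ 2 ℤ.* (+ 2 ℤ.* (+ 2 ℤ.* e))) →
  searchAll δ ≡ true → Mod16.noPrimitiveZero d (1 , 0) 6 (p , q) 4 ≡ true → ExcludedMiddle 0ℓ →
      Γ*[4]≡11 ℚ₂[√ m ]
Γ*[4]≡11-ramified m u w₁ w₂ e δ d p q m≡ u≡ w₁≡ m≡′ searched checked em = ℚ₂[√]-elim Γ*[4]≡11 m λ L L≡ D
    D≡ →
  Γ*[4]≡11-integer {ℤ₂-commutativeRing} {ℤ⇒ℤ₂ (+ 2)} 2-cancelˡ ℤ₂-dyadic m u w₁ w₂ e δ d p q m≡ u≡ w₁≡ m≡′
    (Equivalence.from T-≡ searched) (Equivalence.from T-≡ checked) em {L} L≡ {D} D≡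

-- The search depends on m through δ alone: this evaluation serves 2 and 10, and the one for δ = 1
-- serves -2 and -10.
searched₀ : searchAll 0 ≡ true
searched₀ = ≡.refl

searched₁ : searchAll 1 ≡ true
searched₁ = ≡.refl

open import Data.Integer.Base using (-_)

theorem1 : ExcludedMiddle 0ℓ →
    ∀ m → m ∈ (+ 2 ∷ + 10 ∷ - (+ 2) ∷ - (+ 10) ∷ []) →
    let open CommutativeRing ℚ₂[√ m ] using (Carrier)
        open AdditiveForms ℚ₂[√ m ]
    in (Γ*[ 4 ]≡ 11)
       × (∀ s → s ≥ 11 → (a : Vector Carrier s) → HasNontrivialZero 4 a)
       × (∃[ a ] ¬ HasNontrivialZero 4 {10} a)
theorem1 em _ (here ≡.refl) =
  -- Here u is 1 modulo 4, so δ = 0; the final digits 0 and 2 encode β = 2π.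
  Γ*[4]≡11-ramified (+ 2) (+ 1) (+ 0) (+ 0) (+ 0) 0 2 0 2 ≡.refl ≡.refl ≡.refl ≡.refl searched₀ ≡.refl em
theorem1 em _ (there (here ≡.refl)) =
  Γ*[4]≡11-ramified (+ 10) (+ 5) (+ 2) (+ 1) (+ 0) 0 10 0 2 ≡.refl ≡.refl ≡.refl ≡.refl searched₀ ≡.refl
      em
theorem1 em _ (there (there (here ≡.refl))) =
  -- Here u = -1 is 3 modulo 4, so δ = 1, and the final digits encode β = 4 + 2π. The residue 14
  -- stands for -2 modulo 16, whence e = -1.
  Γ*[4]≡11-ramified (- (+ 2)) -[1+ 0 ] -[1+ 0 ] -[1+ 0 ] -[1+ 0 ] 1 14 4 2 ≡.refl ≡.refl ≡.refl ≡.refl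
      searched₁ ≡.refl em
theorem1 em _ (there (there (there (here ≡.refl)))) =
  Γ*[4]≡11-ramified (- (+ 10)) -[1+ 4 ] -[1+ 2 ] -[1+ 1 ] -[1+ 0 ] 1 6 4 2 ≡.refl ≡.refl ≡.refl ≡.refl
      searched₁ ≡.refl em
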